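{- Let $\mathcal{R}$ be a cylinder and $t$ a tiling of $\mathcal{R}$. The twist $\mathrm{Tw}(t)$ is an integer, and: (i) if a tiling $t_1$ of $\mathcal{R}$ is obtained from a tiling $t_0$ by a flip, then $\mathrm{Tw}(t_1)=\mathrm{Tw}(t_0)$; (ii) if a tiling $t_1$ of $\mathcal{R}$ is obtained from a tiling $t_0$ by a single positive trit, then $\mathrm{Tw}(t_1)-\mathrm{Tw}(t_0)=1$; (iii) if $\mathcal{R}=\mathcal{D}\times[0,2]$ is a duplex region, then $\mathrm{Tw}(t)=P_t'(1)$ for every tiling $t$ of $\mathcal{R}$; (iv) if $\mathcal{R}=\bigcup_{1\le i\le m}\mathcal{R}_i$ where each $\mathcal{R}_i$ is a cylinder (not necessarily with the same axis) and $\mathrm{int}(\mathcal{R}_i)\cap\mathrm{int}(\mathcal{R}_j)=\emptyset$ for $i\neq j$, then there is a constant $K\in\mathbb{Z}$ such that for every family $(t_i)_{1\le i\le m}$ with $t_i$ a tiling of $\mathcal{R}_i$, $$\mathrm{Tw}\Big(\bigsqcup_{1\le i\le m}t_i\Big)=K+\sum_{1\le i\le m}\mathrm{Tw}(t_i).$$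
   Context: A basic cube is $[x,x+1]\times[y,y+1]\times[z,z+1]$, $(x,y,z)\in\mathbb{Z}^3$; white if $x+y+z$ even, black if odd. A region is a finite union of basic cubes; a domino is the union of two basic cubes sharing a face; a tiling of a region is a covering by dominoes with pairwise disjoint interiors. A flip removes two dominoes whose union is a $2\times2\times1$ box (any orientation, integer vertices) and replaces them by the other pair of dominoes tiling that box. Trits: let $B=[l,l+2]\times[m,m+2]\times[n,n+2]$ ($l,m,n\in\mathbb{Z}$) and suppose exactly three dominoes of a tiling $t$ of $\mathcal{R}$ lie in $B\cap\mathcal{R}$, pairwise non-parallel. They cover six cubes of $B$; the other two cubes $h,h'$ are opposite corners of $B$. Replacing the three dominoes by the unique other set of three dominoes covering the same six cubes is a trit. Each of these dominoes consists of a cube $a$ sharing a face with $h$ and a cube $b$ sharing a face with $h'$; with $c_X$ the center of cube $X$, $\chi=\det(c_a-c_h,c_b-c_a,c_{h'}-c_b)\in\{\pm1\}$ is independent of the choices; the trit is positive if the new dominoes have $\chi=+1$ (the removed ones having $\chi=-1$). Let $\Delta=\{e_x,e_y,e_z\}$ be the standard basis and $\Phi=\{\pm e_x,\pm e_y,\pm e_z\}$. A basic plane is a plane $x=k$, $y=k$ or $z=k$ with $k\in\mathbb{Z}$; a planar region in it is a finite union of unit squares with integer vertices. A cylinder is $\mathcal{R}=\mathcal{D}+[0,N]w=\{p+sw: p\in\mathcal{D}, s\in[0,N]\}$ where $w\in\Delta$, $\mathcal{D}$ is a simply connected planar region with connected interior in a basic plane with normal $w$, and $N$ is a positive integer (axis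 $w$, depth $N$). For a domino $d$ let $v(d)\in\Phi$ be the center of its black cube minus the center of its white cube. For $X\subset\mathbb{R}^3$ and $u\in\Phi$ let $S^u(X)$ be the interior of $(X+[0,\infty)u)\setminus X$. For dominoes $d_0,d_1$ set $\tau^u(d_0,d_1)=\tfrac14\det(v(d_1),v(d_0),u)$ if $d_1\cap S^u(d_0)\neq\emptyset$, and $0$ otherwise. The $u$-pretwist of a tiling $t$ is $T^u(t)=\sum_{d_0,d_1\in t}\tau^u(d_0,d_1)$ (sum over ordered pairs). For a tiling $t$ of a cylinder, $T^{e_x}(t)=T^{e_y}(t)=T^{e_z}(t)$, and this common value is the twist $\mathrm{Tw}(t)$. For a duplex region $\mathcal{D}\times[0,2]$ ($\mathcal{D}\subset\mathbb{R}^2$ simply connected with connected interior), $P_t$ is defined as follows: the unit square $[x,x+1]\times[y,y+1]$ has $c=1$ (black) if $x+y$ is even and $c=-1$ (white) if odd; orient each domino from the center of its white cube to that of its black cube and project onto $z=0$; dominoes parallel to $e_z$ project onto single squares (jewels), the others onto oriented unit segments forming disjoint oriented closed curves; for a jewel $j$ with center $p_j$ put $k_t(j)=\sum_\gamma\mathrm{wind}(\gamma,p_j)$ over these curves, and $P_t(q)=\sum_j c(j)q^{k_t(j)}$. -}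

module Defs where

open import Data.Nat as ℕ using (ℕ; zero; suc)
open import Data.Integer as ℤ using (ℤ; +_; -[1+_]; ∣_∣)
open import Data.Integer.Properties using () renaming (_≟_ to _≟ℤ_; _<?_ to _<?ℤ_)
open import Data.Rational as ℚ using (ℚ; 0ℚ)
open import Data.Bool using (Bool; true; false; _∧_; _∨_; not; if_then_else_)
open import Data.List using (List; []; _∷_; foldr; map; concatMap)
open import Data.Bool.ListAction using (any)
open import Data.List.Membership.Propositional using (_∈_; _∉_)
open import Data.List.Relation.Unary.All using (All)
open import Data.List.Relation.Unary.Any using (Any)
open import Data.List.Relation.Unary.AllPairs using (AllPairs)
open import Data.Product using (Σ; ∃; _×_; _,_)
open import Data.Sum using (_⊎_)
open import Relation.Binary.PropositionalEquality using (_≡_; _≢_)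
open import Relation.Nullary using (¬_)
open import Relation.Nullary.Decidable using (⌊_⌋)
open import Function.Bundles using (_⇔_)

record V3 : Set where
  constructor v3
  field
    x y z : ℤ
open V3 public

infixl 6 _⊕_ _⊖_

_⊕_ : V3 → V3 → V3
a ⊕ b = v3 (x a ℤ.+ x b) (y a ℤ.+ y b) (z a ℤ.+ z b)

_⊖_ : V3 → V3 → V3
a ⊖ b = v3 (x a ℤ.- x b) (y a ℤ.- y b) (z a ℤ.- z b)

scale : ℤ → V3 → V3
scale k a = v3 (k ℤ.* x a) (k ℤ.* y a) (k ℤ.* z a)

dot : V3 → V3 → ℤ
dot a b = x a ℤ.* x b ℤ.+ y a ℤ.* y b ℤ.+ z a ℤ.* z b

det : V3 → V3 → V3 → ℤ
det a b c =
  x a ℤ.* (y b ℤ.* z c ℤ.- z b ℤ.* y c)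
  ℤ.- x b ℤ.* (y a ℤ.* z c ℤ.- z a ℤ.* y c)
  ℤ.+ x c ℤ.* (y a ℤ.* z b ℤ.- z a ℤ.* y b)

eqV : V3 → V3 → Bool
eqV a b = ⌊ x a ≟ℤ x b ⌋ ∧ ⌊ y a ≟ℤ y b ⌋ ∧ ⌊ z a ≟ℤ z b ⌋

-- Basic cubes: the cube [x,x+1]×[y,y+1]×[z,z+1] is represented by its
-- lower corner (x,y,z).  Differences of cube centers = differences of
-- lower corners.

Cube : Set
Cube = V3

IsWhite : Cube → Set
IsWhite c = ∣ x c ℤ.+ y c ℤ.+ z c ∣ ℕ.% 2 ≡ 0

data Dir : Set where
  +x -x +y -y +z -z : Dir

vec : Dir → V3
vec +x = v3 (+ 1) (+ 0) (+ 0)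
vec -x = v3 (ℤ.- (+ 1)) (+ 0) (+ 0)
vec +y = v3 (+ 0) (+ 1) (+ 0)
vec -y = v3 (+ 0) (ℤ.- (+ 1)) (+ 0)
vec +z = v3 (+ 0) (+ 0) (+ 1)
vec -z = v3 (+ 0) (+ 0) (ℤ.- (+ 1))

data Axis : Set where
  ax ay az : Axis

axisOf : Dir → Axis
axisOf +x = ax
axisOf -x = ax
axisOf +y = ay
axisOf -y = ay
axisOf +z = az
axisOf -z = az

unit : Axis → V3
unit ax = vec +x
unit ay = vec +y
unit az = vec +z

-- Dominoes: a domino is given by its white cube and the direction
-- v(d) ∈ Φ from the centre of its white cube to the centre of its
-- black cube.  (Whiteness of the stored cube is required in IsTiling.)

record Domino : Set where
  constructor dom
  field
    wc  : Cube
    dir : Dir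
open Domino public

bc : Domino → Cube
bc d = wc d ⊕ vec (dir d)

v : Domino → V3
v d = vec (dir d)

cells : Domino → List Cube
cells d = wc d ∷ bc d ∷ []

Covers : Domino → Cube → Set
Covers d c = c ≡ wc d ⊎ c ≡ bc d

HasCells : Domino → Cube → Cube → Set
HasCells d a b = (wc d ≡ a × bc d ≡ b) ⊎ (wc d ≡ b × bc d ≡ a)

Region : Set₁
Region = Cube → Set

IsTiling : Region → List Domino → Set
IsTiling R t =
  All (λ d → IsWhite (wc d)) t ×
  All (λ d → ∀ c → Covers d c → R c) t ×
  (∀ c → R c → Any (λ d → Covers d c) t) ×
  AllPairs (λ d d′ → ∀ c → Covers d c → ¬ Covers d′ c) t

ray : Cube → V3 → Cube → Bool
ray c u q = ⌊ + 0 <?ℤ dot (q ⊖ c) u ⌋ ∧ eqV (q ⊖ c) (scale (dot (q ⊖ c) u) u)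

memB : Cube → List Cube → Bool
memB q cs = any (eqV q) cs

-- d₁ ∩ S^u(d₀) ≠ ∅ : some cube of d₁ lies in (d₀ + [0,∞)u) and not in d₀
hits : Domino → V3 → Domino → Bool
hits d₀ u d₁ =
  any (λ q → not (memB q (cells d₀)) ∧ any (λ c → ray c u q) (cells d₀)) (cells d₁)

τ : Dir → Domino → Domino → ℚ
τ u d₀ d₁ = if hits d₀ (vec u) d₁ then det (v d₁) (v d₀) (vec u) ℚ./ 4 else 0ℚ

sumℚ : List ℚ → ℚ
sumℚ = foldr ℚ._+_ 0ℚ

pretwist : Dir → List Domino → ℚ
pretwist u t = sumℚ (concatMap (λ d₀ → map (λ d₁ → τ u d₀ d₁) t) t)

-- For cylinders T^{e_x} = T^{e_y} = T^{e_z}; the twist is this common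
-- value, here taken as T^{e_z}.
Tw : List Domino → ℚ
Tw t = pretwist +z t

-- a unit square in a basic plane, by its lower corner in the two
-- coordinates orthogonal to the normal
Sq : Set
Sq = ℤ × ℤ

SqAdj : Sq → Sq → Set
SqAdj (a , b) (a′ , b′) =
  (a ≡ a′ × (b′ ≡ b ℤ.+ + 1 ⊎ b ≡ b′ ℤ.+ + 1)) ⊎
  (b ≡ b′ × (a′ ≡ a ℤ.+ + 1 ⊎ a ≡ a′ ℤ.+ + 1))

data Conn (P : Sq → Set) : Sq → Sq → Set where
  here : ∀ {s} → P s → Conn P s s
  step : ∀ {s s′ s″} → P s → SqAdj s s′ → Conn P s′ s″ → Conn P s s″

-- D (a finite union of unit squares) is nonempty, has connected
-- interior, and is simply connected (⇔ its complement is connected).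
IsCylBase : List Sq → Set
IsCylBase D =
  D ≢ [] ×
  (∀ s s′ → s ∈ D → s′ ∈ D → Conn (_∈ D) s s′) ×
  (∀ s s′ → s ∉ D → s′ ∉ D → Conn (_∉ D) s s′)

record Cylinder : Set where
  constructor cyl
  field
    axis  : Axis
    level : ℤ
    base  : List Sq
    depth : ℕ
open Cylinder public

proj : Axis → Cube → Sq
proj ax c = (y c , z c)
proj ay c = (x c , z c)
proj az c = (x c , y c)

along : Axis → Cube → ℤ
along ax c = x c
along ay c = y c
along az c = z c

IsCylinder : Cylinder → Set
IsCylinder C = IsCylBase (base C) × 1 ℕ.≤ depth C

InCyl : Cylinder → Region
InCyl C c =
  proj (axis C) c ∈ base C ×
  level C ℤ.≤ along (axis C) c ×
  along (axis C) c ℤ.< level C ℤ.+ + depth C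

duplex : List Sq → Cylinder
duplex D = cyl az (+ 0) D 2

Replaces : List Domino → List Domino → List Domino → List Domino → Set
Replaces t₀ A B t₁ =
  All (_∈ t₀) A × (∀ d → d ∈ t₁ ⇔ ((d ∈ t₀ × d ∉ A) ⊎ d ∈ B))

Flip : List Domino → List Domino → Set
Flip t₀ t₁ =
  Σ Cube λ c → Σ Axis λ i → Σ Axis λ j → i ≢ j ×
  Σ Domino λ d₁ → Σ Domino λ d₂ → Σ Domino λ e₁ → Σ Domino λ e₂ →
    HasCells d₁ c (c ⊕ unit i) ×
    HasCells d₂ (c ⊕ unit j) (c ⊕ unit j ⊕ unit i) ×
    HasCells e₁ c (c ⊕ unit j) ×
    HasCells e₂ (c ⊕ unit i) (c ⊕ unit i ⊕ unit j) ×
    Replaces t₀ (d₁ ∷ d₂ ∷ []) (e₁ ∷ e₂ ∷ []) t₁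

InBox : Cube → Cube → Set
InBox B c =
  (x B ℤ.≤ x c × x c ℤ.≤ x B ℤ.+ + 1) ×
  (y B ℤ.≤ y c × y c ℤ.≤ y B ℤ.+ + 1) ×
  (z B ℤ.≤ z c × z c ℤ.≤ z B ℤ.+ + 1)

DomInBox : Cube → Domino → Set
DomInBox B d = InBox B (wc d) × InBox B (bc d)

NonParallel : Domino → Domino → Set
NonParallel d d′ = axisOf (dir d) ≢ axisOf (dir d′)

Cov3 : Domino → Domino → Domino → Cube → Set
Cov3 a b c q = Covers a q ⊎ Covers b q ⊎ Covers c q

Disj : Domino → Domino → Set
Disj d d′ = ∀ q → Covers d q → ¬ Covers d′ q

OneOf3 : Domino → Domino → Domino → Domino → Set
OneOf3 e a b c = e ≡ a ⊎ e ≡ b ⊎ e ≡ c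

FaceAdj : Cube → Cube → Set
FaceAdj h a = ∃ λ δ → a ≡ h ⊕ vec δ

ChiPlus : Cube → Cube → Domino → Set
ChiPlus h h′ e =
  Σ Cube λ a → Σ Cube λ b →
    HasCells e a b × FaceAdj h a × FaceAdj b h′ ×
    det (a ⊖ h) (b ⊖ a) (h′ ⊖ b) ≡ + 1

PositiveTrit : List Domino → List Domino → Set
PositiveTrit t₀ t₁ =
  Σ Cube λ B →
  Σ Domino λ d₁ → Σ Domino λ d₂ → Σ Domino λ d₃ →
  Σ Domino λ e₁ → Σ Domino λ e₂ → Σ Domino λ e₃ →
    (DomInBox B d₁ × DomInBox B d₂ × DomInBox B d₃) ×
    (NonParallel d₁ d₂ × NonParallel d₁ d₃ × NonParallel d₂ d₃) ×
    (∀ d → d ∈ t₀ → DomInBox B d → OneOf3 d d₁ d₂ d₃) ×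
    (∀ q → Cov3 e₁ e₂ e₃ q ⇔ Cov3 d₁ d₂ d₃ q) ×
    (Disj e₁ e₂ × Disj e₁ e₃ × Disj e₂ e₃) ×
    ¬ (OneOf3 e₁ d₁ d₂ d₃ × OneOf3 e₂ d₁ d₂ d₃ × OneOf3 e₃ d₁ d₂ d₃) ×
    Replaces t₀ (d₁ ∷ d₂ ∷ d₃ ∷ []) (e₁ ∷ e₂ ∷ e₃ ∷ []) t₁ ×
    (Σ Cube λ h → Σ Cube λ h′ →
       InBox B h × InBox B h′ × h ≢ h′ ×
       ¬ Cov3 d₁ d₂ d₃ h × ¬ Cov3 d₁ d₂ d₃ h′ ×
       ChiPlus h h′ e₁ × ChiPlus h h′ e₂ × ChiPlus h h′ e₃)

sqColour : ℤ → ℤ → ℤ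
sqColour a b = if ⌊ ∣ a ℤ.+ b ∣ ℕ.% 2 ℕ.≟ 0 ⌋ then + 1 else ℤ.- (+ 1)

isVert : Domino → Bool
isVert d with axisOf (dir d)
... | az = true
... | _  = false

-- Signed crossing of the projected oriented segment of d with the ray
-- from the centre of square (p,q) in direction +e_x (half-open rule, i.e.
-- the standard computation of winding numbers of closed polygonal curves).
-- Only projections of dominoes parallel to e_y are transversal to the ray.
crossing : ℤ → ℤ → Domino → ℤ
crossing p q d with dir d
... | +y = if ⌊ p <?ℤ x (wc d) ⌋ ∧ ⌊ y (wc d) ≟ℤ q ⌋ then + 1 else + 0
... | -y = if ⌊ p <?ℤ x (bc d) ⌋ ∧ ⌊ y (bc d) ≟ℤ q ⌋ then ℤ.- (+ 1) else + 0
... | _  = + 0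

sumℤ : List ℤ → ℤ
sumℤ = foldr ℤ._+_ (+ 0)

-- k_t(j): total winding number of the projected curves around the jewel
-- at square (p,q)
windAt : List Domino → ℤ → ℤ → ℤ
windAt t p q = sumℤ (map (crossing p q) t)

-- P_t′(1) = Σ_{jewels j} c(j) k_t(j), for P_t(q) = Σ_j c(j) q^{k_t(j)}
Pderiv1 : List Domino → ℤ
Pderiv1 t =
  sumℤ (map (λ d → if isVert d
                     then sqColour (x (wc d)) (y (wc d)) ℤ.* windAt t (x (wc d)) (y (wc d))
                     else + 0) t)

{-# OPTIONS --safe #-}
module Submission where

-- Regard a domino as an arrow from its white to its black cube.  Then 4 Tw(t) = B(t, t) for a
-- bilinear crossing kernel B (KB below), and S(f, g) = B(f, g) + B(g, f) (KS) is a linking number: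
-- the circulation of the 1-form S(·, g) around a unit square is the flux of g through the square,
-- plus the value of the boundary of g on a function for which black and white cancel as soon as g
-- fills a cylinder.
--
-- A flip changes a tiling by one square through which the other dominoes have no flux.  A trit
-- changes it by the three squares at a corner h of the box, whose flux is that of the domino at h.
--
-- A closed 1-form on a cylinder integrates to zero over closed chains: pushing along the axis
-- reduces this to the base, where a closed chain bounds its winding numbers, and these vanish off
-- the base because its complement is connected.  Hence the linking of a tiling of one cylinder
-- with tilings of the others does not depend on the tilings, which gives (iv).  For (iii), the
-- planar Stokes formula is applied to the form given by crossings with the lower layer; its curl
-- sits at the jewels.
--
-- For a vertical axis, B(t, t) differs from 4 times the signed crossings of a generic push-off only
-- by boundary terms, and these are 0 mod 4 by the parity of the layers.  The linking kernels for
-- projections along z and along x differ by boundary terms too, which vanish on a cylinder with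
-- axis x; so its twist is that of the rotated tiling, and a reflection deals with the axis y.

open import Defs
open import Data.Nat as ℕ using (ℕ; zero; suc)
import Data.Nat.Properties as ℕP
import Data.Nat.DivMod as ℕDM
open import Data.Integer as ℤ using (ℤ; +_; -[1+_]; _+_; _*_; _-_; -_; ∣_∣)
import Data.Integer.Properties as ℤP
open import Data.Integer.Tactic.RingSolver using (solve-∀)
open import Data.Bool using (Bool; true; false; if_then_else_; _∧_; _∨_; not)
open import Data.Fin using (Fin)
import Data.Fin as Fin
open import Data.List using (List; []; _∷_; _++_; map; concatMap; concat; tabulate; filter; deduplicate; cartesianProductWith)
open import Data.List.Relation.Unary.Any as Any using (Any; here; there)
open import Data.List.Relation.Unary.All as All using (All; []; _∷_)
import Data.List.Properties as ListP
import Data.List.Relation.Unary.All.Properties as AllP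
import Data.List.Relation.Unary.AllPairs.Properties as AllPairsP
open import Data.List.Relation.Unary.AllPairs using (AllPairs; []; _∷_)
open import Data.List.Relation.Unary.Unique.Propositional using (Unique)
import Data.List.Relation.Unary.Unique.Propositional.Properties as UniqueP
import Data.List.Relation.Binary.Permutation.Propositional.Properties as PermP
import Data.List.Relation.Unary.Unique.DecPropositional.Properties as DecUniqueP
open import Data.List.Relation.Binary.Permutation.Propositional as Perm using (_↭_; ↭-sym; ↭-trans; ↭-prep)
open import Data.List.Relation.Binary.Permutation.Propositional.Properties using (shift; ∈-resp-↭; All-resp-↭)
open import Data.List.Membership.Propositional using (_∈_; _∉_; find; lose)
open import Data.List.Membership.Propositional.Properties using (∈-∃++; ∈-++⁺ˡ; ∈-++⁺ʳ; ∈-++⁻; ∈-map⁺; ∈-map⁻; ∈-filter⁺; ∈-filter⁻; ∈-cartesianProductWith⁺; ∈-cartesianProductWith⁻; ∈-deduplicate⁺; ∈-deduplicate⁻; ∈-concat⁺′; ∈-concat⁻′; ∈-tabulate⁺; ∈-tabulate⁻)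
import Data.List.Membership.DecPropositional as DecMembership
open import Data.Product using (Σ; ∃; _×_; _,_; proj₁; proj₂)
open import Data.Product.Properties using (≡-dec)
open import Data.Sum using (_⊎_; inj₁; inj₂)
open import Data.Empty using (⊥; ⊥-elim)
open import Data.Rational as ℚ using (ℚ; 0ℚ; 1ℚ)
import Data.Rational.Properties as ℚP
import Data.Rational.Unnormalised as ℚᵘ
import Data.Rational.Unnormalised.Properties as ℚᵘP
open import Function.Bundles using (_⇔_; Equivalence)
open import Relation.Binary.PropositionalEquality using (_≡_; _≢_; refl; sym; trans; cong; cong₂; subst; module ≡-Reasoning)
open import Relation.Nullary using (¬_; Dec; yes; no)
open import Relation.Nullary.Decidable using (⌊_⌋; map′; _×-dec_; ¬?; _→-dec_; _⊎-dec_; from-yes)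

-- Tilings are not closed curves, so a crossing count of tilings is a linking number only up to
-- error terms. Each error is the boundary of a chain, evaluated on an explicit function. The
-- boundary of a tiling depends only on the coloured cells of the region, and it vanishes on a
-- function that is invariant under a reflection exchanging neighbouring cells, because such a
-- reflection reverses colours. What has to be checked is that the reflected cell stays in the
-- region; it does because a cylinder is a product. The 4 of a positive trit is 2 + 1 + 1: the three
-- dominoes cross each other with total 1 after the trit and -1 before it, the flux at `h` gives 1,
-- and the boundary of the removed dominoes gives 1. In a duplex region the 4 comes from the four
-- corners of a jewel. The constant of (iv) has to be chosen before any tilings are given, and a
-- cylinder may have none. It is therefore computed on chains built from the connectedness of the
-- bases alone; integrals of closed forms depend only on the boundary of a chain.

-- Step functions of integer differences

mI dI sI tI : ℤ → ℤ
mI (+ 0) = + 1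
mI (+ 1) = + 1
mI _ = + 0
dI (+ 0) = + 1
dI _ = + 0
sI (+ 0) = + 0
sI (+ suc _) = + 1
sI -[1+ _ ] = - + 1
tI (+ suc _) = + 1
tI _ = + 0

-- `mm p q` tests whether a cube with coordinate `p` is an end of the unit arrow starting at
-- coordinate `q`. The increments of the sign `ss` are values of `mm`, and those of the step
-- function `θ` are values of the Kronecker delta `dd`; this is why the kernels below differ from
-- each other by differentials.
mm dd ss θ : ℤ → ℤ → ℤ
mm p q = mI (p - q)
dd p q = dI (p - q)
ss p q = sI (p - q)
θ p q = tI (p - q)

private
  up-sub : ∀ p q → (p + + 1) - q ≡ (p - q) + + 1
  up-sub = solve-∀
  neg-sub : ∀ p q → q - p ≡ - (p - q)
  neg-sub = solve-∀
  up-both : ∀ p q → (p + + 1) - (q + + 1) ≡ p - q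
  up-both = solve-∀
  sub-up : ∀ p q → p - (q + + 1) ≡ (p - q) - + 1
  sub-up = solve-∀
  ≡up : ∀ p q → p - q ≡ p - (q + + 1) + + 1
  ≡up = solve-∀

  mI-flip : ∀ n → mI (n + + 1) ≡ mI (- n)
  mI-flip (+ 0) = refl
  mI-flip (+ 1) = refl
  mI-flip (+ suc (suc k)) = refl
  mI-flip -[1+ 0 ] = refl
  mI-flip -[1+ suc k ] = refl

  sI-up : ∀ n → sI (n + + 1) ≡ sI n + mI (- n)
  sI-up (+ 0) = refl
  sI-up (+ 1) = refl
  sI-up (+ suc (suc k)) = refl
  sI-up -[1+ 0 ] = refl
  sI-up -[1+ suc k ] = refl

  tI-up : ∀ n → tI (n + + 1) ≡ tI n + dI n
  tI-up (+ 0) = refl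
  tI-up (+ 1) = refl
  tI-up (+ suc (suc k)) = refl
  tI-up -[1+ 0 ] = refl
  tI-up -[1+ suc k ] = refl

  mI-split : ∀ n → mI n ≡ dI n + dI (n - + 1)
  mI-split (+ 0) = refl
  mI-split (+ 1) = refl
  mI-split (+ suc (suc k)) = refl
  mI-split -[1+ 0 ] = refl
  mI-split -[1+ suc k ] = refl

  dI-neg : ∀ n → dI (- n) ≡ dI n
  dI-neg (+ 0) = refl
  dI-neg (+ suc k) = refl
  dI-neg -[1+ k ] = refl

  sI-neg : ∀ n → sI (- n) ≡ - sI n
  sI-neg (+ 0) = refl
  sI-neg (+ suc k) = refl
  sI-neg -[1+ k ] = refl

  sI-tI : ∀ n → sI n ≡ tI n - tI (- n)
  sI-tI (+ 0) = refl
  sI-tI (+ suc k) = refl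
  sI-tI -[1+ k ] = refl

-- The upper end of the unit interval at `p` lies in the one at `q` exactly when the lower end of
-- the latter lies in the former. Moving to the other end of an arrow thus exchanges the arguments
-- of `mm`.
mm-flip : ∀ p q → mm (p + + 1) q ≡ mm q p
mm-flip p q rewrite up-sub p q | neg-sub p q = mI-flip (p - q)

ss-up : ∀ p q → ss (p + + 1) q ≡ ss p q + mm q p
ss-up p q rewrite up-sub p q | neg-sub p q = sI-up (p - q)

ss-anti : ∀ p q → ss q p ≡ - ss p q
ss-anti p q rewrite neg-sub p q = sI-neg (p - q)

ss-θ : ∀ p q → ss p q ≡ θ p q - θ q p
ss-θ p q rewrite neg-sub p q = sI-tI (p - q)

ss-upʳ : ∀ p q → ss p (q + + 1) ≡ ss p q - mm p q
ss-upʳ p q = begin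
  ss p (q + + 1)       ≡⟨ ss-anti (q + + 1) p ⟩
  - ss (q + + 1) p     ≡⟨ cong -_ (ss-up q p) ⟩
  - (ss q p + mm p q)  ≡⟨ cong (λ w → - (w + mm p q)) (ss-anti p q) ⟩
  - (- ss p q + mm p q) ≡⟨ l (ss p q) (mm p q) ⟩
  ss p q - mm p q ∎
  where
  open ≡-Reasoning
  l : ∀ a b → - (- a + b) ≡ a - b
  l = solve-∀

θ-up : ∀ p q → θ (p + + 1) q ≡ θ p q + dd p q
θ-up p q rewrite up-sub p q = tI-up (p - q)

θ-upʳ : ∀ p q → θ p (q + + 1) ≡ θ p q - dd p (q + + 1)
θ-upʳ p q rewrite ≡up p q | tI-up (p - (q + + 1)) = l (tI (p - (q + + 1))) (dI (p - (q + + 1)))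
  where
  l : ∀ a b → a ≡ a + b - b
  l = solve-∀

mm-split : ∀ p q → mm p q ≡ dd p q + dd p (q + + 1)
mm-split p q rewrite sub-up p q = mI-split (p - q)

dd-sym : ∀ p q → dd q p ≡ dd p q
dd-sym p q rewrite neg-sub p q = dI-neg (p - q)

dd-up : ∀ p q → dd (p + + 1) (q + + 1) ≡ dd p q
dd-up p q rewrite up-both p q = refl

private
  diff0 : ∀ p q → p - q ≡ + 0 → p ≡ q
  diff0 p q e = ℤP.i-j≡0⇒i≡j p q e
  addback : ∀ p q → p ≡ (p - q) + q
  addback = solve-∀

  mI-cases : ∀ n → mI n ≡ + 0 ⊎ (mI n ≡ + 1 × (n ≡ + 0 ⊎ n ≡ + 1))
  mI-cases (+ 0) = inj₂ (refl , inj₁ refl)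
  mI-cases (+ 1) = inj₂ (refl , inj₂ refl)
  mI-cases (+ suc (suc k)) = inj₁ refl
  mI-cases -[1+ k ] = inj₁ refl

  dI-cases : ∀ n → dI n ≡ + 0 ⊎ (dI n ≡ + 1 × n ≡ + 0)
  dI-cases (+ 0) = inj₂ (refl , refl)
  dI-cases (+ suc k) = inj₁ refl
  dI-cases -[1+ k ] = inj₁ refl

mm-cases : ∀ p q → mm p q ≡ + 0 ⊎ (mm p q ≡ + 1 × (p ≡ q ⊎ p ≡ q + + 1))
mm-cases p q with mI-cases (p - q)
... | inj₁ e = inj₁ e
... | inj₂ (e , inj₁ e′) = inj₂ (e , inj₁ (diff0 p q e′))
... | inj₂ (e , inj₂ e′) = inj₂ (e , inj₂ (trans (addback p q) (trans (cong (_+ q) e′) (ℤP.+-comm (+ 1) q))))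

dd-cases : ∀ p q → dd p q ≡ + 0 ⊎ (dd p q ≡ + 1 × p ≡ q)
dd-cases p q with dI-cases (p - q)
... | inj₁ e = inj₁ e
... | inj₂ (e , e′) = inj₂ (e , diff0 p q e′)

dd-refl : ∀ p → dd p p ≡ + 1
dd-refl p rewrite ℤP.+-inverseʳ p = refl

mm-refl : ∀ p → mm p p ≡ + 1
mm-refl p rewrite ℤP.+-inverseʳ p = refl

par : ℤ → ℤ
par n = if ⌊ ∣ n ∣ ℕ.% 2 ℕ.≟ 0 ⌋ then + 1 else - (+ 1)

private
  parℕ-suc : ∀ k → par (+ suc k) ≡ - par (+ k)
  parℕ-suc 0 = refl
  parℕ-suc 1 = refl
  parℕ-suc (suc (suc k)) = parℕ-suc k

par-up : ∀ n → par (n + + 1) ≡ - par n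
par-up (+ k) rewrite ℕP.+-comm k 1 = parℕ-suc k
par-up -[1+ 0 ] = refl
par-up -[1+ suc k ] rewrite parℕ-suc (suc k) = sym (ℤP.neg-involutive _)

par-neg : ∀ n → par (- n) ≡ par n
par-neg n rewrite ℤP.∣-i∣≡∣i∣ n = refl

par-square : ∀ n → par n * par n ≡ + 1
par-square n with ⌊ ∣ n ∣ ℕ.% 2 ℕ.≟ 0 ⌋
... | true = refl
... | false = refl

+-congˡ : ∀ k {m n : ℤ} → m ≡ n → k + m ≡ k + n
+-congˡ k refl = refl

-- Finite sums and lists without repetition

∑ : {A : Set} → List A → (A → ℤ) → ℤ
∑ xs f = sumℤ (map f xs)

private
  variable
    X X′ : Set

∑-cong : ∀ (xs : List X) {f g : X → ℤ} → (∀ a → a ∈ xs → f a ≡ g a) → ∑ xs f ≡ ∑ xs g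
∑-cong [] e = refl
∑-cong (a ∷ xs) e = cong₂ _+_ (e a (here refl)) (∑-cong xs (λ b m → e b (there m)))

∑-zero : ∀ (xs : List X) {f : X → ℤ} → (∀ a → a ∈ xs → f a ≡ + 0) → ∑ xs f ≡ + 0
∑-zero [] e = refl
∑-zero (a ∷ xs) e = cong₂ _+_ (e a (here refl)) (∑-zero xs (λ b m → e b (there m)))

∑-+ : ∀ (xs : List X) (f g : X → ℤ) → ∑ xs (λ a → f a + g a) ≡ ∑ xs f + ∑ xs g
∑-+ [] f g = refl
∑-+ (a ∷ xs) f g rewrite ∑-+ xs f g = l (f a) (g a) (∑ xs f) (∑ xs g)
  where
  l : ∀ a b c d → a + b + (c + d) ≡ a + c + (b + d)
  l = solve-∀

∑-* : ∀ (xs : List X) k (f : X → ℤ) → ∑ xs (λ a → k * f a) ≡ k * ∑ xs f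
∑-* [] k f = sym (ℤP.*-zeroʳ k)
∑-* (a ∷ xs) k f rewrite ∑-* xs k f = sym (ℤP.*-distribˡ-+ k (f a) (∑ xs f))

∑-neg : ∀ (xs : List X) (f : X → ℤ) → ∑ xs (λ a → - f a) ≡ - ∑ xs f
∑-neg [] f = refl
∑-neg (a ∷ xs) f rewrite ∑-neg xs f = sym (ℤP.neg-distrib-+ (f a) (∑ xs f))

∑-- : ∀ (xs : List X) (f g : X → ℤ) → ∑ xs (λ a → f a - g a) ≡ ∑ xs f - ∑ xs g
∑-- xs f g rewrite ∑-+ xs f (λ a → - g a) | ∑-neg xs g = refl

∑-++ : ∀ (xs ys : List X) (f : X → ℤ) → ∑ (xs ++ ys) f ≡ ∑ xs f + ∑ ys f
∑-++ [] ys f = sym (ℤP.+-identityˡ _)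
∑-++ (a ∷ xs) ys f rewrite ∑-++ xs ys f = sym (ℤP.+-assoc (f a) (∑ xs f) (∑ ys f))

∑-map : ∀ (g : X′ → X) xs (f : X → ℤ) → ∑ (map g xs) f ≡ ∑ xs (λ a → f (g a))
∑-map g [] f = refl
∑-map g (a ∷ xs) f = +-congˡ (f (g a)) (∑-map g xs f)

∑-concatMap : ∀ (g : X′ → List X) xs (f : X → ℤ) → ∑ (concatMap g xs) f ≡ ∑ xs (λ a → ∑ (g a) f)
∑-concatMap g [] f = refl
∑-concatMap g (a ∷ xs) f = begin
  ∑ (g a ++ concatMap g xs) f       ≡⟨ ∑-++ (g a) (concatMap g xs) f ⟩
  ∑ (g a) f + ∑ (concatMap g xs) f  ≡⟨ +-congˡ (∑ (g a) f) (∑-concatMap g xs f) ⟩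
  ∑ (g a) f + ∑ xs (λ b → ∑ (g b) f) ∎
  where open ≡-Reasoning

∑-swap : ∀ (xs : List X) (ys : List X′) (f : X → X′ → ℤ) →
  ∑ xs (λ a → ∑ ys (f a)) ≡ ∑ ys (λ b → ∑ xs (λ a → f a b))
∑-swap [] ys f = sym (∑-zero ys (λ _ _ → refl))
∑-swap (a ∷ xs) ys f rewrite ∑-swap xs ys f = sym (∑-+ ys (f a) (λ b → ∑ xs (λ a → f a b)))

∑-↭ : ∀ {xs ys : List X} (f : X → ℤ) → xs ↭ ys → ∑ xs f ≡ ∑ ys f
∑-↭ f Perm.refl = refl
∑-↭ f (Perm.prep a p) = +-congˡ (f a) (∑-↭ f p)
∑-↭ f (Perm.swap {xs = xs} {ys = ys} a b p) rewrite ∑-↭ f p = l (f a) (f b) (∑ ys f)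
  where
  l : ∀ a b c → a + (b + c) ≡ b + (a + c)
  l = solve-∀
∑-↭ f (Perm.trans p q) = trans (∑-↭ f p) (∑-↭ f q)

AllPairs-resp-↭ : ∀ {R : X → X → Set} {xs ys} → (∀ {a b} → R a b → R b a) →
  xs ↭ ys → AllPairs R xs → AllPairs R ys
AllPairs-resp-↭ s Perm.refl u = u
AllPairs-resp-↭ s (Perm.prep a p) (r ∷ u) = All-resp-↭ p r ∷ AllPairs-resp-↭ s p u
AllPairs-resp-↭ s (Perm.swap a b p) ((r ∷ r₁) ∷ r₂ ∷ u) =
  (s r ∷ All-resp-↭ p r₂) ∷ All-resp-↭ p r₁ ∷ AllPairs-resp-↭ s p u
AllPairs-resp-↭ s (Perm.trans p q) u = AllPairs-resp-↭ s q (AllPairs-resp-↭ s p u)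

-- Reindexing a sum thus needs no explicit permutation, only membership in both directions.
unique-↭ : ∀ {xs ys : List X} → Unique xs → Unique ys →
  (∀ {a} → a ∈ xs → a ∈ ys) → (∀ {a} → a ∈ ys → a ∈ xs) → xs ↭ ys
unique-↭ {xs = []} {[]} u w i j = Perm.refl
unique-↭ {xs = []} {b ∷ ys} u w i j with () ← j (here refl)
unique-↭ {xs = a ∷ xs} {ys} (a∉ ∷ u) w i j with ∈-∃++ (i (here refl))
... | ps , qs , refl = ↭-trans (↭-prep a (unique-↭ u (tail-unique w′) i′ j′)) (↭-sym s)
  where
  s : ps ++ a ∷ qs ↭ a ∷ ps ++ qs
  s = shift a ps qs
  w′ : Unique (a ∷ ps ++ qs)
  w′ = AllPairs-resp-↭ (λ ne e → ne (sym e)) s w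
  tail-unique : ∀ {b : _} {zs} → Unique (b ∷ zs) → Unique zs
  tail-unique (_ ∷ u) = u
  a∉′ : a ∉ ps ++ qs
  a∉′ m with (h ∷ _) ← w′ = All.lookup h m refl
  i′ : ∀ {c} → c ∈ xs → c ∈ ps ++ qs
  i′ m with ∈-resp-↭ s (i (there m))
  ... | here refl = ⊥-elim (All.lookup a∉ m refl)
  ... | there n = n
  j′ : ∀ {c} → c ∈ ps ++ qs → c ∈ xs
  j′ m with j (∈-resp-↭ (↭-sym s) (there m))
  ... | here refl = ⊥-elim (a∉′ m)
  ... | there n = n

-- Arrows, 1-forms and chains

V3-≡ : ∀ {a b : V3} → x a ≡ x b → y a ≡ y b → z a ≡ z b → a ≡ b
V3-≡ refl refl refl = refl

up : Axis → Cube → Cube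
up ax c = v3 (x c + + 1) (y c) (z c)
up ay c = v3 (x c) (y c + + 1) (z c)
up az c = v3 (x c) (y c) (z c + + 1)

⊕-unit : ∀ i c → c ⊕ unit i ≡ up i c
⊕-unit ax c = V3-≡ refl (ℤP.+-identityʳ _) (ℤP.+-identityʳ _)
⊕-unit ay c = V3-≡ (ℤP.+-identityʳ _) refl (ℤP.+-identityʳ _)
⊕-unit az c = V3-≡ (ℤP.+-identityʳ _) (ℤP.+-identityʳ _) refl

-- sg and base′ write the arrow of a domino as ± an arrow in a positive coordinate direction,
-- so that forms and kernels need only be defined on the latter.

sg : Dir → ℤ
sg +x = + 1
sg -x = - + 1
sg +y = + 1
sg -y = - + 1
sg +z = + 1
sg -z = - + 1

baseOf : Dir → Cube → Cube → Cube
baseOf +x w b = w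
baseOf -x w b = b
baseOf +y w b = w
baseOf -y w b = b
baseOf +z w b = w
baseOf -z w b = b

base′ : Domino → Cube
base′ d = baseOf (dir d) (wc d) (bc d)

axis′ : Domino → Axis
axis′ d = axisOf (dir d)

private
  dn-up : ∀ n → n + - + 1 + + 1 ≡ n
  dn-up = solve-∀

arrow-ends : ∀ d → (sg (dir d) ≡ + 1 × base′ d ≡ wc d × up (axis′ d) (base′ d) ≡ bc d)
                 ⊎ (sg (dir d) ≡ - + 1 × base′ d ≡ bc d × up (axis′ d) (base′ d) ≡ wc d)
arrow-ends (dom w +x) = inj₁ (refl , refl , sym (⊕-unit ax w))
arrow-ends (dom w -x) = inj₂ (refl , refl , V3-≡ (dn-up _) (ℤP.+-identityʳ _) (ℤP.+-identityʳ _))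
arrow-ends (dom w +y) = inj₁ (refl , refl , sym (⊕-unit ay w))
arrow-ends (dom w -y) = inj₂ (refl , refl , V3-≡ (ℤP.+-identityʳ _) (dn-up _) (ℤP.+-identityʳ _))
arrow-ends (dom w +z) = inj₁ (refl , refl , sym (⊕-unit az w))
arrow-ends (dom w -z) = inj₂ (refl , refl , V3-≡ (ℤP.+-identityʳ _) (ℤP.+-identityʳ _) (dn-up _))

covers-base : ∀ d → Covers d (base′ d)
covers-base d with arrow-ends d
... | inj₁ (_ , e , _) = inj₁ e
... | inj₂ (_ , e , _) = inj₂ e

covers-up : ∀ d → Covers d (up (axis′ d) (base′ d))
covers-up d with arrow-ends d
... | inj₁ (_ , _ , e) = inj₂ e
... | inj₂ (_ , _ , e) = inj₁ e

covers⁻ : ∀ d {c} → Covers d c → c ≡ base′ d ⊎ c ≡ up (axis′ d) (base′ d)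
covers⁻ d (inj₁ refl) with arrow-ends d
... | inj₁ (_ , e , _) = inj₁ (sym e)
... | inj₂ (_ , _ , e) = inj₂ (sym e)
covers⁻ d (inj₂ refl) with arrow-ends d
... | inj₁ (_ , _ , e) = inj₂ (sym e)
... | inj₂ (_ , e , _) = inj₁ (sym e)

covers⁻′ : ∀ d {c i} → axis′ d ≡ i → Covers d c → c ≡ base′ d ⊎ c ≡ up i (base′ d)
covers⁻′ d refl = covers⁻ d

covers-up′ : ∀ d {i} → axis′ d ≡ i → Covers d (up i (base′ d))
covers-up′ d refl = covers-up d

-- The value belongs to the arrow from `c` to `up i c`; on the opposite arrow `ev` supplies the
-- minus sign.
Form : Set
Form = Axis → Cube → ℤ

ev : Form → Domino → ℤ
ev ℓ d = sg (dir d) * ℓ (axis′ d) (base′ d)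

∂ : (Cube → ℤ) → Form
∂ h i c = h (up i c) - h c

ev-∂ : ∀ h d → ev (∂ h) d ≡ h (bc d) - h (wc d)
ev-∂ h d with arrow-ends d
... | inj₁ (s , e , e′) rewrite s | e′ | e = ℤP.*-identityˡ _
... | inj₂ (s , e , e′) rewrite s | e′ | e = l (h (wc d)) (h (bc d))
  where
  l : ∀ a b → - + 1 * (a - b) ≡ b - a
  l = solve-∀

ev-+ : ∀ ℓ ℓ′ d → ev (λ i c → ℓ i c + ℓ′ i c) d ≡ ev ℓ d + ev ℓ′ d
ev-+ ℓ ℓ′ d = ℤP.*-distribˡ-+ (sg (dir d)) _ _

-- The boundary of a chain, ends minus starts, as a functional on functions of cubes. In this form
-- boundaries are added and compared without counting cubes with multiplicity.
bd : List Domino → (Cube → ℤ) → ℤ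
bd f h = ∑ f (λ d → h (bc d) - h (wc d))

∑-ev-∂ : ∀ f h → ∑ f (ev (∂ h)) ≡ bd f h
∑-ev-∂ f h = ∑-cong f (λ d _ → ev-∂ h d)

-- The pretwist as a quadratic form

Kernel : Set
Kernel = Axis → Cube → Axis → Cube → ℤ

ev² : Kernel → Domino → Domino → ℤ
ev² K a b = ev (λ i c → ev (K i c) b) a

pair : Kernel → List Domino → List Domino → ℤ
pair K f g = ∑ f (λ a → ∑ g (ev² K a))

-- The first arrow is the upper one. The shadows of two perpendicular horizontal dominoes share at
-- most one square, and the product of the two `mm` tests whether they do. The signs are those of
-- `det (v d₁) (v d₀) (vec +z)`.
KB : Kernel
KB ax a ay b = mm (x b) (x a) * mm (y a) (y b) * θ (z a) (z b)
KB ay a ax b = - (mm (x a) (x b) * mm (y b) (y a) * θ (z a) (z b))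
KB _ _ _ _ = + 0

-- An integer that is 1 or 0 according to a property. Boolean tests such as `hits` and products of
-- `mm` and `θ` can then be compared by comparing the properties behind them.
data Ind (P : Set) : ℤ → Set where
  holds : P → Ind P (+ 1)
  fails : ¬ P → Ind P (+ 0)

Ind-unique : ∀ {P Q m n} → Ind P m → Ind Q n → (P → Q) → (Q → P) → m ≡ n
Ind-unique (holds p) (holds q) f g = refl
Ind-unique (holds p) (fails q) f g = ⊥-elim (q (f p))
Ind-unique (fails p) (holds q) f g = ⊥-elim (p (g q))
Ind-unique (fails p) (fails q) f g = refl

Ind-× : ∀ {P Q m n} → Ind P m → Ind Q n → Ind (P × Q) (m * n)
Ind-× (holds p) (holds q) = holds (p , q)
Ind-× (holds p) (fails q) = fails (λ (_ , b) → q b)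
Ind-× (fails p) (holds q) = fails (λ (a , _) → p a)
Ind-× (fails p) (fails q) = fails (λ (a , _) → p a)

mm-ind : ∀ p q → Ind (p ≡ q ⊎ p ≡ q + + 1) (mm p q)
mm-ind p q with mm p q in e | mm-cases p q
... | _ | inj₂ (refl , h) = holds h
... | _ | inj₁ refl = fails λ { (inj₁ refl) → l (trans (sym e) (mm-refl p))
                              ; (inj₂ refl) → l (trans (sym e) (trans (mm-flip q q) (mm-refl q))) }
  where
  l : + 0 ≢ + 1
  l ()

0<i-j⇒j<i : ∀ i j → + 0 ℤ.< i - j → j ℤ.< i
0<i-j⇒j<i i j h = subst (λ w → w ℤ.< i) (ℤP.+-identityˡ j)
  (subst (λ w → + 0 + j ℤ.< w) (l i j) (ℤP.+-monoˡ-< j h))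
  where
  l : ∀ i j → i - j + j ≡ i
  l = solve-∀

i<j⇒0<j-i : ∀ {i j} → i ℤ.< j → + 0 ℤ.< j - i
i<j⇒0<j-i {i} {j} h = subst (λ w → w ℤ.< j - i) (ℤP.+-inverseʳ i) (ℤP.+-monoˡ-< (- i) h)

θ-ind : ∀ p q → Ind (q ℤ.< p) (θ p q)
θ-ind p q with p - q in e
... | + suc n = holds (0<i-j⇒j<i p q (subst (+ 0 ℤ.<_) (sym e) (ℤ.+<+ (ℕ.s≤s ℕ.z≤n))))
... | + 0 = fails λ h → ℤP.<-irrefl (sym e) (i<j⇒0<j-i h)
... | -[1+ n ] = fails λ h → l (subst (+ 0 ℤ.<_) e (i<j⇒0<j-i h))
  where
  l : ∀ {n} → ¬ (+ 0 ℤ.< -[1+ n ])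
  l ()

Above : Cube → Cube → Set
Above c q = x q ≡ x c × y q ≡ y c × z c ℤ.< z q

private
  b2i : Bool → ℤ
  b2i b = if b then + 1 else + 0

  ∨-true : ∀ a b → a ∨ b ≡ true → a ≡ true ⊎ b ≡ true
  ∨-true true b e = inj₁ refl
  ∨-true false b e = inj₂ e

  any₂-true : ∀ {A : Set} (p : A → Bool) a b → p a ∨ (p b ∨ false) ≡ true → p a ≡ true ⊎ p b ≡ true
  any₂-true p a b e with ∨-true (p a) _ e
  ... | inj₁ e′ = inj₁ e′
  ... | inj₂ e′ with ∨-true (p b) _ e′
  ... | inj₁ e″ = inj₂ e″

  any₂ˡ : ∀ {A : Set} (p : A → Bool) a b → p a ≡ true → p a ∨ (p b ∨ false) ≡ true
  any₂ˡ p a b e rewrite e = refl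

  any₂ʳ : ∀ {A : Set} (p : A → Bool) a b → p b ≡ true → p a ∨ (p b ∨ false) ≡ true
  any₂ʳ p a b e rewrite e with p a
  ... | true = refl
  ... | false = refl

  ⌊⌋-true : ∀ {P : Set} (d : Dec P) → ⌊ d ⌋ ≡ true → P
  ⌊⌋-true (yes p) e = p

  true-⌊⌋ : ∀ {P : Set} (d : Dec P) → P → ⌊ d ⌋ ≡ true
  true-⌊⌋ (yes p) _ = refl
  true-⌊⌋ (no ¬p) p = ⊥-elim (¬p p)

  ∧-true : ∀ {a b} → a ∧ b ≡ true → a ≡ true × b ≡ true
  ∧-true {true} {true} e = refl , refl

  true-∧ : ∀ {a b} → a ≡ true → b ≡ true → a ∧ b ≡ true
  true-∧ refl refl = refl

  eqV-true : ∀ a b → eqV a b ≡ true → a ≡ b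
  eqV-true a b e with ∧-true e
  ... | e₁ , e₂ with ∧-true e₂
  ... | e₃ , e₄ = V3-≡ (⌊⌋-true (_ ℤP.≟ _) e₁) (⌊⌋-true (_ ℤP.≟ _) e₃) (⌊⌋-true (_ ℤP.≟ _) e₄)

  true-eqV : ∀ a b → a ≡ b → eqV a b ≡ true
  true-eqV a .a refl = true-∧ (true-⌊⌋ (x a ℤP.≟ x a) refl) (true-∧ (true-⌊⌋ (y a ℤP.≟ y a) refl) (true-⌊⌋ (z a ℤP.≟ z a) refl))

  dot-z : ∀ a b c → a * + 0 + b * + 0 + c * + 1 ≡ c
  dot-z = solve-∀

  times0 : ∀ a → a * + 0 ≡ + 0
  times0 = solve-∀
  times1 : ∀ a → a * + 1 ≡ a
  times1 = solve-∀

  ray-Above : ∀ c q → ray c (vec +z) q ≡ true → Above c q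
  ray-Above c q e rewrite dot-z (x q - x c) (y q - y c) (z q - z c)
    with ∧-true {a = ⌊ + 0 ℤP.<? z q - z c ⌋} e
  ... | e₁ , e₂ with eqV-true (q ⊖ c) (scale (z q - z c) (vec +z)) e₂
  ... | e₃ = ℤP.i-j≡0⇒i≡j (x q) (x c) (trans (cong x e₃) (times0 (z q - z c)))
           , ℤP.i-j≡0⇒i≡j (y q) (y c) (trans (cong y e₃) (times0 (z q - z c)))
           , 0<i-j⇒j<i (z q) (z c) (⌊⌋-true (_ ℤP.<? _) e₁)

  Above-ray : ∀ c q → Above c q → ray c (vec +z) q ≡ true
  Above-ray c q (a , b , h) rewrite dot-z (x q - x c) (y q - y c) (z q - z c) =
    true-∧ (true-⌊⌋ (_ ℤP.<? _) (i<j⇒0<j-i h))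
           (true-eqV _ _ (V3-≡ (trans (ℤP.i≡j⇒i-j≡0 a) (sym (times0 (z q - z c))))
                               (trans (ℤP.i≡j⇒i-j≡0 b) (sym (times0 (z q - z c))))
                               (sym (times1 (z q - z c)))))

  Hit : Domino → Domino → Set
  Hit d₀ d₁ = Σ Cube λ c → Σ Cube λ q → Covers d₀ c × Covers d₁ q × Above c q

  hits-Hit : ∀ d₀ d₁ → hits d₀ (vec +z) d₁ ≡ true → Hit d₀ d₁
  hits-Hit d₀ d₁ e with any₂-true (λ q → not (memB q (cells d₀)) ∧ (ray (wc d₀) (vec +z) q ∨ (ray (bc d₀) (vec +z) q ∨ false))) (wc d₁) (bc d₁) e
  hits-Hit d₀ d₁ e | inj₁ e₁ with any₂-true (λ c → ray c (vec +z) (wc d₁)) (wc d₀) (bc d₀) (proj₂ (∧-true {a = not (memB (wc d₁) (cells d₀))} e₁))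
  ... | inj₁ r = _ , _ , inj₁ refl , inj₁ refl , ray-Above _ _ r
  ... | inj₂ r = _ , _ , inj₂ refl , inj₁ refl , ray-Above _ _ r
  hits-Hit d₀ d₁ e | inj₂ e₁ with any₂-true (λ c → ray c (vec +z) (bc d₁)) (wc d₀) (bc d₀) (proj₂ (∧-true {a = not (memB (bc d₁) (cells d₀))} e₁))
  ... | inj₁ r = _ , _ , inj₁ refl , inj₂ refl , ray-Above _ _ r
  ... | inj₂ r = _ , _ , inj₂ refl , inj₂ refl , ray-Above _ _ r

  -- In `hits` the cubes of `d₀` itself are excluded. For a horizontal `d₀` this is automatic, since
  -- a cube strictly above one of its cubes has a different height; for a vertical one the
  -- determinant in `τ` vanishes.
  Hit-hits : ∀ d₀ d₁ → z (wc d₀) ≡ z (bc d₀) → Hit d₀ d₁ → hits d₀ (vec +z) d₁ ≡ true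
  Hit-hits d₀ d₁ lev (c , q , cov₀ , cov₁ , (a , b , h)) = result cov₁
    where
    not-mem : not (memB q (cells d₀)) ≡ true
    not-mem with memB q (cells d₀) in e
    ... | false = refl
    ... | true = ⊥-elim (ℤP.<-irrefl same h)
      where
      height : ∀ {p} → Covers d₀ p → z p ≡ z (wc d₀)
      height (inj₁ refl) = refl
      height (inj₂ refl) = sym lev
      q-covered : Covers d₀ q
      q-covered with any₂-true (eqV q) (wc d₀) (bc d₀) e
      ... | inj₁ e′ = inj₁ (eqV-true _ _ e′)
      ... | inj₂ e′ = inj₂ (eqV-true _ _ e′)
      same : z c ≡ z q
      same = trans (height cov₀) (sym (height q-covered))
    has-ray : ray (wc d₀) (vec +z) q ∨ (ray (bc d₀) (vec +z) q ∨ false) ≡ true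
    has-ray = go cov₀
      where
      go : Covers d₀ c → ray (wc d₀) (vec +z) q ∨ (ray (bc d₀) (vec +z) q ∨ false) ≡ true
      go (inj₁ refl) = any₂ˡ (λ c → ray c (vec +z) q) (wc d₀) (bc d₀) (Above-ray _ _ (a , b , h))
      go (inj₂ refl) = any₂ʳ (λ c → ray c (vec +z) q) (wc d₀) (bc d₀) (Above-ray _ _ (a , b , h))
    p = λ q → not (memB q (cells d₀)) ∧ (ray (wc d₀) (vec +z) q ∨ (ray (bc d₀) (vec +z) q ∨ false))
    result : Covers d₁ q → hits d₀ (vec +z) d₁ ≡ true
    result (inj₁ refl) = any₂ˡ p (wc d₁) (bc d₁) (true-∧ not-mem has-ray)
    result (inj₂ refl) = any₂ʳ p (wc d₁) (bc d₁) (true-∧ not-mem has-ray)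

  flat : ∀ {d} → z (base′ d) ≡ z (up (axis′ d) (base′ d)) → z (wc d) ≡ z (bc d)
  flat {d} e with arrow-ends d
  ... | inj₁ (_ , a , b) = trans (cong z (sym a)) (trans e (cong z b))
  ... | inj₂ (_ , a , b) = trans (cong z (sym b)) (trans (sym e) (cong z a))

  hits-ind : ∀ d₀ d₁ → z (base′ d₀) ≡ z (up (axis′ d₀) (base′ d₀)) → Ind (Hit d₀ d₁) (b2i (hits d₀ (vec +z) d₁))
  hits-ind d₀ d₁ lev with hits d₀ (vec +z) d₁ in e
  ... | true = holds (hits-Hit d₀ d₁ e)
  ... | false = fails λ h → l (trans (sym e) (Hit-hits d₀ d₁ (flat {d₀} lev) h))
    where
    l : false ≢ true
    l ()

  cross-xy : ∀ d₁ d₀ → axis′ d₁ ≡ ax → axis′ d₀ ≡ ay →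
    mm (x (base′ d₀)) (x (base′ d₁)) * mm (y (base′ d₁)) (y (base′ d₀)) * θ (z (base′ d₁)) (z (base′ d₀))
    ≡ b2i (hits d₀ (vec +z) d₁)
  cross-xy d₁ d₀ e₁ e₀ = Ind-unique (Ind-× (Ind-× (mm-ind _ _) (mm-ind _ _)) (θ-ind _ _))
      (hits-ind d₀ d₁ lev) to from
    where
    p = base′ d₁
    q = base′ d₀
    lev : z q ≡ z (up (axis′ d₀) q)
    lev rewrite e₀ = refl
    cu₁ : Covers d₁ (up ax p)
    cu₁ = covers-up′ d₁ e₁
    cu₀ : Covers d₀ (up ay q)
    cu₀ = covers-up′ d₀ e₀
    -- Four cases: the common square of the two shadows may lie under either cube of `d₁` and over
    -- either cube of `d₀`.
    to : _ → Hit d₀ d₁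
    to ((inj₁ a , inj₁ b) , h) = q , p , covers-base d₀ , covers-base d₁ , sym a , b , h
    to ((inj₁ a , inj₂ b) , h) = up ay q , p , cu₀ , covers-base d₁ , sym a , b , h
    to ((inj₂ a , inj₁ b) , h) = q , up ax p , covers-base d₀ , cu₁ , sym a , b , h
    to ((inj₂ a , inj₂ b) , h) = up ay q , up ax p , cu₀ , cu₁ , sym a , b , h
    from : Hit d₀ d₁ → _
    from (c , c′ , k₀ , k₁ , a , b , h) with covers⁻′ d₀ e₀ k₀ | covers⁻′ d₁ e₁ k₁
    ... | inj₁ refl | inj₁ refl = (inj₁ (sym a) , inj₁ b) , h
    ... | inj₂ refl | inj₁ refl = (inj₁ (sym a) , inj₂ b) , h
    ... | inj₁ refl | inj₂ refl = (inj₂ (sym a) , inj₁ b) , h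
    ... | inj₂ refl | inj₂ refl = (inj₂ (sym a) , inj₂ b) , h

  cross-yx : ∀ d₁ d₀ → axis′ d₁ ≡ ay → axis′ d₀ ≡ ax →
    mm (x (base′ d₁)) (x (base′ d₀)) * mm (y (base′ d₀)) (y (base′ d₁)) * θ (z (base′ d₁)) (z (base′ d₀))
    ≡ b2i (hits d₀ (vec +z) d₁)
  cross-yx d₁ d₀ e₁ e₀ = Ind-unique (Ind-× (Ind-× (mm-ind _ _) (mm-ind _ _)) (θ-ind _ _))
      (hits-ind d₀ d₁ lev) to from
    where
    p = base′ d₁
    q = base′ d₀
    lev : z q ≡ z (up (axis′ d₀) q)
    lev rewrite e₀ = refl
    cu₁ : Covers d₁ (up ay p)
    cu₁ = covers-up′ d₁ e₁
    cu₀ : Covers d₀ (up ax q)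
    cu₀ = covers-up′ d₀ e₀
    to : _ → Hit d₀ d₁
    to ((inj₁ a , inj₁ b) , h) = q , p , covers-base d₀ , covers-base d₁ , a , sym b , h
    to ((inj₁ a , inj₂ b) , h) = q , up ay p , covers-base d₀ , cu₁ , a , sym b , h
    to ((inj₂ a , inj₁ b) , h) = up ax q , p , cu₀ , covers-base d₁ , a , sym b , h
    to ((inj₂ a , inj₂ b) , h) = up ax q , up ay p , cu₀ , cu₁ , a , sym b , h
    from : Hit d₀ d₁ → _
    from (c , c′ , k₀ , k₁ , a , b , h) with covers⁻′ d₀ e₀ k₀ | covers⁻′ d₁ e₁ k₁
    ... | inj₁ refl | inj₁ refl = (inj₁ a , inj₁ (sym b)) , h
    ... | inj₂ refl | inj₁ refl = (inj₂ a , inj₁ (sym b)) , h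
    ... | inj₁ refl | inj₂ refl = (inj₁ a , inj₂ (sym b)) , h
    ... | inj₂ refl | inj₂ refl = (inj₂ a , inj₂ (sym b)) , h

  module _ (w₁ w₀ : Cube) where
    lift-xy : ∀ δ₁ δ₀ → axisOf δ₁ ≡ ax → axisOf δ₀ ≡ ay →
      ev² KB (dom w₁ δ₁) (dom w₀ δ₀) ≡ sg δ₁ * (sg δ₀ * b2i (hits (dom w₀ δ₀) (vec +z) (dom w₁ δ₁)))
    lift-xy δ₁ δ₀ e₁ e₀ rewrite sym (cross-xy (dom w₁ δ₁) (dom w₀ δ₀) e₁ e₀) | e₁ | e₀ = refl

    lift-yx : ∀ δ₁ δ₀ → axisOf δ₁ ≡ ay → axisOf δ₀ ≡ ax →
      ev² KB (dom w₁ δ₁) (dom w₀ δ₀) ≡ sg δ₁ * (sg δ₀ * - b2i (hits (dom w₀ δ₀) (vec +z) (dom w₁ δ₁)))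
    lift-yx δ₁ δ₀ e₁ e₀ rewrite sym (cross-yx (dom w₁ δ₁) (dom w₀ δ₀) e₁ e₀) | e₁ | e₀ = refl

  lpp : ∀ b → + 1 * (+ 1 * b) ≡ + 1 * b
  lpp = solve-∀
  lppn : ∀ b → + 1 * (+ 1 * - b) ≡ - + 1 * b
  lppn = solve-∀
  lpm : ∀ b → + 1 * (- + 1 * b) ≡ - + 1 * b
  lpm = solve-∀
  lpmn : ∀ b → + 1 * (- + 1 * - b) ≡ + 1 * b
  lpmn = solve-∀
  lmp : ∀ b → - + 1 * (+ 1 * b) ≡ - + 1 * b
  lmp = solve-∀
  lmpn : ∀ b → - + 1 * (+ 1 * - b) ≡ + 1 * b
  lmpn = solve-∀
  lmm : ∀ b → - + 1 * (- + 1 * b) ≡ + 1 * b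
  lmm = solve-∀
  lmmn : ∀ b → - + 1 * (- + 1 * - b) ≡ - + 1 * b
  lmmn = solve-∀

  hits-KB : ∀ d₁ d₀ → ev² KB d₁ d₀ ≡ det (v d₁) (v d₀) (vec +z) * b2i (hits d₀ (vec +z) d₁)
  hits-KB (dom w₁ +x) (dom w₀ +x) = refl
  hits-KB (dom w₁ +x) (dom w₀ -x) = refl
  hits-KB (dom w₁ +x) (dom w₀ +y) = trans (lift-xy w₁ w₀ +x +y refl refl) (lpp _)
  hits-KB (dom w₁ +x) (dom w₀ -y) = trans (lift-xy w₁ w₀ +x -y refl refl) (lpm _)
  hits-KB (dom w₁ +x) (dom w₀ +z) = refl
  hits-KB (dom w₁ +x) (dom w₀ -z) = refl
  hits-KB (dom w₁ -x) (dom w₀ +x) = refl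
  hits-KB (dom w₁ -x) (dom w₀ -x) = refl
  hits-KB (dom w₁ -x) (dom w₀ +y) = trans (lift-xy w₁ w₀ -x +y refl refl) (lmp _)
  hits-KB (dom w₁ -x) (dom w₀ -y) = trans (lift-xy w₁ w₀ -x -y refl refl) (lmm _)
  hits-KB (dom w₁ -x) (dom w₀ +z) = refl
  hits-KB (dom w₁ -x) (dom w₀ -z) = refl
  hits-KB (dom w₁ +y) (dom w₀ +x) = trans (lift-yx w₁ w₀ +y +x refl refl) (lppn _)
  hits-KB (dom w₁ +y) (dom w₀ -x) = trans (lift-yx w₁ w₀ +y -x refl refl) (lpmn _)
  hits-KB (dom w₁ +y) (dom w₀ +y) = refl
  hits-KB (dom w₁ +y) (dom w₀ -y) = refl
  hits-KB (dom w₁ +y) (dom w₀ +z) = refl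
  hits-KB (dom w₁ +y) (dom w₀ -z) = refl
  hits-KB (dom w₁ -y) (dom w₀ +x) = trans (lift-yx w₁ w₀ -y +x refl refl) (lmpn _)
  hits-KB (dom w₁ -y) (dom w₀ -x) = trans (lift-yx w₁ w₀ -y -x refl refl) (lmmn _)
  hits-KB (dom w₁ -y) (dom w₀ +y) = refl
  hits-KB (dom w₁ -y) (dom w₀ -y) = refl
  hits-KB (dom w₁ -y) (dom w₀ +z) = refl
  hits-KB (dom w₁ -y) (dom w₀ -z) = refl
  hits-KB (dom w₁ +z) (dom w₀ +x) = refl
  hits-KB (dom w₁ +z) (dom w₀ -x) = refl
  hits-KB (dom w₁ +z) (dom w₀ +y) = refl
  hits-KB (dom w₁ +z) (dom w₀ -y) = refl
  hits-KB (dom w₁ +z) (dom w₀ +z) = refl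
  hits-KB (dom w₁ +z) (dom w₀ -z) = refl
  hits-KB (dom w₁ -z) (dom w₀ +x) = refl
  hits-KB (dom w₁ -z) (dom w₀ -x) = refl
  hits-KB (dom w₁ -z) (dom w₀ +y) = refl
  hits-KB (dom w₁ -z) (dom w₀ -y) = refl
  hits-KB (dom w₁ -z) (dom w₀ +z) = refl
  hits-KB (dom w₁ -z) (dom w₀ -z) = refl

quarters-+ : ∀ m n → (m + n) ℚ./ 4 ≡ m ℚ./ 4 ℚ.+ n ℚ./ 4
quarters-+ m n = ℚP.toℚᵘ-injective (begin
  ℚ.toℚᵘ ((m + n) ℚ./ 4)                  ≈⟨ ℚP.toℚᵘ-fromℚᵘ (ℚᵘ.mkℚᵘ (m + n) 3) ⟩
  ℚᵘ.mkℚᵘ (m + n) 3                       ≈⟨ ℚᵘ.*≡* (l m n) ⟩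
  ℚᵘ.mkℚᵘ m 3 ℚᵘ.+ ℚᵘ.mkℚᵘ n 3            ≈⟨ ℚᵘP.+-cong (ℚP.toℚᵘ-fromℚᵘ (ℚᵘ.mkℚᵘ m 3)) (ℚP.toℚᵘ-fromℚᵘ (ℚᵘ.mkℚᵘ n 3)) ⟨
  ℚ.toℚᵘ (m ℚ./ 4) ℚᵘ.+ ℚ.toℚᵘ (n ℚ./ 4)  ≈⟨ ℚP.toℚᵘ-homo-+ (m ℚ./ 4) (n ℚ./ 4) ⟨
  ℚ.toℚᵘ (m ℚ./ 4 ℚ.+ n ℚ./ 4) ∎)
  where
  open import Relation.Binary.Reasoning.Setoid ℚᵘP.≃-setoid
  l : ∀ m n → (m + n) * + 16 ≡ (m * + 4 + n * + 4) * + 4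
  l = solve-∀

quarter-of-4* : ∀ k → (+ 4 * k) ℚ./ 4 ≡ k ℚ./ 1
quarter-of-4* k = ℚP.fromℚᵘ-cong {ℚᵘ.mkℚᵘ (+ 4 * k) 3} {ℚᵘ.mkℚᵘ k 0} (ℚᵘ.*≡* (l k))
  where
  l : ∀ k → + 4 * k * + 1 ≡ k * + 4
  l = solve-∀

sumℚ-++ : ∀ xs ys → sumℚ (xs ++ ys) ≡ sumℚ xs ℚ.+ sumℚ ys
sumℚ-++ [] ys = sym (ℚP.+-identityˡ _)
sumℚ-++ (a ∷ xs) ys = trans (cong (a ℚ.+_) (sumℚ-++ xs ys)) (sym (ℚP.+-assoc a (sumℚ xs) (sumℚ ys)))

private
  τ-KB : ∀ d₀ d₁ → τ +z d₀ d₁ ≡ ev² KB d₁ d₀ ℚ./ 4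
  τ-KB d₀ d₁ = trans (l (hits d₀ (vec +z) d₁)) (cong (ℚ._/ 4) (sym (hits-KB d₁ d₀)))
    where
    D = det (v d₁) (v d₀) (vec +z)
    l : ∀ b → (if b then D ℚ./ 4 else 0ℚ) ≡ (D * b2i b) ℚ./ 4
    l true = cong (ℚ._/ 4) (sym (ℤP.*-identityʳ D))
    l false = cong (ℚ._/ 4) (sym (ℤP.*-zeroʳ D))

-- `τ` takes the lower domino first and `KB` the upper one, hence the exchange of the two sums.
Tw-pair : ∀ t → Tw t ≡ pair KB t t ℚ./ 4
Tw-pair t = trans (go t) (cong (ℚ._/ 4) (∑-swap t t (λ d₀ d₁ → ev² KB d₁ d₀)))
  where
  inner : ∀ d₀ u → sumℚ (map (λ d₁ → τ +z d₀ d₁) u) ≡ ∑ u (λ d₁ → ev² KB d₁ d₀) ℚ./ 4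
  inner d₀ [] = refl
  inner d₀ (d₁ ∷ u) = trans (cong₂ ℚ._+_ (τ-KB d₀ d₁) (inner d₀ u))
    (sym (quarters-+ (ev² KB d₁ d₀) (∑ u (λ d₁ → ev² KB d₁ d₀))))
  go : ∀ u → sumℚ (concatMap (λ d₀ → map (λ d₁ → τ +z d₀ d₁) t) u) ≡ ∑ u (λ d₀ → ∑ t (λ d₁ → ev² KB d₁ d₀)) ℚ./ 4
  go [] = refl
  go (d₀ ∷ u) = trans (sumℚ-++ (map (λ d₁ → τ +z d₀ d₁) t) _)
    (trans (cong₂ ℚ._+_ (inner d₀ t) (go u))
      (sym (quarters-+ (∑ t (λ d₁ → ev² KB d₁ d₀)) (∑ u (λ d₀ → ∑ t (λ d₁ → ev² KB d₁ d₀))))))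

-- Colours, cells and boundaries of tilings

par-dn : ∀ n → par (n - + 1) ≡ - par n
par-dn n = begin
  par (n - + 1)             ≡⟨ sym (ℤP.neg-involutive _) ⟩
  - - par (n - + 1)         ≡⟨ cong -_ (sym (par-up (n - + 1))) ⟩
  - par (n - + 1 + + 1)     ≡⟨ cong (λ w → - par w) (l n) ⟩
  - par n ∎
  where
  open ≡-Reasoning
  l : ∀ n → n - + 1 + + 1 ≡ n
  l = solve-∀

par-+ : ∀ m n → par (m + n) ≡ par m * par n
par-+ (+ 0) n rewrite ℤP.+-identityˡ n = sym (ℤP.*-identityˡ (par n))
par-+ (+ suc k) n = begin
  par (+ suc k + n)       ≡⟨ cong par (l (+ k) n) ⟩
  par (+ k + n + + 1)     ≡⟨ par-up (+ k + n) ⟩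
  - par (+ k + n)         ≡⟨ cong -_ (par-+ (+ k) n) ⟩
  - (par (+ k) * par n)   ≡⟨ ℤP.neg-distribˡ-* (par (+ k)) (par n) ⟩
  - par (+ k) * par n     ≡⟨ cong (_* par n) (sym (trans (cong par (ℤP.+-comm (+ 1) (+ k))) (par-up (+ k)))) ⟩
  par (+ suc k) * par n ∎
  where
  open ≡-Reasoning
  l : ∀ k n → + 1 + k + n ≡ k + n + + 1
  l = solve-∀
par-+ -[1+ 0 ] n = trans (cong par (l n)) (trans (par-dn n) (l′ (par n)))
  where
  l : ∀ n → - + 1 + n ≡ n - + 1
  l = solve-∀
  l′ : ∀ n → - n ≡ - + 1 * n
  l′ = solve-∀
par-+ -[1+ suc k ] n = begin
  par (-[1+ suc k ] + n)     ≡⟨ cong (λ w → par (w + n)) (e k) ⟩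
  par (-[1+ k ] - + 1 + n)   ≡⟨ cong par (l -[1+ k ] n) ⟩
  par (-[1+ k ] + n - + 1)   ≡⟨ par-dn (-[1+ k ] + n) ⟩
  - par (-[1+ k ] + n)       ≡⟨ cong -_ (par-+ -[1+ k ] n) ⟩
  - (par -[1+ k ] * par n)   ≡⟨ ℤP.neg-distribˡ-* (par -[1+ k ]) (par n) ⟩
  - par -[1+ k ] * par n     ≡⟨ cong (_* par n) (sym (trans (cong par (e k)) (par-dn -[1+ k ]))) ⟩
  par -[1+ suc k ] * par n ∎
  where
  open ≡-Reasoning
  e : ∀ k → -[1+ suc k ] ≡ -[1+ k ] - + 1
  e k = cong -[1+_] (cong suc (sym (ℕP.+-identityʳ k)))
  l : ∀ k n → k - + 1 + n ≡ k + n - + 1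
  l = solve-∀

-- The colour as a sign, positive on white cubes.
ε : Cube → ℤ
ε c = par (x c + y c + z c)

ε-up : ∀ i c → ε (up i c) ≡ - ε c
ε-up ax c = trans (cong par (l (x c) (y c) (z c))) (par-up (x c + y c + z c))
  where
  l : ∀ a b c → a + + 1 + b + c ≡ a + b + c + + 1
  l = solve-∀
ε-up ay c = trans (cong par (l (x c) (y c) (z c))) (par-up (x c + y c + z c))
  where
  l : ∀ a b c → a + (b + + 1) + c ≡ a + b + c + + 1
  l = solve-∀
ε-up az c = trans (cong par (l (x c) (y c) (z c))) (par-up (x c + y c + z c))
  where
  l : ∀ a b c → a + b + (c + + 1) ≡ a + b + c + + 1
  l = solve-∀

ε-square : ∀ c → ε c * ε c ≡ + 1
ε-square c = par-square (x c + y c + z c)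

ε-bc : ∀ d → ε (bc d) ≡ - ε (wc d)
ε-bc d with arrow-ends d
... | inj₁ (_ , e , e′) = trans (cong ε (sym e′)) (trans (ε-up (axis′ d) (base′ d)) (cong (λ c → - ε c) e))
... | inj₂ (_ , e , e′) = trans (cong ε (sym e)) (trans (sym (ℤP.neg-involutive _))
        (cong -_ (trans (sym (ε-up (axis′ d) (base′ d))) (cong ε e′))))

white-ε : ∀ c → IsWhite c → ε c ≡ + 1
white-ε c w rewrite w = refl

par≢-par : ∀ n → par n ≢ - par n
par≢-par n with ⌊ ∣ n ∣ ℕ.% 2 ℕ.≟ 0 ⌋
... | true = λ ()
... | false = λ ()

wc≢bc : ∀ d → wc d ≢ bc d
wc≢bc d e = par≢-par (x (wc d) + y (wc d) + z (wc d)) (trans (cong ε e) (ε-bc d))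

heights : ℤ → ℕ → List ℤ
heights l zero = []
heights l (suc n) = l ∷ heights (l + + 1) n

<⇒+1≤ : ∀ {i j} → i ℤ.< j → i + + 1 ℤ.≤ j
<⇒+1≤ {i} {j} h = subst (ℤ._≤ j) (ℤP.+-comm (+ 1) i) (ℤP.i<j⇒suc[i]≤j h)

+1≤⇒< : ∀ {i j} → i + + 1 ℤ.≤ j → i ℤ.< j
+1≤⇒< {i} {j} h = ℤP.suc[i]≤j⇒i<j (subst (ℤ._≤ j) (ℤP.+-comm i (+ 1)) h)

i<i+1 : ∀ i → i ℤ.< i + + 1
i<i+1 i = +1≤⇒< ℤP.≤-refl

<+1⇒≤ : ∀ {i j} → i ℤ.< j + + 1 → i ℤ.≤ j
<+1⇒≤ {i} {j} h = ℤP.≮⇒≥ λ g → ℤP.<-irrefl refl (ℤP.<-≤-trans h (<⇒+1≤ g))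

private
  shift-end : ∀ l n → l + + suc n ≡ l + + 1 + + n
  shift-end l n = sym (ℤP.+-assoc l (+ 1) (+ n))

∈-heights⁺ : ∀ {l n h} → l ℤ.≤ h → h ℤ.< l + + n → h ∈ heights l n
∈-heights⁺ {l} {zero} a b = ⊥-elim (ℤP.<⇒≱ b (subst (ℤ._≤ _) (sym (ℤP.+-identityʳ l)) a))
∈-heights⁺ {l} {suc n} {h} a b with h ℤP.≟ l
... | yes refl = here refl
... | no h≢l = there (∈-heights⁺ (<⇒+1≤ (ℤP.≤∧≢⇒< a (λ e → h≢l (sym e)))) (subst (h ℤ.<_) (shift-end l n) b))

∈-heights⁻ : ∀ {l n h} → h ∈ heights l n → l ℤ.≤ h × h ℤ.< l + + n
∈-heights⁻ {l} {suc n} (here refl) = ℤP.≤-refl ,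
  subst (l ℤ.<_) (sym (shift-end l n)) (ℤP.<-≤-trans (i<i+1 l) (ℤP.i≤i+j (l + + 1) (+ n)))
∈-heights⁻ {l} {suc n} {h} (there m) with ∈-heights⁻ {l + + 1} {n} m
... | a , b = ℤP.<⇒≤ (+1≤⇒< a) , subst (h ℤ.<_) (sym (shift-end l n)) b

heights-unique : ∀ l n → Unique (heights l n)
heights-unique l zero = []
heights-unique l (suc n) = All.tabulate (λ { m refl → ℤP.<-irrefl refl (+1≤⇒< (proj₁ (∈-heights⁻ m))) })
  ∷ heights-unique (l + + 1) n

emb : Axis → ℤ → Sq → Cube
emb ax k (a , b) = v3 k a b
emb ay k (a , b) = v3 a k b
emb az k (a , b) = v3 a b k

along-emb : ∀ i k s → along i (emb i k s) ≡ k
along-emb ax k s = refl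
along-emb ay k s = refl
along-emb az k s = refl

proj-emb : ∀ i k s → proj i (emb i k s) ≡ s
proj-emb ax k s = refl
proj-emb ay k s = refl
proj-emb az k s = refl

emb-split : ∀ i c → emb i (along i c) (proj i c) ≡ c
emb-split ax c = refl
emb-split ay c = refl
emb-split az c = refl

_≟Sq_ : (s s′ : Sq) → Dec (s ≡ s′)
_≟Sq_ = ≡-dec ℤP._≟_ ℤP._≟_

-- The base is a list in which a square may occur twice, while sums over the region must count every
-- cube once; hence the deduplication.
cellsOf : Cylinder → List Cube
cellsOf C = cartesianProductWith (emb (axis C)) (heights (level C) (depth C)) (deduplicate _≟Sq_ (base C))

cellsOf-unique : ∀ C → Unique (cellsOf C)
cellsOf-unique C = UniqueP.cartesianProductWith⁺ (emb i) inj (heights-unique (level C) (depth C)) (DecUniqueP.deduplicate-! _≟Sq_ (base C))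
  where
  i = axis C
  inj : ∀ {k k′ s s′} → emb i k s ≡ emb i k′ s′ → k ≡ k′ × s ≡ s′
  inj {k} {k′} {s} {s′} e = trans (sym (along-emb i k s)) (trans (cong (along i) e) (along-emb i k′ s′))
                          , trans (sym (proj-emb i k s)) (trans (cong (proj i) e) (proj-emb i k′ s′))

∈-cellsOf⁺ : ∀ C {c} → InCyl C c → c ∈ cellsOf C
∈-cellsOf⁺ C {c} (p , a , b) = subst (_∈ cellsOf C) (emb-split (axis C) c)
  (∈-cartesianProductWith⁺ (emb (axis C)) (∈-heights⁺ a b) (∈-deduplicate⁺ _≟Sq_ p))

∈-cellsOf⁻ : ∀ C {c} → c ∈ cellsOf C → InCyl C c
∈-cellsOf⁻ C m with ∈-cartesianProductWith⁻ (emb (axis C)) (heights (level C) (depth C)) (deduplicate _≟Sq_ (base C)) m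
... | k , s , k∈ , s∈ , refl rewrite along-emb (axis C) k s | proj-emb (axis C) k s =
  ∈-deduplicate⁻ _≟Sq_ (base C) s∈ , ∈-heights⁻ k∈

-- The boundary of f is that of a tiling of L.
Fills : List Cube → List Domino → Set
Fills L f = ∀ h → bd f h ≡ - ∑ L (λ c → ε c * h c)

covers-∈ : ∀ {c} d {t} → d ∈ t → Covers d c → c ∈ concatMap cells t
covers-∈ d (here refl) (inj₁ refl) = here refl
covers-∈ d (here refl) (inj₂ refl) = there (here refl)
covers-∈ d (there m) k = there (there (covers-∈ d m k))

∈-covers : ∀ {c} t → c ∈ concatMap cells t → Σ Domino λ d → d ∈ t × Covers d c
∈-covers (d ∷ t) (here refl) = d , here refl , inj₁ refl
∈-covers (d ∷ t) (there (here refl)) = d , here refl , inj₂ refl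
∈-covers (d ∷ t) (there (there m)) with ∈-covers t m
... | e , e∈ , k = e , there e∈ , k

cells-unique : ∀ {t} → AllPairs Disj t → Unique (concatMap cells t)
cells-unique [] = []
cells-unique {d ∷ t} (a ∷ u) =
  (wc≢bc d ∷ All.tabulate (λ m e → sep (inj₁ refl) (subst (_∈ concatMap cells t) (sym e) m)))
  ∷ All.tabulate (λ m e → sep (inj₂ refl) (subst (_∈ concatMap cells t) (sym e) m))
  ∷ cells-unique u
  where
  sep : ∀ {c} → Covers d c → c ∉ concatMap cells t
  sep k m with ∈-covers t m
  ... | e , e∈ , k′ = All.lookup a e∈ _ k k′

module _ {R : Region} {t : List Domino} (T : IsTiling R t) where

  private
    whites = proj₁ T
    insides = proj₁ (proj₂ T)
    covered = proj₁ (proj₂ (proj₂ T))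

  tiling-disjoint : AllPairs Disj t
  tiling-disjoint = proj₂ (proj₂ (proj₂ T))

  tiling-white : ∀ {d} → d ∈ t → ε (wc d) ≡ + 1
  tiling-white {d} m = white-ε (wc d) (All.lookup whites m)

  tiling-inside : ∀ {d c} → d ∈ t → Covers d c → R c
  tiling-inside m k = All.lookup insides m _ k

  tiling-covered : ∀ {c} → R c → Σ Domino λ d → d ∈ t × Covers d c
  tiling-covered r = find (covered _ r)

  tiling-unique : Unique t
  tiling-unique = go tiling-disjoint
    where
    go : ∀ {u} → AllPairs Disj u → Unique u
    go [] = []
    go (a ∷ u) = All.map (λ { D refl → D _ (inj₁ refl) (inj₁ refl) }) a ∷ go u

  tiling-overlap : ∀ {d e c} → d ∈ t → e ∈ t → Covers d c → Covers e c → d ≡ e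
  tiling-overlap = go tiling-disjoint
    where
    go : ∀ {u d e c} → AllPairs Disj u → d ∈ u → e ∈ u → Covers d c → Covers e c → d ≡ e
    go (a ∷ u) (here refl) (here refl) _ _ = refl
    go (a ∷ u) (here refl) (there m) k k′ = ⊥-elim (All.lookup a m _ k k′)
    go (a ∷ u) (there m) (here refl) k k′ = ⊥-elim (All.lookup a m _ k′ k)
    go (a ∷ u) (there m) (there m′) k k′ = go u m m′ k k′

  -- Each domino contributes minus the coloured sum over its own two cubes, and the cubes of all
  -- dominoes make up the region, each once. So the boundary is the same for all tilings of a
  -- region.
  tiling-fills : ∀ {L} → Unique L → (∀ {c} → R c → c ∈ L) → (∀ {c} → c ∈ L → R c) → Fills L t
  tiling-fills {L} u to from h = begin
    bd t h                                                   ≡⟨ ∑-cong t local ⟩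
    ∑ t (λ d → - ∑ (cells d) (λ c → ε c * h c))              ≡⟨ ∑-neg t _ ⟩
    - ∑ t (λ d → ∑ (cells d) (λ c → ε c * h c))              ≡⟨ cong -_ (sym (∑-concatMap cells t _)) ⟩
    - ∑ (concatMap cells t) (λ c → ε c * h c)                ≡⟨ cong -_ (∑-↭ _ (unique-↭ (cells-unique tiling-disjoint) u i j)) ⟩
    - ∑ L (λ c → ε c * h c) ∎
    where
    open ≡-Reasoning
    l : ∀ a b → b - a ≡ - (+ 1 * a + (- + 1 * b + + 0))
    l = solve-∀
    local : ∀ d → d ∈ t → h (bc d) - h (wc d) ≡ - (ε (wc d) * h (wc d) + (ε (bc d) * h (bc d) + + 0))
    local d m rewrite ε-bc d | tiling-white m = l (h (wc d)) (h (bc d))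
    i : ∀ {c} → c ∈ concatMap cells t → c ∈ L
    i m with ∈-covers t m
    ... | d , d∈ , k = to (tiling-inside d∈ k)
    j : ∀ {c} → c ∈ L → c ∈ concatMap cells t
    j m with tiling-covered (from m)
    ... | d , d∈ , k = covers-∈ d d∈ k

cylinder-fills : ∀ C {t} → IsTiling (InCyl C) t → Fills (cellsOf C) t
cylinder-fills C T = tiling-fills T (cellsOf-unique C) (∈-cellsOf⁺ C) (∈-cellsOf⁻ C)

-- Cancellation under colour-reversing reflections

≡-neg⇒0 : ∀ {n} → n ≡ - n → n ≡ + 0
≡-neg⇒0 {+ 0} e = refl

unique-map : ∀ {A B : Set} (f : A → B) {xs} → Unique xs →
  (∀ {a b} → a ∈ xs → b ∈ xs → f a ≡ f b → a ≡ b) → Unique (map f xs)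
unique-map f [] inj = []
unique-map f (a∉ ∷ u) inj =
  AllP.map⁺ (All.tabulate (λ m e → All.lookup a∉ m (inj (here refl) (there m) e)))
  ∷ unique-map f u (λ m m′ → inj (there m) (there m′))

-- Reindexing by the involution turns the sum into its negative. Only the support of `φ` has to be
-- mapped into `L`: elsewhere `σ′` is the identity, and the sign rule holds there because `φ`
-- vanishes.
∑-involution : ∀ {A : Set} {L : List A} → Unique L → (φ : A → ℤ) (σ : A → A) →
  (∀ c → c ∈ L → φ c ≢ + 0 → σ c ∈ L × φ (σ c) ≡ - φ c × σ (σ c) ≡ c) → ∑ L φ ≡ + 0
∑-involution {A} {L} u φ σ inv = ≡-neg⇒0 (begin
  ∑ L φ                    ≡⟨ sym (∑-↭ φ (unique-↭ (unique-map σ′ u inj) u into onto)) ⟩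
  ∑ (map σ′ L) φ           ≡⟨ ∑-map σ′ L φ ⟩
  ∑ L (λ c → φ (σ′ c))     ≡⟨ ∑-cong L (λ c m → proj₁ (proj₂ (inv′ c m))) ⟩
  ∑ L (λ c → - φ c)        ≡⟨ ∑-neg L φ ⟩
  - ∑ L φ ∎)
  where
  open ≡-Reasoning
  σ′ : A → A
  σ′ c with φ c ℤP.≟ + 0
  ... | yes _ = c
  ... | no _ = σ c
  σ′-zero : ∀ {c} → φ c ≡ + 0 → σ′ c ≡ c
  σ′-zero {c} e with φ c ℤP.≟ + 0
  ... | yes _ = refl
  ... | no n = ⊥-elim (n e)
  σ′-nonzero : ∀ {c} → φ c ≢ + 0 → σ′ c ≡ σ c
  σ′-nonzero {c} n with φ c ℤP.≟ + 0
  ... | yes e = ⊥-elim (n e)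
  ... | no _ = refl
  inv′ : ∀ c → c ∈ L → σ′ c ∈ L × φ (σ′ c) ≡ - φ c × σ′ (σ′ c) ≡ c
  inv′ c m = go (φ c ℤP.≟ + 0)
    where
    go : Dec (φ c ≡ + 0) → σ′ c ∈ L × φ (σ′ c) ≡ - φ c × σ′ (σ′ c) ≡ c
    go (yes e) rewrite σ′-zero {c} e = m , trans e (cong -_ (sym e)) , σ′-zero e
    go (no n) rewrite σ′-nonzero {c} n with inv c m n
    ... | k , e , e′ = k , e , trans (σ′-nonzero λ q → n (trans (sym (ℤP.neg-involutive (φ c))) (cong -_ (trans (sym e) q)))) e′
  inj : ∀ {a b} → a ∈ L → b ∈ L → σ′ a ≡ σ′ b → a ≡ b
  inj {a} {b} m m′ e = trans (sym (proj₂ (proj₂ (inv′ a m)))) (trans (cong σ′ e) (proj₂ (proj₂ (inv′ b m′))))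
  into : ∀ {a} → a ∈ map σ′ L → a ∈ L
  into m with ∈-map⁻ σ′ m
  ... | c , c∈ , refl = proj₁ (inv′ c c∈)
  onto : ∀ {a} → a ∈ L → a ∈ map σ′ L
  onto {a} m = subst (_∈ map σ′ L) (proj₂ (proj₂ (inv′ a m))) (∈-map⁺ σ′ (proj₁ (inv′ a m)))

mirror : Axis → ℤ → Cube → Cube
mirror ax k c = v3 (k - x c) (y c) (z c)
mirror ay k c = v3 (x c) (k - y c) (z c)
mirror az k c = v3 (x c) (y c) (k - z c)

private
  twice : ∀ k a → k - (k - a) ≡ a
  twice = solve-∀

  par-mirror : ∀ k a s → par (k - a + s) ≡ par k * par (a + s)
  par-mirror k a s = begin
    par (k - a + s)              ≡⟨ cong par (l k a s) ⟩
    par (k + (- a + s))          ≡⟨ par-+ k (- a + s) ⟩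
    par k * par (- a + s)        ≡⟨ cong (par k *_) (par-+ (- a) s) ⟩
    par k * (par (- a) * par s)  ≡⟨ cong (λ w → par k * (w * par s)) (par-neg a) ⟩
    par k * (par a * par s)      ≡⟨ cong (par k *_) (sym (par-+ a s)) ⟩
    par k * par (a + s) ∎
    where
    open ≡-Reasoning
    l : ∀ k a s → k - a + s ≡ k + (- a + s)
    l = solve-∀

mirror-mirror : ∀ i k c → mirror i k (mirror i k c) ≡ c
mirror-mirror ax k c = V3-≡ (twice k (x c)) refl refl
mirror-mirror ay k c = V3-≡ refl (twice k (y c)) refl
mirror-mirror az k c = V3-≡ refl refl (twice k (z c))

ε-mirror : ∀ i k c → ε (mirror i k c) ≡ par k * ε c
ε-mirror ax k (v3 a b c) = trans (cong par (l (k - a) b c)) (trans (par-mirror k a (b + c)) (cong (λ w → par k * par w) (sym (l a b c))))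
  where
  l : ∀ a b c → a + b + c ≡ a + (b + c)
  l = solve-∀
ε-mirror ay k (v3 a b c) = trans (cong par (l a (k - b) c)) (trans (par-mirror k b (a + c)) (cong (λ w → par k * par w) (sym (l a b c))))
  where
  l : ∀ a b c → a + b + c ≡ b + (a + c)
  l = solve-∀
ε-mirror az k (v3 a b c) = trans (cong par (l a b (k - c))) (trans (par-mirror k c (a + b)) (cong (λ w → par k * par w) (sym (l a b c))))
  where
  l : ∀ a b c → a + b + c ≡ c + (a + b)
  l = solve-∀

∑-mirror : ∀ {L} i k → Unique L → par k ≡ - + 1 → (h : Cube → ℤ) →
  (∀ c → c ∈ L → h c ≢ + 0 → mirror i k c ∈ L × h (mirror i k c) ≡ h c) →
  ∑ L (λ c → ε c * h c) ≡ + 0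
∑-mirror {L} i k u odd h H = ∑-involution u (λ c → ε c * h c) (mirror i k) inv
  where
  l : ∀ a b → - + 1 * a * b ≡ - (a * b)
  l = solve-∀
  inv : ∀ c → c ∈ L → ε c * h c ≢ + 0 →
    mirror i k c ∈ L × ε (mirror i k c) * h (mirror i k c) ≡ - (ε c * h c) × mirror i k (mirror i k c) ≡ c
  inv c m n with H c m (λ e → n (trans (cong (ε c *_) e) (ℤP.*-zeroʳ (ε c))))
  ... | k∈ , e = k∈ , trans (cong₂ _*_ (trans (ε-mirror i k c) (cong (_* ε c) odd)) e) (l (ε c) (h c)) , mirror-mirror i k c

-- A cylinder is the product of its base and an interval, so the two factors may be taken from
-- different cubes. This is how reflected cubes are seen to stay in the region.
InCyl-mix : ∀ C {c c₁ c₂} → InCyl C c₁ → InCyl C c₂ →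
  proj (axis C) c ≡ proj (axis C) c₁ → along (axis C) c ≡ along (axis C) c₂ → InCyl C c
InCyl-mix C (p , _) (_ , a , b) e e′ =
  subst (_∈ base C) (sym e) p , subst (level C ℤ.≤_) (sym e′) a , subst (ℤ._< level C + + depth C) (sym e′) b

infix 4 _∈₂_
_∈₂_ : ℤ → ℤ → Set
p ∈₂ a = p ≡ a ⊎ p ≡ a + + 1

*-nonzeroˡ : ∀ {a b} → a * b ≢ + 0 → a ≢ + 0
*-nonzeroˡ {a} {b} n refl = n (ℤP.*-zeroˡ b)

*-nonzeroʳ : ∀ {a b} → a * b ≢ + 0 → b ≢ + 0
*-nonzeroʳ {a} {b} n refl = n (ℤP.*-zeroʳ a)

mm-∈₂ : ∀ {p a} → mm p a ≢ + 0 → p ∈₂ a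
mm-∈₂ {p} {a} n with mm-cases p a
... | inj₁ e = ⊥-elim (n e)
... | inj₂ (_ , h) = h

dd-≡ : ∀ {p a} → dd p a ≢ + 0 → p ≡ a
dd-≡ {p} {a} n with dd-cases p a
... | inj₁ e = ⊥-elim (n e)
... | inj₂ (_ , h) = h

-- Reflection with this sum exchanges `a` and `a + 1`, and since the sum is odd it reverses colours.
odd : ℤ → ℤ
odd a = a + (a + + 1)

odd-par : ∀ a → par (odd a) ≡ - + 1
odd-par a = begin
  par (a + (a + + 1))     ≡⟨ par-+ a (a + + 1) ⟩
  par a * par (a + + 1)   ≡⟨ cong (par a *_) (par-up a) ⟩
  par a * - par a         ≡⟨ sym (ℤP.neg-distribʳ-* (par a) (par a)) ⟩
  - (par a * par a)       ≡⟨ cong -_ (par-square a) ⟩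
  - + 1 ∎
  where open ≡-Reasoning

mirror-∈₂ : ∀ a {p} → p ∈₂ a → odd a - p ∈₂ a
mirror-∈₂ a (inj₁ refl) = inj₂ (l a)
  where
  l : ∀ a → a + (a + + 1) - a ≡ a + + 1
  l = solve-∀
mirror-∈₂ a (inj₂ refl) = inj₁ (l a)
  where
  l : ∀ a → a + (a + + 1) - (a + + 1) ≡ a
  l = solve-∀

mm-mirror : ∀ a p → mm (odd a - p) a ≡ mm p a
mm-mirror a p = begin
  mm (odd a - p) a         ≡⟨ cong (λ w → mm w a) (l a p) ⟩
  mm (a + a - p + + 1) a   ≡⟨ mm-flip (a + a - p) a ⟩
  mm a (a + a - p)         ≡⟨ cong mI (l′ a p) ⟩
  mm p a ∎
  where
  open ≡-Reasoning
  l : ∀ a p → a + (a + + 1) - p ≡ a + a - p + + 1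
  l = solve-∀
  l′ : ∀ a p → a - (a + a - p) ≡ p - a
  l′ = solve-∀

εsum : Cylinder → (Cube → ℤ) → ℤ
εsum C h = ∑ (cellsOf C) (λ c → ε c * h c)

εsum-mirror : ∀ C i k → par k ≡ - + 1 → (h : Cube → ℤ) →
  (∀ c → InCyl C c → h c ≢ + 0 → InCyl C (mirror i k c) × h (mirror i k c) ≡ h c) → εsum C h ≡ + 0
εsum-mirror C i k o h H = ∑-mirror i k (cellsOf-unique C) o h λ c m n →
  ∈-cellsOf⁺ C (proj₁ (H c (∈-cellsOf⁻ C m) n)) , proj₂ (H c (∈-cellsOf⁻ C m) n)

private
  nz₁ : ∀ {a b c} → a * b * c ≢ + 0 → a ≢ + 0
  nz₁ {a} {b} n = *-nonzeroˡ {b = b} (*-nonzeroˡ n)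
  nz₂ : ∀ {a b c} → a * b * c ≢ + 0 → b ≢ + 0
  nz₂ {a} n = *-nonzeroʳ {a} (*-nonzeroˡ n)
  nz₃ : ∀ {a b c} → a * b * c ≢ + 0 → c ≢ + 0
  nz₃ {a} {b} n = *-nonzeroʳ {a * b} n

-- One 2×2 square of cubes in the region controls the whole column through it. For a vertical axis
-- it puts all four squares into the base, and a horizontal reflection keeps the height. For a
-- horizontal axis the reflection runs along the axis and keeps the projection, and the square shows
-- that both layers belong to the cylinder.
εsum-column : ∀ C a b k (g : ℤ → ℤ) → (∀ p q → p ∈₂ a → q ∈₂ b → InCyl C (v3 p q k)) →
  εsum C (λ c → mm (x c) a * mm (y c) b * g (z c)) ≡ + 0
εsum-column C@(cyl ax _ _ _) a b k g corner = εsum-mirror C ax (odd a) (odd-par a) _ λ c c∈ n →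
  InCyl-mix C c∈ (corner _ _ (mirror-∈₂ a (mm-∈₂ (nz₁ n))) (inj₁ refl)) refl refl ,
  cong (λ w → w * mm (y c) b * g (z c)) (mm-mirror a (x c))
εsum-column C@(cyl ay _ _ _) a b k g corner = εsum-mirror C ay (odd b) (odd-par b) _ λ c c∈ n →
  InCyl-mix C c∈ (corner _ _ (inj₁ refl) (mirror-∈₂ b (mm-∈₂ (nz₂ {mm (x c) a} n)))) refl refl ,
  cong (λ w → mm (x c) a * w * g (z c)) (mm-mirror b (y c))
εsum-column C@(cyl az _ _ _) a b k g corner = εsum-mirror C ax (odd a) (odd-par a) _ λ c c∈ n →
  InCyl-mix C (corner _ _ (mirror-∈₂ a (mm-∈₂ (nz₁ n))) (mm-∈₂ (nz₂ {mm (x c) a} n))) c∈ refl refl ,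
  cong (λ w → w * mm (y c) b * g (z c)) (mm-mirror a (x c))

εsum-strip : ∀ l D N a b k (g : ℤ → ℤ) → (∀ q → q ∈₂ b → InCyl (cyl az l D N) (v3 a q k)) →
  εsum (cyl az l D N) (λ c → dd (x c) a * mm (y c) b * g (z c)) ≡ + 0
εsum-strip l D N a b k g corner = εsum-mirror C ay (odd b) (odd-par b) _ λ c c∈ n →
  InCyl-mix C (corner _ (mirror-∈₂ b (mm-∈₂ (nz₂ {dd (x c) a} n)))) c∈ (cong (_, odd b - y c) (dd-≡ (nz₁ n))) refl ,
  cong (λ w → dd (x c) a * w * g (z c)) (mm-mirror b (y c))
  where C = cyl az l D N

εsum-side : ∀ l D N b e k (g : ℤ → ℤ) → (∀ p q → p ∈₂ b → q ∈₂ e → InCyl (cyl ax l D N) (v3 k p q)) →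
  εsum (cyl ax l D N) (λ c → g (x c) * mm (y c) b * mm (z c) e) ≡ + 0
εsum-side l D N b e k g corner = εsum-mirror C ay (odd b) (odd-par b) _ λ c c∈ n →
  InCyl-mix C (corner _ _ (mirror-∈₂ b (mm-∈₂ (nz₂ {g (x c)} n))) (mm-∈₂ (nz₃ {g (x c)} n))) c∈ refl refl ,
  cong (λ w → g (x c) * w * mm (z c) e) (mm-mirror b (y c))
  where C = cyl ax l D N

-- The linking kernel

KS : Kernel
KS i c j c′ = KB i c j c′ + KB j c′ i c

curl : Form → Axis → Axis → Cube → ℤ
curl ℓ i j c = ℓ i c + ℓ j (up i c) - ℓ i (up j c) - ℓ j c

form : Kernel → List Domino → Form
form K g i c = ∑ g (ev (K i c))

pair-form : ∀ K f g → pair K f g ≡ ∑ f (ev (form K g))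
pair-form K f g = ∑-cong f λ d _ → ∑-* g (sg (dir d)) (ev (K (axis′ d) (base′ d)))

curl-form : ∀ K g i j c → curl (form K g) i j c ≡ ∑ g (ev (λ j′ c′ → curl (λ i c → K i c j′ c′) i j c))
curl-form K [] i j c = refl
curl-form K (d ∷ g) i j c rewrite sym (curl-form K g i j c) =
  l (sg (dir d)) (k i c) (k j (up i c)) (k i (up j c)) (k j c)
    (form K g i c) (form K g j (up i c)) (form K g i (up j c)) (form K g j c)
  where
  k : Form
  k i c = K i c (axis′ d) (base′ d)
  l : ∀ s a b c d a′ b′ c′ d′ → s * a + a′ + (s * b + b′) - (s * c + c′) - (s * d + d′)
    ≡ s * (a + b - c - d) + (a′ + b′ - c′ - d′)
  l = solve-∀

-- The vertices of the square with lower corner p and normal n are cubes.  An arrow with one end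
-- on the square counts fully, so an arrow path crossing it counts twice.
flux : Axis → Cube → Form
flux ax p ax b = mm (x p) (x b) * mm (y b) (y p) * mm (z b) (z p)
flux ay p ay b = mm (x b) (x p) * mm (y p) (y b) * mm (z b) (z p)
flux az p az b = mm (x b) (x p) * mm (y b) (y p) * mm (z p) (z b)
flux _ _ _ _ = + 0

-- The potential of the error of `KS` on horizontal squares. Projection along z sees an arrow that
-- enters the column over or under the square, but not the vertical arrows that continue it through
-- the square.
side : Cube → Cube → ℤ
side p q = - (mm (x q) (x p) * mm (y q) (y p) * ss (z q) (z p))

private
  KS-xy : ∀ p j b → curl (λ i c → KS i c j b) ax ay p ≡ flux az p j b + ∂ (side p) j b
  KS-xy p ax b rewrite mm-flip (x p) (x b) | mm-flip (x b) (x p) | ss-θ (z b) (z p) =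
    l (mm (x b) (x p)) (mm (x p) (x b)) (mm (y b) (y p)) (θ (z p) (z b)) (θ (z b) (z p))
    where
    l : ∀ m m′ n s t → + 0 + (- (m * n * s) + m * n * t) - + 0 - (- (m′ * n * s) + m′ * n * t)
      ≡ + 0 + (- (m′ * n * (t - s)) - - (m * n * (t - s)))
    l = solve-∀
  KS-xy p ay b rewrite mm-flip (y p) (y b) | mm-flip (y b) (y p) | ss-θ (z b) (z p) =
    l (mm (x b) (x p)) (mm (y p) (y b)) (mm (y b) (y p)) (θ (z p) (z b)) (θ (z b) (z p))
    where
    l : ∀ m n n′ s t → m * n * s + - (m * n * t) + + 0 - (m * n′ * s + - (m * n′ * t)) - + 0
      ≡ + 0 + (- (m * n * (t - s)) - - (m * n′ * (t - s)))
    l = solve-∀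
  KS-xy p az b rewrite ss-up (z b) (z p) = l (mm (x b) (x p)) (mm (y b) (y p)) (mm (z p) (z b)) (ss (z b) (z p))
    where
    l : ∀ m n k s → + 0 ≡ m * n * k + (- (m * n * (s + k)) - - (m * n * s))
    l = solve-∀

  -- Vertical squares have no error term. Their horizontal sides lie at consecutive heights, and the
  -- sign of the relative height changes between them exactly when the other arrow lies at one of
  -- these heights. The minus sign appears because y, x, z is a negatively oriented frame.
  KS-xz : ∀ p j b → curl (λ i c → KS i c j b) ax az p ≡ - flux ay p j b
  KS-xz p ax b = refl
  KS-xz p ay b = l (mm (x b) (x p)) (mm (y p) (y b)) (mm (z b) (z p)) (θ (z p) (z b)) (θ (z p + + 1) (z b)) (θ (z b) (z p)) (θ (z b) (z p + + 1)) key
    where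
    key : θ (z p + + 1) (z b) - θ (z b) (z p + + 1) ≡ θ (z p) (z b) - θ (z b) (z p) + mm (z b) (z p)
    key = trans (sym (ss-θ (z p + + 1) (z b))) (trans (ss-up (z p) (z b)) (cong (_+ mm (z b) (z p)) (ss-θ (z p) (z b))))
    l : ∀ m n k a a′ b b′ → a′ - b′ ≡ a - b + k →
      m * n * a + - (m * n * b) + + 0 - (m * n * a′ + - (m * n * b′)) - + 0 ≡ - (m * n * k)
    l m n k a a′ b b′ e = trans (l₁ m n a a′ b b′) (trans (cong (λ w → m * n * (a - b - w)) e) (l₂ m n k a b))
      where
      l₁ : ∀ m n a a′ b b′ → m * n * a + - (m * n * b) + + 0 - (m * n * a′ + - (m * n * b′)) - + 0
        ≡ m * n * (a - b - (a′ - b′))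
      l₁ = solve-∀
      l₂ : ∀ m n k a b → m * n * (a - b - (a - b + k)) ≡ - (m * n * k)
      l₂ = solve-∀
  KS-xz p az b = refl

  KS-yz : ∀ p j b → curl (λ i c → KS i c j b) ay az p ≡ flux ax p j b
  KS-yz p ax b = l (mm (x p) (x b)) (mm (y b) (y p)) (mm (z b) (z p)) (θ (z p) (z b)) (θ (z p + + 1) (z b)) (θ (z b) (z p)) (θ (z b) (z p + + 1)) key
    where
    key : θ (z p + + 1) (z b) - θ (z b) (z p + + 1) ≡ θ (z p) (z b) - θ (z b) (z p) + mm (z b) (z p)
    key = trans (sym (ss-θ (z p + + 1) (z b))) (trans (ss-up (z p) (z b)) (cong (_+ mm (z b) (z p)) (ss-θ (z p) (z b))))
    l : ∀ m n k a a′ b b′ → a′ - b′ ≡ a - b + k →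
      - (m * n * a) + m * n * b + + 0 - (- (m * n * a′) + m * n * b′) - + 0 ≡ m * n * k
    l m n k a a′ b b′ e = trans (l₁ m n a a′ b b′) (trans (cong (λ w → m * n * (w - (a - b))) e) (l₂ m n k a b))
      where
      l₁ : ∀ m n a a′ b b′ → - (m * n * a) + m * n * b + + 0 - (- (m * n * a′) + m * n * b′) - + 0
        ≡ m * n * (a′ - b′ - (a - b))
      l₁ = solve-∀
      l₂ : ∀ m n k a b → m * n * (a - b + k - (a - b)) ≡ m * n * k
      l₂ = solve-∀
  KS-yz p ay b = refl
  KS-yz p az b = refl

curl-xy : ∀ g p → curl (form KS g) ax ay p ≡ ∑ g (ev (flux az p)) + bd g (side p)
curl-xy g p = begin
  curl (form KS g) ax ay p                            ≡⟨ curl-form KS g ax ay p ⟩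
  ∑ g (ev (λ j b → curl (λ i c → KS i c j b) ax ay p)) ≡⟨ ∑-cong g (λ d _ → trans (cong (sg (dir d) *_) (KS-xy p (axis′ d) (base′ d))) (ev-+ (flux az p) (∂ (side p)) d)) ⟩
  ∑ g (λ d → ev (flux az p) d + ev (∂ (side p)) d)     ≡⟨ ∑-+ g (ev (flux az p)) (ev (∂ (side p))) ⟩
  ∑ g (ev (flux az p)) + ∑ g (ev (∂ (side p)))         ≡⟨ +-congˡ (∑ g (ev (flux az p))) (∑-ev-∂ g (side p)) ⟩
  ∑ g (ev (flux az p)) + bd g (side p) ∎
  where open ≡-Reasoning

curl-xz : ∀ g p → curl (form KS g) ax az p ≡ - ∑ g (ev (flux ay p))
curl-xz g p = begin
  curl (form KS g) ax az p                             ≡⟨ curl-form KS g ax az p ⟩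
  ∑ g (ev (λ j b → curl (λ i c → KS i c j b) ax az p)) ≡⟨ ∑-cong g (λ d _ → trans (cong (sg (dir d) *_) (KS-xz p (axis′ d) (base′ d))) (sym (ℤP.neg-distribʳ-* (sg (dir d)) _))) ⟩
  ∑ g (λ d → - ev (flux ay p) d)                       ≡⟨ ∑-neg g (ev (flux ay p)) ⟩
  - ∑ g (ev (flux ay p)) ∎
  where open ≡-Reasoning

curl-yz : ∀ g p → curl (form KS g) ay az p ≡ ∑ g (ev (flux ax p))
curl-yz g p = trans (curl-form KS g ay az p) (∑-cong g λ d _ → cong (sg (dir d) *_) (KS-yz p (axis′ d) (base′ d)))

OnFace : Axis → Cube → Cube → Set
OnFace ax p c = x c ≡ x p × y c ∈₂ y p × z c ∈₂ z p
OnFace ay p c = x c ∈₂ x p × y c ≡ y p × z c ∈₂ z p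
OnFace az p c = x c ∈₂ x p × y c ∈₂ y p × z c ≡ z p

private
  flux-on : ∀ n p d → flux n p (axis′ d) (base′ d) ≢ + 0 → Σ Cube λ c → Covers d c × OnFace n p c
  flux-on n p d nz with axis′ d in e
  flux-on ax p d nz | ay = ⊥-elim (nz refl)
  flux-on ax p d nz | az = ⊥-elim (nz refl)
  flux-on ay p d nz | ax = ⊥-elim (nz refl)
  flux-on ay p d nz | az = ⊥-elim (nz refl)
  flux-on az p d nz | ax = ⊥-elim (nz refl)
  flux-on az p d nz | ay = ⊥-elim (nz refl)
  flux-on ax p d nz | ax with mm-∈₂ (nz₁ nz) | mm-∈₂ (nz₂ {mm (x p) (x (base′ d))} nz) | mm-∈₂ (nz₃ {mm (x p) (x (base′ d))} nz)
  ... | inj₁ h | b | c = base′ d , covers-base d , sym h , b , c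
  ... | inj₂ h | b | c = up ax (base′ d) , covers-up′ d e , sym h , b , c
  flux-on ay p d nz | ay with mm-∈₂ (nz₁ nz) | mm-∈₂ (nz₂ {mm (x (base′ d)) (x p)} nz) | mm-∈₂ (nz₃ {mm (x (base′ d)) (x p)} nz)
  ... | a | inj₁ h | c = base′ d , covers-base d , a , sym h , c
  ... | a | inj₂ h | c = up ay (base′ d) , covers-up′ d e , a , sym h , c
  flux-on az p d nz | az with mm-∈₂ (nz₁ nz) | mm-∈₂ (nz₂ {mm (x (base′ d)) (x p)} nz) | mm-∈₂ (nz₃ {mm (x (base′ d)) (x p)} nz)
  ... | a | b | inj₁ h = base′ d , covers-base d , a , b , sym h
  ... | a | b | inj₂ h = up az (base′ d) , covers-up′ d e , a , b , sym h

flux-off : ∀ n p d → (∀ c → Covers d c → ¬ OnFace n p c) → ev (flux n p) d ≡ + 0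
flux-off n p d off with flux n p (axis′ d) (base′ d) ℤP.≟ + 0
... | yes e = trans (cong (sg (dir d) *_) e) (ℤP.*-zeroʳ (sg (dir d)))
... | no nz with flux-on n p d nz
... | c , k , o = ⊥-elim (off c k o)

-- The planar Stokes formula

θ-one : ∀ {p q} → q ℤ.< p → θ p q ≡ + 1
θ-one {p} {q} h with θ p q | θ-ind p q
... | _ | holds _ = refl
... | _ | fails n = ⊥-elim (n h)

θ-zero : ∀ {p q} → p ℤ.≤ q → θ p q ≡ + 0
θ-zero {p} {q} h with θ p q | θ-ind p q
... | _ | holds k = ⊥-elim (ℤP.<⇒≱ k h)
... | _ | fails _ = refl

dd-ind : ∀ p q → Ind (p ≡ q) (dd p q)
dd-ind p q with dd p q in e | dd-cases p q
... | _ | inj₂ (refl , h) = holds h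
... | _ | inj₁ refl = fails λ { refl → 0≢1 (trans (sym e) (dd-refl p)) }
  where
  0≢1 : + 0 ≢ + 1
  0≢1 ()

-- The factor `θ w i` stops the sum at `w`. An integral up to a variable point is thereby a sum over
-- a fixed range, which can be exchanged with other sums.
∑-telescope : ∀ (φ : ℤ → ℤ) l n {w} → l ℤ.≤ w → w ℤ.≤ l + + n →
  ∑ (heights l n) (λ i → θ w i * (φ (i + + 1) - φ i)) ≡ φ w - φ l
∑-telescope φ l zero {w} a b with ℤP.≤-antisym a (subst (w ℤ.≤_) (ℤP.+-identityʳ l) b)
... | refl = sym (ℤP.+-inverseʳ (φ l))
∑-telescope φ l (suc n) {w} a b with l ℤP.≟ w
... | yes refl = trans (∑-zero (heights l (suc n)) λ i m → cong (_* (φ (i + + 1) - φ i)) (θ-zero (proj₁ (∈-heights⁻ {l} {suc n} m)))) (sym (ℤP.+-inverseʳ (φ l)))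
... | no l≢w rewrite θ-one (ℤP.≤∧≢⇒< a l≢w)
  | ∑-telescope φ (l + + 1) n {w} (<⇒+1≤ (ℤP.≤∧≢⇒< a l≢w)) (subst (w ℤ.≤_) (sym (ℤP.+-assoc l (+ 1) (+ n))) b)
  = r (φ l) (φ (l + + 1)) (φ w)
  where
  r : ∀ a b c → + 1 * (b - a) + (c - b) ≡ c - a
  r = solve-∀

∑-pick : ∀ {L} → Unique L → ∀ {w} → w ∈ L → (φ : ℤ → ℤ) → ∑ L (λ i → dd w i * φ i) ≡ φ w
∑-pick {a ∷ L} (a∉ ∷ u) (here refl) φ = trans (cong₂ _+_ (cong (_* φ a) (dd-refl a)) (∑-zero L off)) (r (φ a))
  where
  r : ∀ a → + 1 * a + + 0 ≡ a
  r = solve-∀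
  off : ∀ i → i ∈ L → dd a i * φ i ≡ + 0
  off i m with dd-cases a i
  ... | inj₁ e = cong (_* φ i) e
  ... | inj₂ (_ , e) = ⊥-elim (All.lookup a∉ m e)
∑-pick {a ∷ L} (a∉ ∷ u) {w} (there m) φ with dd-cases w a
... | inj₁ e rewrite e = trans (ℤP.+-identityˡ _) (∑-pick u m φ)
... | inj₂ (_ , e) = ⊥-elim (All.lookup a∉ m (sym e))

PForm : Set
PForm = Axis → ℤ → ℤ → ℤ

planar : PForm → Form
planar J i c = J i (x c) (y c)

pcurl : PForm → ℤ → ℤ → ℤ
pcurl J p q = J ax p q + J ay (p + + 1) q - J ax p (q + + 1) - J ay p q

-- The 1-form dual to the ray of `crossing`: its sum over a chain is the winding number at
-- `(p , q)`.
crossForm : ℤ → ℤ → Form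
crossForm p q ay c = θ (x c) p * dd (y c) q
crossForm p q _ c = + 0

private
  ∧-ind : ∀ {P Q : Set} (d : Dec P) (e : Dec Q) → Ind (P × Q) (if ⌊ d ⌋ ∧ ⌊ e ⌋ then + 1 else + 0)
  ∧-ind (yes p) (yes q) = holds (p , q)
  ∧-ind (yes p) (no q) = fails λ (_ , b) → q b
  ∧-ind (no p) e = fails λ (a , _) → p a

  if-neg : ∀ b → (if b then - (+ 1) else + 0) ≡ - + 1 * (if b then + 1 else + 0)
  if-neg true = refl
  if-neg false = refl

  hit : ∀ p q c → (if ⌊ p ℤP.<? x c ⌋ ∧ ⌊ y c ℤP.≟ q ⌋ then + 1 else + 0) ≡ θ (x c) p * dd (y c) q
  hit p q c = Ind-unique (∧-ind (p ℤP.<? x c) (y c ℤP.≟ q)) (Ind-× (θ-ind (x c) p) (dd-ind (y c) q)) (λ h → h) (λ h → h)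

crossing-ev : ∀ p q d → crossing p q d ≡ ev (crossForm p q) d
crossing-ev p q (dom w +x) = refl
crossing-ev p q (dom w -x) = refl
crossing-ev p q (dom w +y) = trans (hit p q w) (sym (ℤP.*-identityˡ _))
crossing-ev p q (dom w -y) = trans (if-neg _) (cong (- + 1 *_) (hit p q (bc (dom w -y))))
crossing-ev p q (dom w +z) = refl
crossing-ev p q (dom w -z) = refl

wind-ev : ∀ f p q → windAt f p q ≡ ∑ f (ev (crossForm p q))
wind-ev f p q = ∑-cong f λ d _ → crossing-ev p q d

-- Closedness is asked of the projection to the xy-plane only: this holds for the tilings of a
-- duplex region, which are not closed chains themselves.
FlatClosed : List Domino → Set
FlatClosed f = ∀ (H : ℤ → ℤ → ℤ) → bd f (λ c → H (x c) (y c)) ≡ + 0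

module _ (lo : ℤ) (n : ℕ) where

  private
    rng = heights lo n

  InRange : Domino → Set
  InRange d = x (base′ d) ∈ rng × y (base′ d) ∈ rng

  -- Subtracting the differential of H turns J into a form supported on the arrows parallel
  -- to the y-axis, whose value there is the integral of its curl over the row to the left.
  stokes : ∀ f → (∀ {d} → d ∈ f → InRange d) → FlatClosed f → ∀ J → (∀ p q → J az p q ≡ + 0) →
    ∑ f (ev (planar J)) ≡ ∑ rng (λ p → ∑ rng (λ q → windAt f p q * pcurl J p q))
  stokes f inr closed J J-az = begin
    ∑ f (ev (planar J))                              ≡⟨ ∑-cong f (λ d m → split d (inr m)) ⟩
    ∑ f (λ d → ev (∂ H) d + rows d)                  ≡⟨ ∑-+ f _ _ ⟩
    ∑ f (ev (∂ H)) + ∑ f rows                        ≡⟨ cong (_+ ∑ f rows) (trans (∑-ev-∂ f H) (closed H₂)) ⟩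
    + 0 + ∑ f rows                                   ≡⟨ ℤP.+-identityˡ _ ⟩
    ∑ f rows                                         ≡⟨ ∑-swap f rng _ ⟩
    ∑ rng (λ p → ∑ f (λ d → ∑ rng (λ q → ev (crossForm p q) d * pcurl J p q))) ≡⟨ ∑-cong rng (λ p _ → ∑-swap f rng _) ⟩
    ∑ rng (λ p → ∑ rng (λ q → ∑ f (λ d → ev (crossForm p q) d * pcurl J p q))) ≡⟨ ∑-cong rng (λ p _ → ∑-cong rng (λ q _ → pull p q)) ⟩
    ∑ rng (λ p → ∑ rng (λ q → windAt f p q * pcurl J p q)) ∎
    where
    open ≡-Reasoning
    -- The integral of `J` up the line `x = lo` and then along the row at height `b`. Its
    -- differential therefore agrees with `J` on every x-arrow in the range.
    H₂ : ℤ → ℤ → ℤ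
    H₂ a b = ∑ rng (λ i → θ a i * J ax i b) + ∑ rng (λ j → θ b j * J ay lo j)
    H : Cube → ℤ
    H c = H₂ (x c) (y c)
    rows : Domino → ℤ
    rows d = ∑ rng (λ p → ∑ rng (λ q → ev (crossForm p q) d * pcurl J p q))

    pull : ∀ p q → ∑ f (λ d → ev (crossForm p q) d * pcurl J p q) ≡ windAt f p q * pcurl J p q
    pull p q = trans (∑-cong f (λ d _ → ℤP.*-comm (ev (crossForm p q) d) (pcurl J p q)))
      (trans (∑-* f (pcurl J p q) (ev (crossForm p q)))
      (trans (ℤP.*-comm (pcurl J p q) _) (cong (_* pcurl J p q) (sym (wind-ev f p q)))))

    rowForm : Form
    rowForm ay c = ∑ rng (λ p → θ (x c) p * pcurl J p (y c))
    rowForm _ c = + 0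

    dθ : ∀ a (φ : ℤ → ℤ) → a ∈ rng → ∑ rng (λ i → θ (a + + 1) i * φ i) - ∑ rng (λ i → θ a i * φ i) ≡ φ a
    dθ a φ m = trans (sym (∑-- rng _ _)) (trans (∑-cong rng (λ i _ → trans (cong (λ w → w * φ i - θ a i * φ i) (θ-up a i)) (r (θ a i) (dd a i) (φ i))))
      (∑-pick (heights-unique lo n) m φ))
      where
      r : ∀ a b c → (a + b) * c - a * c ≡ b * c
      r = solve-∀

    split-form : ∀ i c → x c ∈ rng → y c ∈ rng → planar J i c ≡ ∂ H i c + rowForm i c
    split-form ax c a b = sym (trans (r (∑ rng (λ i → θ (x c + + 1) i * J ax i (y c))) (∑ rng (λ i → θ (x c) i * J ax i (y c))) (∑ rng (λ j → θ (y c) j * J ay lo j)))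
                                     (dθ (x c) (λ i → J ax i (y c)) a))
      where
      r : ∀ a b c → a + c - (b + c) + + 0 ≡ a - b
      r = solve-∀
    split-form ay c a b = sym (begin
      (S₁ + T₁) - (S₀ + T₀) + ∑ rng (λ p → θ (x c) p * pcurl J p (y c))
        ≡⟨ +-congˡ (S₁ + T₁ - (S₀ + T₀)) curl-sum ⟩
      (S₁ + T₁) - (S₀ + T₀) + (S₀ - S₁ + (J ay (x c) (y c) - J ay lo (y c)))
        ≡⟨ r S₁ T₁ S₀ T₀ (J ay (x c) (y c)) (J ay lo (y c)) ⟩
      T₁ - T₀ - J ay lo (y c) + J ay (x c) (y c)
        ≡⟨ cong (λ w → w - J ay lo (y c) + J ay (x c) (y c)) (dθ (y c) (J ay lo) b) ⟩
      J ay lo (y c) - J ay lo (y c) + J ay (x c) (y c)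
        ≡⟨ r′ (J ay lo (y c)) (J ay (x c) (y c)) ⟩
      J ay (x c) (y c) ∎)
      where
      S₀ = ∑ rng (λ i → θ (x c) i * J ax i (y c))
      S₁ = ∑ rng (λ i → θ (x c) i * J ax i (y c + + 1))
      T₀ = ∑ rng (λ j → θ (y c) j * J ay lo j)
      T₁ = ∑ rng (λ j → θ (y c + + 1) j * J ay lo j)
      r : ∀ s₁ t₁ s₀ t₀ j k → s₁ + t₁ - (s₀ + t₀) + (s₀ - s₁ + (j - k)) ≡ t₁ - t₀ - k + j
      r = solve-∀
      r′ : ∀ a b → a - a + b ≡ b
      r′ = solve-∀
      r″ : ∀ t a b c d → t * (a + b - c - d) ≡ t * a - t * c + t * (b - d)
      r″ = solve-∀
      bounds = ∈-heights⁻ {lo} {n} a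
      curl-sum : ∑ rng (λ p → θ (x c) p * pcurl J p (y c)) ≡ S₀ - S₁ + (J ay (x c) (y c) - J ay lo (y c))
      curl-sum = begin
        ∑ rng (λ p → θ (x c) p * pcurl J p (y c))
          ≡⟨ ∑-cong rng (λ p _ → r″ (θ (x c) p) (J ax p (y c)) (J ay (p + + 1) (y c)) (J ax p (y c + + 1)) (J ay p (y c))) ⟩
        ∑ rng (λ p → θ (x c) p * J ax p (y c) - θ (x c) p * J ax p (y c + + 1) + θ (x c) p * (J ay (p + + 1) (y c) - J ay p (y c)))
          ≡⟨ ∑-+ rng _ _ ⟩
        ∑ rng (λ p → θ (x c) p * J ax p (y c) - θ (x c) p * J ax p (y c + + 1)) + ∑ rng (λ p → θ (x c) p * (J ay (p + + 1) (y c) - J ay p (y c)))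
          ≡⟨ cong₂ _+_ (∑-- rng _ _) (∑-telescope (λ p → J ay p (y c)) lo n (proj₁ bounds) (ℤP.<⇒≤ (proj₂ bounds))) ⟩
        S₀ - S₁ + (J ay (x c) (y c) - J ay lo (y c)) ∎
    split-form az c a b = trans (J-az (x c) (y c)) (sym (r (H c)))
      where
      r : ∀ a → a - a + + 0 ≡ + 0
      r = solve-∀

    rowForm-ev : ∀ s i c → y c ∈ rng → s * rowForm i c ≡ ∑ rng (λ p → ∑ rng (λ q → s * crossForm p q i c * pcurl J p q))
    rowForm-ev s ax c b = trans (ℤP.*-zeroʳ s) (sym (∑-zero rng λ p _ → ∑-zero rng λ q _ → cong (_* pcurl J p q) (ℤP.*-zeroʳ s)))
    rowForm-ev s az c b = trans (ℤP.*-zeroʳ s) (sym (∑-zero rng λ p _ → ∑-zero rng λ q _ → cong (_* pcurl J p q) (ℤP.*-zeroʳ s)))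
    rowForm-ev s ay c b = trans (sym (∑-* rng s _)) (∑-cong rng λ p _ →
      trans (cong (λ w → s * (θ (x c) p * w)) (sym (∑-pick (heights-unique lo n) b (pcurl J p))))
      (trans (sym (ℤP.*-assoc s (θ (x c) p) _)) (trans (sym (∑-* rng (s * θ (x c) p) _))
      (∑-cong rng λ q _ → r s (θ (x c) p) (dd (y c) q) (pcurl J p q)))))
      where
      r : ∀ s t d k → s * t * (d * k) ≡ s * (t * d) * k
      r = solve-∀

    split : ∀ d → InRange d → ev (planar J) d ≡ ev (∂ H) d + rows d
    split d (a , b) = trans (cong (sg (dir d) *_) (split-form (axis′ d) (base′ d) a b))
      (trans (ev-+ (∂ H) rowForm d) (+-congˡ (ev (∂ H) d) (rowForm-ev (sg (dir d)) (axis′ d) (base′ d) b)))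

-- The winding number at (p, q) belongs to the upper right corner of that square.  It is
-- the same at all four corners of a square that the curve does not meet.

Touches : Domino → ℤ → ℤ → Set
Touches d p q = axis′ d ≢ az × Σ Cube λ c → Covers d c × x c ≡ p × y c ≡ q

Untouched : List Domino → ℤ → ℤ → Set
Untouched f p q = ∀ {d} → d ∈ f → ¬ Touches d p q

private
  stepForm : ℤ → ℤ → Form
  stepForm p q ax c = dd (x c) p * dd (y c) q
  stepForm p q _ c = + 0

  stepForm-off : ∀ p q P d → (P ≡ p ⊎ P ≡ p + + 1) → ¬ Touches d P q → ev (stepForm p q) d ≡ + 0
  stepForm-off p q P d PP no-touch = trans (cong (sg (dir d) *_) (go (axis′ d) refl)) (ℤP.*-zeroʳ (sg (dir d)))
    where
    ax≢az : ax ≢ az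
    ax≢az ()
    go : ∀ i → axis′ d ≡ i → stepForm p q i (base′ d) ≡ + 0
    go ay _ = refl
    go az _ = refl
    go ax e with dd-cases (x (base′ d)) p | dd-cases (y (base′ d)) q
    ... | inj₁ e₁ | _ rewrite e₁ = refl
    ... | inj₂ _ | inj₁ e₂ rewrite e₂ = ℤP.*-zeroʳ (dd (x (base′ d)) p)
    ... | inj₂ (_ , e₁) | inj₂ (_ , e₂) = ⊥-elim (no-touch ((λ e′ → ax≢az (trans (sym e) e′)) , cell PP))
      where
      cell : (P ≡ p ⊎ P ≡ p + + 1) → Σ Cube λ c → Covers d c × x c ≡ P × y c ≡ q
      cell (inj₁ e₃) = base′ d , covers-base d , trans e₁ (sym e₃) , e₂
      cell (inj₂ e₃) = up ax (base′ d) , covers-up′ d e , trans (cong (_+ + 1) e₁) (sym e₃) , e₂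

-- The two points are separated only by the edge going up from the centre of `(P , q)`, and a
-- y-arrow on that edge would touch this square.
wind-left : ∀ f {p P} q → P ≡ p + + 1 → Untouched f P q → windAt f p q ≡ windAt f P q
wind-left f {p} q refl un = trans (wind-ev f p q) (trans (∑-cong f local) (sym (wind-ev f (p + + 1) q)))
  where
  ay≢az : ay ≢ az
  ay≢az ()
  r : ∀ a b d → d ≡ + 0 → a * b ≡ (a - d) * b
  r a b .(+ 0) refl = r′ a b
    where
    r′ : ∀ a b → a * b ≡ (a - + 0) * b
    r′ = solve-∀
  go : ∀ d → ¬ Touches d (p + + 1) q → ∀ i → axis′ d ≡ i → crossForm p q i (base′ d) ≡ crossForm (p + + 1) q i (base′ d)
  go d no-touch ax _ = refl
  go d no-touch az _ = refl
  go d no-touch ay e rewrite θ-upʳ (x (base′ d)) p with dd-cases (x (base′ d)) (p + + 1) | dd-cases (y (base′ d)) q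
  ... | inj₁ e₁ | _ = r (θ (x (base′ d)) p) (dd (y (base′ d)) q) _ e₁
  ... | inj₂ _ | inj₁ e₂ rewrite e₂ = trans (ℤP.*-zeroʳ (θ (x (base′ d)) p)) (sym (ℤP.*-zeroʳ (θ (x (base′ d)) p - dd (x (base′ d)) (p + + 1))))
  ... | inj₂ (_ , e₁) | inj₂ (_ , e₂) = ⊥-elim (no-touch ((λ e′ → ay≢az (trans (sym e) e′)) , base′ d , covers-base d , e₁ , e₂))
  local : ∀ d → d ∈ f → ev (crossForm p q) d ≡ ev (crossForm (p + + 1) q) d
  local d m = cong (sg (dir d) *_) (go d (un m) (axis′ d) refl)

private
  -- Raising the ray by one replaces the y-arrows of one row by those of the next. Up to the
  -- differential of `h`, the indicator of the half-row `y = q + 1`, `x > p`, only the x-arrow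
  -- passing between the two points makes a difference.
  wind-step : ∀ f → FlatClosed f → ∀ p q → windAt f p (q + + 1) - windAt f p q ≡ ∑ f (ev (stepForm p (q + + 1)))
  wind-step f closed p q = begin
    windAt f p (q + + 1) - windAt f p q                       ≡⟨ cong₂ _-_ (wind-ev f p (q + + 1)) (wind-ev f p q) ⟩
    ∑ f (ev (crossForm p (q + + 1))) - ∑ f (ev (crossForm p q)) ≡⟨ sym (∑-- f _ _) ⟩
    ∑ f (λ d → ev (crossForm p (q + + 1)) d - ev (crossForm p q) d) ≡⟨ ∑-cong f (λ d _ → lift (sg (dir d)) (axis′ d) (base′ d)) ⟩
    ∑ f (λ d → ev (stepForm p (q + + 1)) d - ev (∂ h) d)      ≡⟨ ∑-- f _ _ ⟩
    ∑ f (ev (stepForm p (q + + 1))) - ∑ f (ev (∂ h))          ≡⟨ cong (λ w → ∑ f (ev (stepForm p (q + + 1))) - w) (trans (∑-ev-∂ f h) (closed (λ a b → dd b (q + + 1) * θ a p))) ⟩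
    ∑ f (ev (stepForm p (q + + 1))) - + 0                     ≡⟨ ℤP.+-identityʳ _ ⟩
    ∑ f (ev (stepForm p (q + + 1))) ∎
    where
    open ≡-Reasoning
    h : Cube → ℤ
    h c = dd (y c) (q + + 1) * θ (x c) p
    lift : ∀ s i c → s * crossForm p (q + + 1) i c - s * crossForm p q i c ≡ s * stepForm p (q + + 1) i c - s * ∂ h i c
    lift s ax c rewrite θ-up (x c) p = r s (dd (y c) (q + + 1)) (θ (x c) p) (dd (x c) p)
      where
      r : ∀ s a t d → s * + 0 - s * + 0 ≡ s * (d * a) - s * (a * (t + d) - a * t)
      r = solve-∀
    lift s ay c rewrite dd-up (y c) q = r s (θ (x c) p) (dd (y c) q) (dd (y c) (q + + 1))
      where
      r : ∀ s t a b → s * (t * b) - s * (t * a) ≡ s * + 0 - s * (a * t - b * t)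
      r = solve-∀
    lift s az c = r s (h c)
      where
      r : ∀ s a → s * + 0 - s * + 0 ≡ s * + 0 - s * (a - a)
      r = solve-∀

wind-below : ∀ f → FlatClosed f → ∀ p P {q Q} → P ≡ p ⊎ P ≡ p + + 1 → Q ≡ q + + 1 → Untouched f P Q →
  windAt f p q ≡ windAt f p Q
wind-below f closed p P {q} PP refl un = sym (ℤP.i-j≡0⇒i≡j _ _ (trans (wind-step f closed p q)
  (∑-zero f (λ d m → stepForm-off p (q + + 1) P d PP (un m)))))

module _ (D : List Sq) (connected : ∀ s s′ → s ∉ D → s′ ∉ D → Conn (_∉ D) s s′)
  (f : List Domino) (closed : FlatClosed f) (inD : ∀ {d c} → d ∈ f → Covers d c → (x c , y c) ∈ D)
  (hi : ℤ) (bound : ∀ {a b} → (a , b) ∈ D → a ℤ.< hi) where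

  private
    untouched : ∀ {p q} → (p , q) ∉ D → Untouched f p q
    untouched n m (_ , c , k , refl , refl) = n (inD m k)

    wind-adj : ∀ s s′ → s ∉ D → s′ ∉ D → SqAdj s s′ → windAt f (proj₁ s) (proj₂ s) ≡ windAt f (proj₁ s′) (proj₂ s′)
    wind-adj (a , b) (a′ , b′) n n′ (inj₁ (refl , inj₁ e)) = wind-below f closed a a (inj₁ refl) e (untouched n′)
    wind-adj (a , b) (a′ , b′) n n′ (inj₁ (refl , inj₂ e)) = sym (wind-below f closed a a (inj₁ refl) e (untouched n))
    wind-adj (a , b) (a′ , b′) n n′ (inj₂ (refl , inj₁ e)) = wind-left f b e (untouched n′)
    wind-adj (a , b) (a′ , b′) n n′ (inj₂ (refl , inj₂ e)) = sym (wind-left f b e (untouched n))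

    start : ∀ {s s′} → Conn (_∉ D) s s′ → s ∉ D
    start (here n) = n
    start (step n _ _) = n

    wind-conn : ∀ {s s′} → Conn (_∉ D) s s′ → windAt f (proj₁ s) (proj₂ s) ≡ windAt f (proj₁ s′) (proj₂ s′)
    wind-conn (here _) = refl
    wind-conn (step n a c) = trans (wind-adj _ _ n (start c) a) (wind-conn c)

    -- A square to the right of all of `D`, so that the ray from it meets no arrow.
    far : (hi , + 0) ∉ D
    far m = ℤP.<-irrefl refl (bound m)

    wind-far : windAt f hi (+ 0) ≡ + 0
    wind-far = trans (wind-ev f hi (+ 0)) (∑-zero f λ d m →
      trans (cong (sg (dir d) *_) (go d m (axis′ d))) (ℤP.*-zeroʳ (sg (dir d))))
      where
      go : ∀ d → d ∈ f → ∀ i → crossForm hi (+ 0) i (base′ d) ≡ + 0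
      go d m ax = refl
      go d m az = refl
      go d m ay rewrite θ-zero {x (base′ d)} {hi} (ℤP.<⇒≤ (bound (inD m (covers-base d)))) = refl

  wind-outside : ∀ {p q} → (p , q) ∉ D → windAt f p q ≡ + 0
  wind-outside n = trans (wind-conn (connected _ _ n far)) wind-far

  -- If one of the four squares lies outside `D`, the chain does not touch it. Then the winding
  -- number at `(p , q)` can be carried unchanged to that square, where it is 0.
  wind-block : ∀ p q → windAt f p q ≢ + 0 → ∀ p′ q′ → p′ ∈₂ p → q′ ∈₂ q → (p′ , q′) ∈ D
  wind-block p q nz p′ q′ P Q with DecMembership._∈?_ _≟Sq_ (p′ , q′) D
  ... | yes m = m
  ... | no n = ⊥-elim (nz (zero-at P Q))
    where
    zero-at : p′ ∈₂ p → q′ ∈₂ q → windAt f p q ≡ + 0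
    zero-at (inj₁ refl) (inj₁ refl) = wind-outside n
    zero-at (inj₁ refl) (inj₂ e) = trans (wind-below f closed p p (inj₁ refl) e (untouched n)) (wind-outside n)
    zero-at (inj₂ e) (inj₁ refl) = trans (wind-left f q e (untouched n)) (wind-outside n)
    zero-at (inj₂ e) (inj₂ e′) = trans (wind-below f closed p p′ (inj₂ e) e′ (untouched n))
      (trans (wind-left f q′ e (untouched n)) (wind-outside n))

-- Closed forms on cylinders

private
  i≤∣i∣ : ∀ i → i ℤ.≤ + ∣ i ∣
  i≤∣i∣ (+ k) = ℤP.≤-refl
  i≤∣i∣ -[1+ k ] = ℤ.-≤+

  ∈-symmetric-range : ∀ M a → ∣ a ∣ ℕ.≤ M → a ∈ heights (- (+ M)) (suc (M ℕ.+ M))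
  ∈-symmetric-range M a h = ∈-heights⁺ lower upper
    where
    upper′ : a ℤ.≤ + M
    upper′ = ℤP.≤-trans (i≤∣i∣ a) (ℤ.+≤+ h)
    lower : - (+ M) ℤ.≤ a
    lower = subst (- (+ M) ℤ.≤_) (ℤP.neg-involutive a) (ℤP.neg-mono-≤ (ℤP.≤-trans (i≤∣i∣ (- a)) (ℤ.+≤+ (subst (ℕ._≤ M) (sym (ℤP.∣-i∣≡∣i∣ a)) h))))
    r : ∀ m → m + + 1 ≡ - m + (+ 1 + (m + m))
    r = solve-∀
    upper : a ℤ.< - (+ M) + + suc (M ℕ.+ M)
    upper = subst (a ℤ.<_) (r (+ M)) (ℤP.≤-<-trans upper′ (i<i+1 (+ M)))

  abs-bound : ∀ (D : List Sq) → Σ ℕ λ M → ∀ {a b} → (a , b) ∈ D → ∣ a ∣ ℕ.≤ M × ∣ b ∣ ℕ.≤ M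
  abs-bound [] = 0 , λ ()
  abs-bound ((a , b) ∷ D) with abs-bound D
  ... | M , h = ∣ a ∣ ℕ.+ (∣ b ∣ ℕ.+ M) , bound
    where
    big : M ℕ.≤ ∣ a ∣ ℕ.+ (∣ b ∣ ℕ.+ M)
    big = ℕP.≤-trans (ℕP.m≤n+m M ∣ b ∣) (ℕP.m≤n+m _ ∣ a ∣)
    bound : ∀ {p q} → (p , q) ∈ (a , b) ∷ D → ∣ p ∣ ℕ.≤ ∣ a ∣ ℕ.+ (∣ b ∣ ℕ.+ M) × ∣ q ∣ ℕ.≤ ∣ a ∣ ℕ.+ (∣ b ∣ ℕ.+ M)
    bound (here refl) = ℕP.m≤m+n ∣ a ∣ _ , ℕP.≤-trans (ℕP.m≤m+n ∣ b ∣ M) (ℕP.m≤n+m _ ∣ a ∣)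
    bound (there m) = ℕP.≤-trans (proj₁ (h m)) big , ℕP.≤-trans (proj₂ (h m)) big

in-square : ∀ (D : List Sq) → Σ ℤ λ lo → Σ ℕ λ n → ∀ {a b} → (a , b) ∈ D → a ∈ heights lo n × b ∈ heights lo n
in-square D with abs-bound D
... | M , h = - (+ M) , suc (M ℕ.+ M) , λ m →
  ∈-symmetric-range M _ (proj₁ (h m)) , ∈-symmetric-range M _ (proj₂ (h m))

Inside : Region → List Domino → Set
Inside R f = ∀ {d c} → d ∈ f → Covers d c → R c

Closed : List Domino → Set
Closed f = ∀ h → bd f h ≡ + 0

ClosedOn : Region → Form → Set
ClosedOn R ℓ = ∀ i j c → i ≢ j → R c → R (up i c) → R (up j c) → R (up j (up i c)) → curl ℓ i j c ≡ + 0

-- Every term of the Stokes sum has a vanishing factor: the curl if the four squares around the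
-- point belong to `D`, and the winding number otherwise.
planar-exact : ∀ D → IsCylBase D → ∀ J → (∀ p q → J az p q ≡ + 0) →
  (∀ p q → (∀ p′ q′ → p′ ∈₂ p → q′ ∈₂ q → (p′ , q′) ∈ D) → pcurl J p q ≡ + 0) →
  ∀ f → (∀ {d c} → d ∈ f → Covers d c → (x c , y c) ∈ D) → FlatClosed f → ∑ f (ev (planar J)) ≡ + 0
planar-exact D (_ , _ , conn) J J-az curl0 f inD closed with in-square D
... | lo , n , range = trans (stokes lo n f (λ {d} m → range (inD m (covers-base d))) closed J J-az)
  (∑-zero rng λ p _ → ∑-zero rng λ q _ → term p q)
  where
  rng = heights lo n
  term : ∀ p q → windAt f p q * pcurl J p q ≡ + 0
  term p q with windAt f p q ℤP.≟ + 0
  ... | yes e = cong (_* pcurl J p q) e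
  ... | no nz = trans (cong (windAt f p q *_) (curl0 p q (wind-block D conn f closed inD (lo + + n) (λ m → proj₂ (∈-heights⁻ {lo} {n} (proj₁ (range m)))) p q nz)))
                      (ℤP.*-zeroʳ (windAt f p q))

-- Subtracting the differential of the vertical primitive of ℓ leaves the pullback of its
-- restriction to the bottom layer.
exact-z : ∀ l D N → IsCylBase D → 1 ℕ.≤ N → let C = cyl az l D N in
  ∀ ℓ → ClosedOn (InCyl C) ℓ → ∀ f → Inside (InCyl C) f → Closed f → ∑ f (ev ℓ) ≡ + 0
exact-z l D N cb N≥1 ℓ closed f inside f-closed = begin
  ∑ f (ev ℓ)                                 ≡⟨ ∑-cong f (λ d m → trans (cong (sg (dir d) *_) (split (axis′ d) (base′ d) (inside m (covers-base d)) (inside m (covers-up d)))) (ev-+ (∂ h) (planar J) d)) ⟩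
  ∑ f (λ d → ev (∂ h) d + ev (planar J) d)   ≡⟨ ∑-+ f _ _ ⟩
  ∑ f (ev (∂ h)) + ∑ f (ev (planar J))       ≡⟨ cong₂ _+_ (trans (∑-ev-∂ f h) (f-closed h)) (planar-exact D cb J (λ _ _ → refl) curl0 f (λ m k → proj₁ (inside m k)) (λ H → f-closed (λ c → H (x c) (y c)))) ⟩
  + 0 ∎
  where
  open ≡-Reasoning
  C = cyl az l D N
  lev = heights l N
  J : PForm
  J az p q = + 0
  J i p q = ℓ i (v3 p q l)
  h : Cube → ℤ
  h c = ∑ lev (λ k → θ (z c) k * ℓ az (v3 (x c) (y c) k))

  bottom : ∀ {p q} → (p , q) ∈ D → InCyl C (v3 p q l)
  bottom m = m , ℤP.≤-refl , subst (ℤ._< l + + N) (ℤP.+-identityʳ l) (ℤP.+-monoʳ-< l (ℤ.+<+ N≥1))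

  curl0 : ∀ p q → (∀ p′ q′ → p′ ∈₂ p → q′ ∈₂ q → (p′ , q′) ∈ D) → pcurl J p q ≡ + 0
  curl0 p q c = closed ax ay (v3 p q l) (λ ()) (bottom (c _ _ (inj₁ refl) (inj₁ refl))) (bottom (c _ _ (inj₂ refl) (inj₁ refl)))
    (bottom (c _ _ (inj₁ refl) (inj₂ refl))) (bottom (c _ _ (inj₂ refl) (inj₂ refl)))

  vertical : ∀ i → i ≢ az → (J≡ : ∀ p q → J i p q ≡ ℓ i (v3 p q l)) →
    (flat : ∀ c → z (up i c) ≡ z c) → (col : ∀ c k → v3 (x (up i c)) (y (up i c)) k ≡ up i (v3 (x c) (y c) k)) →
    (swap : ∀ p q k → up az (up i (v3 p q k)) ≡ up i (v3 p q (k + + 1))) →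
    ∀ c → InCyl C c → InCyl C (up i c) → ℓ i c ≡ ∂ h i c + planar J i c
  vertical i i≢az J≡ flat col swap c c∈ u∈ = sym (begin
    h (up i c) - h c + J i (x c) (y c)
      ≡⟨ cong₂ (λ a b → a - h c + b) (∑-cong lev (λ k _ → cong₂ _*_ (cong (λ w → θ w k) (flat c)) (cong (ℓ az) (col c k)))) (J≡ _ _) ⟩
    ∑ lev (λ k → θ (z c) k * ℓ az (up i (at k))) - h c + ℓ i (at l)
      ≡⟨ cong (_+ ℓ i (at l)) (sym (∑-- lev _ _)) ⟩
    ∑ lev (λ k → θ (z c) k * ℓ az (up i (at k)) - θ (z c) k * ℓ az (at k)) + ℓ i (at l)
      ≡⟨ cong (_+ ℓ i (at l)) (∑-cong lev λ k m → slice k m) ⟩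
    ∑ lev (λ k → θ (z c) k * (ℓ i (at (k + + 1)) - ℓ i (at k))) + ℓ i (at l)
      ≡⟨ cong (_+ ℓ i (at l)) (∑-telescope (λ k → ℓ i (at k)) l N (proj₁ (proj₂ c∈)) (ℤP.<⇒≤ (proj₂ (proj₂ c∈)))) ⟩
    ℓ i c - ℓ i (at l) + ℓ i (at l)
      ≡⟨ r (ℓ i c) (ℓ i (at l)) ⟩
    ℓ i c ∎)
    where
    at : ℤ → Cube
    at k = v3 (x c) (y c) k
    r : ∀ a b → a - b + b ≡ a
    r = solve-∀
    r′ : ∀ t a b c d → a + b - c - d ≡ + 0 → t * b - t * d ≡ t * (c - a)
    r′ t a b c d e = trans (r₁ t a b c d) (trans (cong (λ w → t * w + t * (c - a)) e) (r₂ t a c))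
      where
      r₁ : ∀ t a b c d → t * b - t * d ≡ t * (a + b - c - d) + t * (c - a)
      r₁ = solve-∀
      r₂ : ∀ t a c → t * + 0 + t * (c - a) ≡ t * (c - a)
      r₂ = solve-∀
    upD : (x (up i c) , y (up i c)) ∈ D
    upD = proj₁ u∈
    at∈ : ∀ {k} → l ℤ.≤ k → k ℤ.≤ z c → InCyl C (at k)
    at∈ a b = proj₁ c∈ , a , ℤP.≤-<-trans b (proj₂ (proj₂ c∈))
    up∈ : ∀ {k} → l ℤ.≤ k → k ℤ.≤ z c → InCyl C (up i (at k))
    up∈ {k} a b = subst (InCyl C) (col c k) (upD , a , ℤP.≤-<-trans b (proj₂ (proj₂ c∈)))
    -- Closedness on the vertical square at height `k` trades vertical arrows for horizontal ones,
    -- which telescope in `k`. From height `z c` on the square may leave the cylinder, but there the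
    -- weight `θ` is 0.
    slice : ∀ k → k ∈ lev → θ (z c) k * ℓ az (up i (at k)) - θ (z c) k * ℓ az (at k) ≡ θ (z c) k * (ℓ i (at (k + + 1)) - ℓ i (at k))
    slice k m with k ℤP.<? z c
    ... | no n = z0 (θ-zero (ℤP.≮⇒≥ n))
      where
      z0 : θ (z c) k ≡ + 0 → θ (z c) k * ℓ az (up i (at k)) - θ (z c) k * ℓ az (at k) ≡ θ (z c) k * (ℓ i (at (k + + 1)) - ℓ i (at k))
      z0 e rewrite e = refl
    ... | yes k<z = r′ (θ (z c) k) (ℓ i (at k)) (ℓ az (up i (at k))) (ℓ i (at (k + + 1))) (ℓ az (at k)) (closed i az (at k) i≢az (at∈ lk (ℤP.<⇒≤ k<z)) (up∈ lk (ℤP.<⇒≤ k<z))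
          (at∈ lk′ (<⇒+1≤ k<z)) (subst (InCyl C) (sym (swap _ _ k)) (up∈ lk′ (<⇒+1≤ k<z))))
      where
      lk = proj₁ (∈-heights⁻ {l} {N} m)
      lk′ : l ℤ.≤ k + + 1
      lk′ = ℤP.≤-trans lk (ℤP.<⇒≤ (i<i+1 k))

  split : ∀ i c → InCyl C c → InCyl C (up i c) → ℓ i c ≡ ∂ h i c + planar J i c
  split ax = vertical ax (λ ()) (λ _ _ → refl) (λ _ → refl) (λ _ _ → refl) (λ _ _ _ → refl)
  split ay = vertical ay (λ ()) (λ _ _ → refl) (λ _ → refl) (λ _ _ → refl) (λ _ _ _ → refl)
  split az c c∈ u∈ = sym (trans (ℤP.+-identityʳ _) (trans (sym (∑-- lev _ _))
    (trans (∑-cong lev λ k _ → trans (cong (λ w → w * ℓ az (v3 (x c) (y c) k) - θ (z c) k * ℓ az (v3 (x c) (y c) k)) (θ-up (z c) k)) (r (θ (z c) k) (dd (z c) k) _))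
    (∑-pick (heights-unique l N) (∈-heights⁺ (proj₁ (proj₂ c∈)) (proj₂ (proj₂ c∈))) (λ k → ℓ az (v3 (x c) (y c) k))))))
    where
    r : ∀ a b c → (a + b) * c - a * c ≡ b * c
    r = solve-∀

-- Permutations of the coordinates

-- Chosen to fit `proj` and `along`, so that membership in a cylinder is preserved by definition:
-- `rot` turns the axis x into z, `yz` turns y into z, and `xy` turns y into x. The last two reverse
-- the orientation of space.
data Perm₃ : Set where
  rot yz xy : Perm₃

pc pc⁻¹ : Perm₃ → Cube → Cube
pc rot c = v3 (y c) (z c) (x c)
pc yz c = v3 (x c) (z c) (y c)
pc xy c = v3 (y c) (x c) (z c)
pc⁻¹ rot c = v3 (z c) (x c) (y c)
pc⁻¹ yz c = v3 (x c) (z c) (y c)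
pc⁻¹ xy c = v3 (y c) (x c) (z c)

pa pa⁻¹ : Perm₃ → Axis → Axis
pa rot ax = az
pa rot ay = ax
pa rot az = ay
pa yz ax = ax
pa yz ay = az
pa yz az = ay
pa xy ax = ay
pa xy ay = ax
pa xy az = az
pa⁻¹ rot ax = ay
pa⁻¹ rot ay = az
pa⁻¹ rot az = ax
pa⁻¹ yz i = pa yz i
pa⁻¹ xy i = pa xy i

orient : ℤ → Axis → Dir
orient (+ _) ax = +x
orient (+ _) ay = +y
orient (+ _) az = +z
orient -[1+ _ ] ax = -x
orient -[1+ _ ] ay = -y
orient -[1+ _ ] az = -z

pd : Perm₃ → Dir → Dir
pd π δ = orient (sg δ) (pa π (axisOf δ))

permD : Perm₃ → Domino → Domino
permD π d = dom (pc π (wc d)) (pd π (dir d))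

pc-inverse : ∀ π c → pc⁻¹ π (pc π c) ≡ c
pc-inverse rot c = refl
pc-inverse yz c = refl
pc-inverse xy c = refl

pc-inverseʳ : ∀ π c → pc π (pc⁻¹ π c) ≡ c
pc-inverseʳ rot c = refl
pc-inverseʳ yz c = refl
pc-inverseʳ xy c = refl

pa-inverse : ∀ π i → pa⁻¹ π (pa π i) ≡ i
pa-inverse rot ax = refl
pa-inverse rot ay = refl
pa-inverse rot az = refl
pa-inverse yz ax = refl
pa-inverse yz ay = refl
pa-inverse yz az = refl
pa-inverse xy ax = refl
pa-inverse xy ay = refl
pa-inverse xy az = refl

pa⁻¹-injective : ∀ π {i j} → pa⁻¹ π i ≡ pa⁻¹ π j → i ≡ j
pa⁻¹-injective π {i} {j} e = trans (sym (inv π i)) (trans (cong (pa π) e) (inv π j))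
  where
  inv : ∀ π i → pa π (pa⁻¹ π i) ≡ i
  inv rot ax = refl
  inv rot ay = refl
  inv rot az = refl
  inv yz ax = refl
  inv yz ay = refl
  inv yz az = refl
  inv xy ax = refl
  inv xy ay = refl
  inv xy az = refl

pc⁻¹-up : ∀ π i c → pc⁻¹ π (up i c) ≡ up (pa⁻¹ π i) (pc⁻¹ π c)
pc⁻¹-up rot ax c = refl
pc⁻¹-up rot ay c = refl
pc⁻¹-up rot az c = refl
pc⁻¹-up yz ax c = refl
pc⁻¹-up yz ay c = refl
pc⁻¹-up yz az c = refl
pc⁻¹-up xy ax c = refl
pc⁻¹-up xy ay c = refl
pc⁻¹-up xy az c = refl

private
  vec-perm : ∀ π δ → vec (pd π δ) ≡ pc π (vec δ)
  vec-perm rot +x = refl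
  vec-perm rot -x = refl
  vec-perm rot +y = refl
  vec-perm rot -y = refl
  vec-perm rot +z = refl
  vec-perm rot -z = refl
  vec-perm yz +x = refl
  vec-perm yz -x = refl
  vec-perm yz +y = refl
  vec-perm yz -y = refl
  vec-perm yz +z = refl
  vec-perm yz -z = refl
  vec-perm xy +x = refl
  vec-perm xy -x = refl
  vec-perm xy +y = refl
  vec-perm xy -y = refl
  vec-perm xy +z = refl
  vec-perm xy -z = refl

  orient-sg : ∀ δ i → sg (orient (sg δ) i) ≡ sg δ
  orient-sg δ i with δ | i
  ... | +x | ax = refl
  ... | +x | ay = refl
  ... | +x | az = refl
  ... | -x | ax = refl
  ... | -x | ay = refl
  ... | -x | az = refl
  ... | +y | ax = refl
  ... | +y | ay = refl
  ... | +y | az = refl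
  ... | -y | ax = refl
  ... | -y | ay = refl
  ... | -y | az = refl
  ... | +z | ax = refl
  ... | +z | ay = refl
  ... | +z | az = refl
  ... | -z | ax = refl
  ... | -z | ay = refl
  ... | -z | az = refl

  orient-axis : ∀ s i → axisOf (orient s i) ≡ i
  orient-axis (+ _) ax = refl
  orient-axis (+ _) ay = refl
  orient-axis (+ _) az = refl
  orient-axis -[1+ _ ] ax = refl
  orient-axis -[1+ _ ] ay = refl
  orient-axis -[1+ _ ] az = refl

  baseOf-sg : ∀ δ w b → (sg δ ≡ + 1 × baseOf δ w b ≡ w) ⊎ (sg δ ≡ - + 1 × baseOf δ w b ≡ b)
  baseOf-sg +x w b = inj₁ (refl , refl)
  baseOf-sg -x w b = inj₂ (refl , refl)
  baseOf-sg +y w b = inj₁ (refl , refl)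
  baseOf-sg -y w b = inj₂ (refl , refl)
  baseOf-sg +z w b = inj₁ (refl , refl)
  baseOf-sg -z w b = inj₂ (refl , refl)

bc-perm : ∀ π d → bc (permD π d) ≡ pc π (bc d)
bc-perm π d = trans (cong (pc π (wc d) ⊕_) (vec-perm π (dir d))) (go π)
  where
  go : ∀ π → pc π (wc d) ⊕ pc π (vec (dir d)) ≡ pc π (wc d ⊕ vec (dir d))
  go rot = refl
  go yz = refl
  go xy = refl

base-perm : ∀ π d → base′ (permD π d) ≡ pc π (base′ d)
base-perm π d with baseOf-sg (pd π (dir d)) (pc π (wc d)) (bc (permD π d)) | baseOf-sg (dir d) (wc d) (bc d)
... | inj₁ (_ , e) | inj₁ (_ , e′) = trans e (cong (pc π) (sym e′))
... | inj₂ (_ , e) | inj₂ (_ , e′) = trans e (trans (bc-perm π d) (cong (pc π) (sym e′)))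
... | inj₁ (s , _) | inj₂ (s′ , _) with () ← trans (sym s) (trans (orient-sg (dir d) (pa π (axis′ d))) s′)
... | inj₂ (s , _) | inj₁ (s′ , _) with () ← trans (sym s) (trans (orient-sg (dir d) (pa π (axis′ d))) s′)

ev-perm : ∀ π ℓ d → ev ℓ (permD π d) ≡ ev (λ i c → ℓ (pa π i) (pc π c)) d
ev-perm π ℓ d rewrite base-perm π d | orient-axis (sg (dir d)) (pa π (axis′ d)) | orient-sg (dir d) (pa π (axis′ d)) = refl

covers-perm⁻ : ∀ π d {c} → Covers (permD π d) c → Covers d (pc⁻¹ π c)
covers-perm⁻ π d (inj₁ refl) = inj₁ (pc-inverse π (wc d))
covers-perm⁻ π d (inj₂ refl) = inj₂ (trans (cong (pc⁻¹ π) (bc-perm π d)) (pc-inverse π (bc d)))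

covers-perm : ∀ π d {c} → Covers d (pc⁻¹ π c) → Covers (permD π d) c
covers-perm π d {c} (inj₁ e) = inj₁ (trans (sym (pc-inverseʳ π c)) (cong (pc π) e))
covers-perm π d {c} (inj₂ e) = inj₂ (trans (sym (pc-inverseʳ π c)) (trans (cong (pc π) e) (sym (bc-perm π d))))

bd-perm : ∀ π f h → bd (map (permD π) f) h ≡ bd f (λ c → h (pc π c))
bd-perm π f h = trans (∑-map (permD π) f _) (∑-cong f λ d _ → cong (λ w → h w - h (pc π (wc d))) (bc-perm π d))

private
  exact-perm : ∀ π i l D N → (∀ c → InCyl (cyl az l D N) c → InCyl (cyl i l D N) (pc⁻¹ π c)) →
    (∀ c → InCyl (cyl i l D N) (pc⁻¹ π c) → InCyl (cyl az l D N) c) → IsCylBase D → 1 ℕ.≤ N →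
    ∀ ℓ → ClosedOn (InCyl (cyl i l D N)) ℓ → ∀ f → Inside (InCyl (cyl i l D N)) f → Closed f → ∑ f (ev ℓ) ≡ + 0
  exact-perm π i l D N from to cb N≥1 ℓ closed f inside f-closed = begin
    ∑ f (ev ℓ)                     ≡⟨ ∑-cong f (λ d _ → cong (sg (dir d) *_) (sym (cong₂ ℓ (pa-inverse π (axis′ d)) (pc-inverse π (base′ d))))) ⟩
    ∑ f (ev (λ j c → ℓ′ (pa π j) (pc π c)))  ≡⟨ ∑-cong f (λ d _ → sym (ev-perm π ℓ′ d)) ⟩
    ∑ f (λ d → ev ℓ′ (permD π d))  ≡⟨ sym (∑-map (permD π) f (ev ℓ′)) ⟩
    ∑ (map (permD π) f) (ev ℓ′)    ≡⟨ exact-z l D N cb N≥1 ℓ′ closed′ (map (permD π) f) inside′ (λ h → trans (bd-perm π f h) (f-closed (λ c → h (pc π c)))) ⟩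
    + 0 ∎
    where
    open ≡-Reasoning
    ℓ′ : Form
    ℓ′ j c = ℓ (pa⁻¹ π j) (pc⁻¹ π c)
    closed′ : ClosedOn (InCyl (cyl az l D N)) ℓ′
    closed′ j k c j≢k a b e g
      rewrite pc⁻¹-up π j c | pc⁻¹-up π k c =
      closed (pa⁻¹ π j) (pa⁻¹ π k) (pc⁻¹ π c) (λ q → j≢k (pa⁻¹-injective π q)) (from c a)
        (subst (InCyl (cyl i l D N)) (pc⁻¹-up π j c) (from _ b)) (subst (InCyl (cyl i l D N)) (pc⁻¹-up π k c) (from _ e))
        (subst (InCyl (cyl i l D N)) (trans (pc⁻¹-up π k (up j c)) (cong (up (pa⁻¹ π k)) (pc⁻¹-up π j c))) (from _ g))
    inside′ : Inside (InCyl (cyl az l D N)) (map (permD π) f)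
    inside′ m k with ∈-map⁻ (permD π) m
    ... | d , d∈ , refl = to _ (inside d∈ (covers-perm⁻ π d k))

-- Being closed is a vanishing condition on all squares, so it survives every relabelling of the
-- coordinates, whatever the orientation.
exact : ∀ C → IsCylinder C → ∀ ℓ → ClosedOn (InCyl C) ℓ → ∀ f → Inside (InCyl C) f → Closed f → ∑ f (ev ℓ) ≡ + 0
exact (cyl ax l D N) (cb , N≥1) = exact-perm rot ax l D N (λ _ h → h) (λ _ h → h) cb N≥1
exact (cyl ay l D N) (cb , N≥1) = exact-perm yz ay l D N (λ _ h → h) (λ _ h → h) cb N≥1
exact (cyl az l D N) (cb , N≥1) = exact-z l D N cb N≥1

tiling-perm : ∀ π {R R′ : Region} {t} → (∀ c → R c → R′ (pc π c)) → (∀ c → R′ c → R (pc⁻¹ π c)) →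
  IsTiling R t → IsTiling R′ (map (permD π) t)
tiling-perm π {R} {R′} {t} to from (w , i , c , dj) =
    AllP.map⁺ (All.map (λ {d} → white π (wc d)) w)
  , AllP.map⁺ (All.map (λ {d} h c k → subst R′ (pc-inverseʳ π c) (to _ (h _ (covers-perm⁻ π d k)))) i)
  , (λ q r → cover q (c _ (from q r)))
  , pairs dj
  where
  white : ∀ π c → IsWhite c → IsWhite (pc π c)
  white rot c h = trans (cong (λ w → ∣ w ∣ ℕ.% 2) (l (x c) (y c) (z c))) h
    where
    l : ∀ a b c → b + c + a ≡ a + b + c
    l = solve-∀
  white yz c h = trans (cong (λ w → ∣ w ∣ ℕ.% 2) (l (x c) (y c) (z c))) h
    where
    l : ∀ a b c → a + c + b ≡ a + b + c
    l = solve-∀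
  white xy c h = trans (cong (λ w → ∣ w ∣ ℕ.% 2) (l (x c) (y c) (z c))) h
    where
    l : ∀ a b c → b + a + c ≡ a + b + c
    l = solve-∀
  cover : ∀ q → Any (λ d → Covers d (pc⁻¹ π q)) t → Any (λ d → Covers d q) (map (permD π) t)
  cover q a with find a
  ... | d , d∈ , k = lose (∈-map⁺ (permD π) d∈) (covers-perm π d k)
  pairs : ∀ {u} → AllPairs Disj u → AllPairs Disj (map (permD π) u)
  pairs [] = []
  pairs {d ∷ u} (a ∷ p) = AllP.map⁺ (All.map (λ {e} D c k k′ → D _ (covers-perm⁻ π d k) (covers-perm⁻ π e k′)) a) ∷ pairs p

-- Bilinearity of the pairing

pair-∑ : ∀ K f g → pair K f g ≡ ∑ g (λ b → ∑ f (λ a → ev² K a b))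
pair-∑ K f g = ∑-swap f g (ev² K)

pair-++ˡ : ∀ K f f′ g → pair K (f ++ f′) g ≡ pair K f g + pair K f′ g
pair-++ˡ K f f′ g = ∑-++ f f′ _

pair-++ʳ : ∀ K f g g′ → pair K f (g ++ g′) ≡ pair K f g + pair K f g′
pair-++ʳ K f g g′ = trans (∑-cong f λ a _ → ∑-++ g g′ (ev² K a)) (∑-+ f _ _)

pair-↭ : ∀ K {f f′ g g′} → f ↭ f′ → g ↭ g′ → pair K f g ≡ pair K f′ g′
pair-↭ K {f} p q = trans (∑-cong f λ a _ → ∑-↭ (ev² K a) q) (∑-↭ _ p)

pair-KS : ∀ f g → pair KS f g ≡ pair KB f g + pair KB g f
pair-KS f g = begin
  pair KS f g                                              ≡⟨ ∑-cong f (λ a _ → trans (∑-cong g λ b _ → split a b) (∑-+ g _ _)) ⟩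
  ∑ f (λ a → ∑ g (ev² KB a) + ∑ g (λ b → ev² KB b a))      ≡⟨ ∑-+ f _ _ ⟩
  pair KB f g + ∑ f (λ a → ∑ g (λ b → ev² KB b a))         ≡⟨ +-congˡ (pair KB f g) (sym (pair-∑ KB g f)) ⟩
  pair KB f g + pair KB g f ∎
  where
  open ≡-Reasoning
  r : ∀ s t a b → s * (t * (a + b)) ≡ s * (t * a) + t * (s * b)
  r = solve-∀
  split : ∀ a b → ev² KS a b ≡ ev² KB a b + ev² KB b a
  split a b = r (sg (dir a)) (sg (dir b)) _ _

pair-square-++ : ∀ f g → pair KB (f ++ g) (f ++ g) ≡ pair KB f f + pair KS f g + pair KB g g
pair-square-++ f g = begin
  pair KB (f ++ g) (f ++ g)
    ≡⟨ trans (pair-++ˡ KB f g (f ++ g)) (cong₂ _+_ (pair-++ʳ KB f f g) (pair-++ʳ KB g f g)) ⟩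
  pair KB f f + pair KB f g + (pair KB g f + pair KB g g)
    ≡⟨ r (pair KB f f) (pair KB f g) (pair KB g f) (pair KB g g) ⟩
  pair KB f f + (pair KB f g + pair KB g f) + pair KB g g
    ≡⟨ cong (λ w → pair KB f f + w + pair KB g g) (sym (pair-KS f g)) ⟩
  pair KB f f + pair KS f g + pair KB g g ∎
  where
  open ≡-Reasoning
  r : ∀ a b c d → a + b + (c + d) ≡ a + (b + c) + d
  r = solve-∀

bd-++ : ∀ f g h → bd (f ++ g) h ≡ bd f h + bd g h
bd-++ f g h = ∑-++ f g _

bd-↭ : ∀ {f g} h → f ↭ g → bd f h ≡ bd g h
bd-↭ h = ∑-↭ _

-- Flips

axis-≟ : (i j : Axis) → Dec (i ≡ j)
axis-≟ ax ax = yes refl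
axis-≟ ax ay = no λ ()
axis-≟ ax az = no λ ()
axis-≟ ay ax = no λ ()
axis-≟ ay ay = yes refl
axis-≟ ay az = no λ ()
axis-≟ az ax = no λ ()
axis-≟ az ay = no λ ()
axis-≟ az az = yes refl

_≟V_ : (a b : V3) → Dec (a ≡ b)
v3 a b c ≟V v3 a′ b′ c′ = map′ (λ { (refl , refl , refl) → refl }) (λ { refl → refl , refl , refl })
  (a ℤP.≟ a′ ×-dec (b ℤP.≟ b′ ×-dec c ℤP.≟ c′))

orient-split : ∀ δ → orient (sg δ) (axisOf δ) ≡ δ
orient-split +x = refl
orient-split -x = refl
orient-split +y = refl
orient-split -y = refl
orient-split +z = refl
orient-split -z = refl

_≟Dir_ : (δ δ′ : Dir) → Dec (δ ≡ δ′)
δ ≟Dir δ′ = map′ (λ (e , e′) → trans (sym (orient-split δ)) (trans (cong₂ orient e e′) (orient-split δ′)))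
  (λ { refl → refl , refl }) (sg δ ℤP.≟ sg δ′ ×-dec axis-≟ (axisOf δ) (axisOf δ′))

_≟D_ : (d e : Domino) → Dec (d ≡ e)
dom w δ ≟D dom w′ δ′ = map′ (λ { (refl , refl) → refl }) (λ { refl → refl , refl }) (w ≟V w′ ×-dec δ ≟Dir δ′)

open DecMembership _≟D_ using (_∈?_)

-- The condition `meets` keeps the new dominoes out of the common part `r`: a new domino in `r`
-- would overlap a removed one inside the tiling `t₀`.
replaces-split : ∀ {R R′ t₀ t₁} A E → IsTiling R t₀ → IsTiling R′ t₁ → Replaces t₀ A E t₁ → Unique A → Unique E →
  (∀ {e} → e ∈ E → Σ Domino λ a → a ∈ A × Σ Cube λ c → Covers e c × Covers a c) →
  Σ (List Domino) λ r → t₀ ↭ A ++ r × t₁ ↭ E ++ r × (∀ {d} → d ∈ r → d ∈ t₀ × d ∉ A)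
replaces-split {t₀ = t₀} {t₁} A E T₀ T₁ (A⊆ , t₁⇔) uA uE meets =
  r , unique-↭ (tiling-unique T₀) (UniqueP.++⁺ uA ur (λ (a , b) → proj₂ (r⁻ b) a)) i₀ j₀
    , unique-↭ (tiling-unique T₁) (UniqueP.++⁺ uE ur (λ (a , b) → E∉r a b)) i₁ j₁
    , r⁻
  where
  P? = λ d → ¬? (d ∈? A)
  r = filter P? t₀
  ur : Unique r
  ur = UniqueP.filter⁺ P? (tiling-unique T₀)
  r⁻ : ∀ {d} → d ∈ r → d ∈ t₀ × d ∉ A
  r⁻ = ∈-filter⁻ P?
  E∉r : ∀ {e} → e ∈ E → e ∉ r
  E∉r m n with meets m
  ... | a , a∈ , c , k , k′ = proj₂ (r⁻ n) (subst (_∈ A) (sym (tiling-overlap T₀ (proj₁ (r⁻ n)) (All.lookup A⊆ a∈) k k′)) a∈)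
  i₀ : ∀ {d} → d ∈ t₀ → d ∈ A ++ r
  i₀ {d} m with d ∈? A
  ... | yes a = ∈-++⁺ˡ a
  ... | no n = ∈-++⁺ʳ A (∈-filter⁺ P? m n)
  j₀ : ∀ {d} → d ∈ A ++ r → d ∈ t₀
  j₀ m with ∈-++⁻ A m
  ... | inj₁ a = All.lookup A⊆ a
  ... | inj₂ b = proj₁ (r⁻ b)
  i₁ : ∀ {d} → d ∈ t₁ → d ∈ E ++ r
  i₁ {d} m with Equivalence.to (t₁⇔ d) m
  ... | inj₁ (a , b) = ∈-++⁺ʳ E (∈-filter⁺ P? a b)
  ... | inj₂ e = ∈-++⁺ˡ e
  j₁ : ∀ {d} → d ∈ E ++ r → d ∈ t₁
  j₁ {d} m with ∈-++⁻ E m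
  ... | inj₁ e = Equivalence.from (t₁⇔ d) (inj₂ e)
  ... | inj₂ b = Equivalence.from (t₁⇔ d) (inj₁ (r⁻ b))

-- The crossings of the common part with itself cancel; the rest enters only through the 1-form
-- `form KS r`.
move-difference : ∀ {t₀ t₁} A E r → t₀ ↭ A ++ r → t₁ ↭ E ++ r →
  pair KB t₁ t₁ - pair KB t₀ t₀ ≡ pair KB E E - pair KB A A + (∑ E (ev (form KS r)) - ∑ A (ev (form KS r)))
move-difference {t₀} {t₁} A E r p q = begin
  pair KB t₁ t₁ - pair KB t₀ t₀
    ≡⟨ cong₂ _-_ (trans (pair-↭ KB q q) (pair-square-++ E r)) (trans (pair-↭ KB p p) (pair-square-++ A r)) ⟩
  pair KB E E + pair KS E r + pair KB r r - (pair KB A A + pair KS A r + pair KB r r)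
    ≡⟨ l (pair KB E E) (pair KS E r) (pair KB r r) (pair KB A A) (pair KS A r) ⟩
  pair KB E E - pair KB A A + (pair KS E r - pair KS A r)
    ≡⟨ cong (λ w → pair KB E E - pair KB A A + w) (cong₂ _-_ (pair-form KS E r) (pair-form KS A r)) ⟩
  pair KB E E - pair KB A A + (∑ E (ev (form KS r)) - ∑ A (ev (form KS r))) ∎
  where
  open ≡-Reasoning
  l : ∀ a b c d e → a + b + c - (d + e + c) ≡ a - d + (b - e)
  l = solve-∀

curl-swap : ∀ ℓ i j c → curl ℓ j i c ≡ - curl ℓ i j c
curl-swap ℓ i j c = l (ℓ j c) (ℓ i (up j c)) (ℓ j (up i c)) (ℓ i c)
  where
  l : ∀ a b c d → a + b - c - d ≡ - (d + c - b - a)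
  l = solve-∀

curl-diagonal : ∀ ℓ i c → curl ℓ i i c ≡ + 0
curl-diagonal ℓ i c = l (ℓ i c) (ℓ i (up i c))
  where
  l : ∀ a b → a + b - b - a ≡ + 0
  l = solve-∀

-- The flux through the square spanned by two axes, with the normal determined by their order.
-- `nside` is the matching error term, which only horizontal squares have.
nflux : Axis → Axis → Cube → Form
nflux ax ay p j b = flux az p j b
nflux ay ax p j b = - flux az p j b
nflux ax az p j b = - flux ay p j b
nflux az ax p j b = flux ay p j b
nflux ay az p j b = flux ax p j b
nflux az ay p j b = - flux ax p j b
nflux _ _ p j b = + 0

nside : Axis → Axis → Cube → Cube → ℤ
nside ax ay p q = side p q
nside ay ax p q = - side p q
nside _ _ p q = + 0

private
  ∑-ev-neg : ∀ g ℓ → ∑ g (ev (λ i c → - ℓ i c)) ≡ - ∑ g (ev ℓ)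
  ∑-ev-neg g ℓ = trans (∑-cong g λ d _ → sym (ℤP.neg-distribʳ-* (sg (dir d)) _)) (∑-neg g (ev ℓ))

  ∑-ev-zero : ∀ g → ∑ g (ev (λ _ _ → + 0)) ≡ + 0
  ∑-ev-zero g = ∑-zero g λ d _ → ℤP.*-zeroʳ (sg (dir d))

  bd-zero : ∀ g → bd g (λ _ → + 0) ≡ + 0
  bd-zero g = ∑-zero g λ _ _ → refl

bd-neg : ∀ g h → bd g (λ c → - h c) ≡ - bd g h
bd-neg g h = trans (∑-cong g λ d _ → l (h (bc d)) (h (wc d))) (∑-neg g _)
  where
  l : ∀ a b → - a - - b ≡ - (a - b)
  l = solve-∀

curl-KS : ∀ g i j p → curl (form KS g) i j p ≡ ∑ g (ev (nflux i j p)) + bd g (nside i j p)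
curl-KS g ax ax p = trans (curl-diagonal (form KS g) ax p) (sym (cong₂ _+_ (∑-ev-zero g) (bd-zero g)))
curl-KS g ay ay p = trans (curl-diagonal (form KS g) ay p) (sym (cong₂ _+_ (∑-ev-zero g) (bd-zero g)))
curl-KS g az az p = trans (curl-diagonal (form KS g) az p) (sym (cong₂ _+_ (∑-ev-zero g) (bd-zero g)))
curl-KS g ax ay p = curl-xy g p
curl-KS g ay ax p = trans (curl-swap (form KS g) ax ay p) (trans (cong -_ (curl-xy g p))
  (trans (ℤP.neg-distrib-+ (∑ g (ev (flux az p))) (bd g (side p))) (sym (cong₂ _+_ (∑-ev-neg g (flux az p)) (bd-neg g (side p))))))
curl-KS g ax az p = trans (curl-xz g p) (sym (trans (cong₂ _+_ (∑-ev-neg g (flux ay p)) (bd-zero g)) (ℤP.+-identityʳ _)))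
curl-KS g az ax p = trans (curl-swap (form KS g) ax az p) (trans (cong -_ (curl-xz g p)) (trans (ℤP.neg-involutive _)
  (sym (trans (+-congˡ (∑ g (ev (flux ay p))) (bd-zero g)) (ℤP.+-identityʳ _)))))
curl-KS g ay az p = trans (curl-yz g p) (sym (trans (+-congˡ (∑ g (ev (flux ax p))) (bd-zero g)) (ℤP.+-identityʳ _)))
curl-KS g az ay p = trans (curl-swap (form KS g) ay az p) (trans (cong -_ (curl-yz g p))
  (sym (trans (cong₂ _+_ (∑-ev-neg g (flux ax p)) (bd-zero g)) (ℤP.+-identityʳ _))))

up-comm : ∀ i j {c} → up i (up j c) ≡ up j (up i c)
up-comm ax ax = refl
up-comm ax ay = refl
up-comm ax az = refl
up-comm ay ax = refl
up-comm ay ay = refl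
up-comm ay az = refl
up-comm az ax = refl
up-comm az ay = refl
up-comm az az = refl

data Face (i j : Axis) (c : Cube) : Cube → Set where
  f₀₀ : Face i j c c
  f₁₀ : Face i j c (up i c)
  f₀₁ : Face i j c (up j c)
  f₁₁ : Face i j c (up j (up i c))

Face-swap : ∀ {i j c q} → Face i j c q → Face j i c q
Face-swap f₀₀ = f₀₀
Face-swap f₁₀ = f₀₁
Face-swap f₀₁ = f₁₀
Face-swap {i} {j} {c} f₁₁ = subst (Face j i c) (up-comm i j) f₁₁

private
  face-z : ∀ {p q} → OnFace az p q → Face ax ay p q
  face-z (inj₁ refl , inj₁ refl , refl) = f₀₀
  face-z (inj₁ refl , inj₂ refl , refl) = f₀₁
  face-z (inj₂ refl , inj₁ refl , refl) = f₁₀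
  face-z (inj₂ refl , inj₂ refl , refl) = f₁₁

  face-y : ∀ {p q} → OnFace ay p q → Face ax az p q
  face-y (inj₁ refl , refl , inj₁ refl) = f₀₀
  face-y (inj₁ refl , refl , inj₂ refl) = f₀₁
  face-y (inj₂ refl , refl , inj₁ refl) = f₁₀
  face-y (inj₂ refl , refl , inj₂ refl) = f₁₁

  face-x : ∀ {p q} → OnFace ax p q → Face ay az p q
  face-x (refl , inj₁ refl , inj₁ refl) = f₀₀
  face-x (refl , inj₁ refl , inj₂ refl) = f₀₁
  face-x (refl , inj₂ refl , inj₁ refl) = f₁₀
  face-x (refl , inj₂ refl , inj₂ refl) = f₁₁

  neg-zero : ∀ s {a} → s * a ≡ + 0 → s * - a ≡ + 0
  neg-zero s {a} e = trans (sym (ℤP.neg-distribʳ-* s a)) (cong -_ e)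

nflux-off : ∀ i j p d → (∀ c → Covers d c → ¬ Face i j p c) → ev (nflux i j p) d ≡ + 0
nflux-off ax ay p d off = flux-off az p d λ c k o → off c k (face-z o)
nflux-off ay ax p d off = neg-zero (sg (dir d)) (flux-off az p d λ c k o → off c k (Face-swap (face-z o)))
nflux-off ax az p d off = neg-zero (sg (dir d)) (flux-off ay p d λ c k o → off c k (face-y o))
nflux-off az ax p d off = flux-off ay p d λ c k o → off c k (Face-swap (face-y o))
nflux-off ay az p d off = flux-off ax p d λ c k o → off c k (face-x o)
nflux-off az ay p d off = neg-zero (sg (dir d)) (flux-off ax p d λ c k o → off c k (Face-swap (face-x o)))
nflux-off ax ax p d off = ℤP.*-zeroʳ (sg (dir d))
nflux-off ay ay p d off = ℤP.*-zeroʳ (sg (dir d))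
nflux-off az az p d off = ℤP.*-zeroʳ (sg (dir d))

εsum-neg : ∀ C h → εsum C (λ c → - h c) ≡ - εsum C h
εsum-neg C h = trans (∑-cong (cellsOf C) λ c _ → sym (ℤP.neg-distribʳ-* (ε c) (h c))) (∑-neg (cellsOf C) _)

εsum-side≡0 : ∀ C p → (∀ q → Face ax ay p q → InCyl C q) → εsum C (side p) ≡ + 0
εsum-side≡0 C p face = trans (εsum-neg C _) (cong -_ (εsum-column C (x p) (y p) (z p) (λ k → ss k (z p))
  (λ a b α β → face _ (face-z (α , β , refl)))))

εsum-nside : ∀ C i j p → (∀ q → Face i j p q → InCyl C q) → εsum C (nside i j p) ≡ + 0
εsum-nside C ax ay p face = εsum-side≡0 C p face
εsum-nside C ay ax p face = trans (εsum-neg C (side p)) (cong -_ (εsum-side≡0 C p λ q f → face q (Face-swap f)))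
εsum-nside C ax ax p face = ∑-zero (cellsOf C) λ c _ → ℤP.*-zeroʳ (ε c)
εsum-nside C ax az p face = ∑-zero (cellsOf C) λ c _ → ℤP.*-zeroʳ (ε c)
εsum-nside C ay ay p face = ∑-zero (cellsOf C) λ c _ → ℤP.*-zeroʳ (ε c)
εsum-nside C ay az p face = ∑-zero (cellsOf C) λ c _ → ℤP.*-zeroʳ (ε c)
εsum-nside C az ax p face = ∑-zero (cellsOf C) λ c _ → ℤP.*-zeroʳ (ε c)
εsum-nside C az ay p face = ∑-zero (cellsOf C) λ c _ → ℤP.*-zeroʳ (ε c)
εsum-nside C az az p face = ∑-zero (cellsOf C) λ c _ → ℤP.*-zeroʳ (ε c)

-- At the height of the square itself the sign of the relative height is 0.
nside-face : ∀ i j p {q} → Face i j p q → nside i j p q ≡ + 0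
nside-face ax ax p f = refl
nside-face ax az p f = refl
nside-face ay ay p f = refl
nside-face ay az p f = refl
nside-face az ax p f = refl
nside-face az ay p f = refl
nside-face az az p f = refl
nside-face ax ay p {q} f = trans (cong (λ w → - (mm (x q) (x p) * mm (y q) (y p) * w)) (lev f)) (l (mm (x q) (x p) * mm (y q) (y p)))
  where
  l : ∀ a → - (a * + 0) ≡ + 0
  l = solve-∀
  self : ss (z p) (z p) ≡ + 0
  self rewrite ℤP.+-inverseʳ (z p) = refl
  lev : ∀ {q} → Face ax ay p q → ss (z q) (z p) ≡ + 0
  lev f₀₀ = self
  lev f₁₀ = self
  lev f₀₁ = self
  lev f₁₁ = self
nside-face ay ax p f = cong -_ (nside-face ax ay p (Face-swap f))

-- The arrow of a domino starts at its white cube, so it points in the positive direction exactly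
-- when its lower cube is white.
sg-ε : ∀ d → ε (wc d) ≡ + 1 → sg (dir d) ≡ ε (base′ d)
sg-ε d w with arrow-ends d
... | inj₁ (s , e , _) = trans s (sym (trans (cong ε e) w))
... | inj₂ (s , e , _) = trans s (sym (trans (cong ε e) (trans (ε-bc d) (cong -_ w))))

private
  n+1≢n : ∀ {n} → n + + 1 ≢ n
  n+1≢n {n} e = ℤP.<-irrefl (sym e) (i<i+1 n)

  n+1+1≢n : ∀ {n} → n + + 1 + + 1 ≢ n
  n+1+1≢n {n} e = ℤP.<-irrefl (sym e) (ℤP.<-trans (i<i+1 n) (i<i+1 (n + + 1)))

  up-injective : ∀ i j {c} → up i c ≡ up j c → i ≡ j
  up-injective ax ax e = refl
  up-injective ay ay e = refl
  up-injective az az e = refl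
  up-injective ax ay e = ⊥-elim (n+1≢n (cong x e))
  up-injective ax az e = ⊥-elim (n+1≢n (cong x e))
  up-injective ay ax e = ⊥-elim (n+1≢n (cong y e))
  up-injective ay az e = ⊥-elim (n+1≢n (cong y e))
  up-injective az ax e = ⊥-elim (n+1≢n (cong z e))
  up-injective az ay e = ⊥-elim (n+1≢n (cong z e))

  up-up≢ : ∀ i j {c} → up i (up j c) ≢ c
  up-up≢ ax ax e = n+1+1≢n (cong x e)
  up-up≢ ay ay e = n+1+1≢n (cong y e)
  up-up≢ az az e = n+1+1≢n (cong z e)
  up-up≢ ax ay e = n+1≢n (cong x e)
  up-up≢ ax az e = n+1≢n (cong x e)
  up-up≢ ay ax e = n+1≢n (cong y e)
  up-up≢ ay az e = n+1≢n (cong y e)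
  up-up≢ az ax e = n+1≢n (cong z e)
  up-up≢ az ay e = n+1≢n (cong z e)

up≢ : ∀ i {c} → up i c ≢ c
up≢ ax e = n+1≢n (cong x e)
up≢ ay e = n+1≢n (cong y e)
up≢ az e = n+1≢n (cong z e)

HasCells-sym : ∀ d {a b} → HasCells d a b → HasCells d b a
HasCells-sym d (inj₁ h) = inj₂ h
HasCells-sym d (inj₂ h) = inj₁ h

HasCells-≡ : ∀ d {a b a′ b′} → a ≡ a′ → b ≡ b′ → HasCells d a b → HasCells d a′ b′
HasCells-≡ d refl refl h = h

HasCells-covers : ∀ d {a b} → HasCells d a b → Covers d a × Covers d b
HasCells-covers d (inj₁ (e , e′)) = inj₁ (sym e) , inj₂ (sym e′)
HasCells-covers d (inj₂ (e , e′)) = inj₂ (sym e′) , inj₁ (sym e)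

has-unit : ∀ d {i c} → HasCells d c (up i c) → axis′ d ≡ i × base′ d ≡ c
has-unit d {i} {c} h with arrow-ends d
... | inj₁ (_ , e , e′) = go h
  where
  go : HasCells d c (up i c) → axis′ d ≡ i × base′ d ≡ c
  go (inj₁ (w , b)) = up-injective (axis′ d) i (trans (cong (up (axis′ d)) (sym (trans e w))) (trans e′ b)) , trans e w
  go (inj₂ (w , b)) = ⊥-elim (up-up≢ (axis′ d) i (trans (cong (up (axis′ d)) (sym (trans e w))) (trans e′ b)))
... | inj₂ (_ , e , e′) = go h
  where
  go : HasCells d c (up i c) → axis′ d ≡ i × base′ d ≡ c
  go (inj₂ (w , b)) = up-injective (axis′ d) i (trans (cong (up (axis′ d)) (sym (trans e b))) (trans e′ w)) , trans e b
  go (inj₁ (w , b)) = ⊥-elim (up-up≢ (axis′ d) i (trans (cong (up (axis′ d)) (sym (trans e b))) (trans e′ w)))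

ev-unit : ∀ ℓ d {i c} → ε (wc d) ≡ + 1 → HasCells d c (up i c) → ev ℓ d ≡ ε c * ℓ i c
ev-unit ℓ d w h with has-unit d h
... | refl , refl = cong (_* ℓ (axis′ d) (base′ d)) (sg-ε d w)

KB-parallel : ∀ i a b → KB i a i b ≡ + 0
KB-parallel ax a b = refl
KB-parallel ay a b = refl
KB-parallel az a b = refl

ev²-parallel : ∀ {d e k} → axis′ d ≡ k → axis′ e ≡ k → ev² KB d e ≡ + 0
ev²-parallel {d} {e} {k} p q rewrite p | q | KB-parallel k (base′ d) (base′ e) = l (sg (dir d)) (sg (dir e))
  where
  l : ∀ a b → a * (b * + 0) ≡ + 0
  l = solve-∀

flip-invariant : ∀ C t₀ t₁ → IsTiling (InCyl C) t₀ → IsTiling (InCyl C) t₁ → Flip t₀ t₁ →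
  pair KB t₁ t₁ ≡ pair KB t₀ t₀
flip-invariant C t₀ t₁ T₀ T₁ (c , i , j , i≢j , d₁ , d₂ , e₁ , e₂ , D₁′ , D₂′ , E₁′ , E₂′ , rep@(A⊆ , t₁⇔)) = result
  where
  open ≡-Reasoning
  ⊕⊕ : ∀ k l → c ⊕ unit k ⊕ unit l ≡ up l (up k c)
  ⊕⊕ k l = trans (cong (_⊕ unit l) (⊕-unit k c)) (⊕-unit l (up k c))
  D₁ = HasCells-≡ d₁ refl (⊕-unit i c) D₁′
  D₂ = HasCells-≡ d₂ (⊕-unit j c) (⊕⊕ j i) D₂′
  E₁ = HasCells-≡ e₁ refl (⊕-unit j c) E₁′
  E₂ = HasCells-≡ e₂ (⊕-unit i c) (⊕⊕ i j) E₂′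
  A = d₁ ∷ d₂ ∷ []
  E = e₁ ∷ e₂ ∷ []
  e∈ : ∀ {e} → e ∈ E → e ∈ t₁
  e∈ m = Equivalence.from (t₁⇔ _) (inj₂ m)
  apart : ∀ {d e : Domino} {c i} → base′ d ≡ c → base′ e ≡ up i c → d ≢ e
  apart {i = i} p q refl = up≢ i (trans (sym q) p)
  uA : Unique A
  uA = (apart (proj₂ (has-unit d₁ D₁)) (proj₂ (has-unit d₂ D₂)) ∷ []) ∷ [] ∷ []
  uE : Unique E
  uE = (apart (proj₂ (has-unit e₁ E₁)) (proj₂ (has-unit e₂ E₂)) ∷ []) ∷ [] ∷ []
  meets : ∀ {e} → e ∈ E → Σ Domino λ a → a ∈ A × Σ Cube λ c → Covers e c × Covers a c
  meets (here refl) = d₁ , here refl , c , proj₁ (HasCells-covers e₁ E₁) , proj₁ (HasCells-covers d₁ D₁)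
  meets (there (here refl)) = d₁ , here refl , up i c , proj₁ (HasCells-covers e₂ E₂) , proj₂ (HasCells-covers d₁ D₁)

  split = replaces-split A E T₀ T₁ rep uA uE meets
  r = proj₁ split
  t₀↭ = proj₁ (proj₂ split)
  t₁↭ = proj₁ (proj₂ (proj₂ split))
  r⁻ = proj₂ (proj₂ (proj₂ split))
  ℓ = form KS r

  comm = up-comm j i {c}

  face-A : ∀ {q} → Face i j c q → Σ Domino λ a → a ∈ A × Covers a q
  face-A f₀₀ = d₁ , here refl , proj₁ (HasCells-covers d₁ D₁)
  face-A f₁₀ = d₁ , here refl , proj₂ (HasCells-covers d₁ D₁)
  face-A f₀₁ = d₂ , there (here refl) , proj₁ (HasCells-covers d₂ D₂)
  face-A f₁₁ = d₂ , there (here refl) , subst (Covers d₂) (sym comm) (proj₂ (HasCells-covers d₂ D₂))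

  A-face : ∀ {a q} → a ∈ A → Covers a q → Face i j c q
  A-face (here refl) k with has-unit d₁ D₁ | covers⁻ d₁ k
  ... | a , b | inj₁ refl = subst (Face i j c) (sym b) f₀₀
  ... | refl , b | inj₂ refl = subst (Face i j c) (cong (up i) (sym b)) f₁₀
  A-face (there (here refl)) k with has-unit d₂ D₂ | covers⁻ d₂ k
  ... | a , b | inj₁ refl = subst (Face i j c) (sym b) f₀₁
  ... | refl , b | inj₂ refl = subst (Face i j c) (trans comm (cong (up i) (sym b))) f₁₁

  face-C : ∀ q → Face i j c q → InCyl C q
  face-C q f with face-A f
  ... | a , a∈ , k = tiling-inside T₀ (All.lookup A⊆ a∈) k

  bd-A : bd A (nside i j c) ≡ + 0
  bd-A = ∑-zero A λ a m → cong₂ _-_ (nside-face i j c (A-face m (inj₂ refl))) (nside-face i j c (A-face m (inj₁ refl)))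

  -- The boundary of the rest is that of the tiling minus that of the flipped pair. The first part
  -- cancels by reflection, and the second vanishes because the function is 0 on the four cubes of
  -- the square.
  bd-r : bd r (nside i j c) ≡ + 0
  bd-r = begin
    bd r (nside i j c)                         ≡⟨ sym (trans (cong (_+ bd r (nside i j c)) bd-A) (ℤP.+-identityˡ _)) ⟩
    bd A (nside i j c) + bd r (nside i j c)    ≡⟨ sym (bd-++ A r (nside i j c)) ⟩
    bd (A ++ r) (nside i j c)                  ≡⟨ sym (bd-↭ (nside i j c) t₀↭) ⟩
    bd t₀ (nside i j c)                        ≡⟨ cylinder-fills C T₀ (nside i j c) ⟩
    - εsum C (nside i j c)                     ≡⟨ cong -_ (εsum-nside C i j c face-C) ⟩
    + 0 ∎

  curl0 : curl ℓ i j c ≡ + 0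
  curl0 = trans (curl-KS r i j c) (cong₂ _+_ (∑-zero r λ d m → nflux-off i j c d (off m)) bd-r)
    where
    off : ∀ {d} → d ∈ r → ∀ q → Covers d q → ¬ Face i j c q
    off m q k f with face-A f
    ... | a , a∈ , k′ = proj₂ (r⁻ m) (subst (_∈ A) (tiling-overlap T₀ (All.lookup A⊆ a∈) (proj₁ (r⁻ m)) k′ k) a∈)

  self : ∀ {d e k} → axis′ d ≡ k → axis′ e ≡ k → pair KB (d ∷ e ∷ []) (d ∷ e ∷ []) ≡ + 0
  self {d} {e} p q = ∑-zero (d ∷ e ∷ []) λ a m → ∑-zero (d ∷ e ∷ []) λ b n → ev²-parallel {a} {b} (ax′ m) (ax′ n)
    where
    ax′ : ∀ {a} → a ∈ d ∷ e ∷ [] → axis′ a ≡ _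
    ax′ (here refl) = p
    ax′ (there (here refl)) = q

  white₀ : ∀ {d} → d ∈ A → ε (wc d) ≡ + 1
  white₀ m = tiling-white T₀ (All.lookup A⊆ m)
  white₁ : ∀ {d} → d ∈ E → ε (wc d) ≡ + 1
  white₁ m = tiling-white T₁ (e∈ m)

  -- The two pairs are the two pairs of opposite sides of the square. Since neighbouring vertices
  -- differ in colour, their difference is a circulation.
  sums : ∑ E (ev ℓ) - ∑ A (ev ℓ) ≡ - (ε c * curl ℓ i j c)
  sums rewrite ev-unit ℓ d₁ (white₀ (here refl)) D₁ | ev-unit ℓ d₂ (white₀ (there (here refl))) D₂
    | ev-unit ℓ e₁ (white₁ (here refl)) E₁ | ev-unit ℓ e₂ (white₁ (there (here refl))) E₂
    | ε-up i c | ε-up j c = l (ε c) (ℓ j c) (ℓ j (up i c)) (ℓ i c) (ℓ i (up j c))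
    where
    l : ∀ s a b c d → s * a + (- s * b + + 0) - (s * c + (- s * d + + 0)) ≡ - (s * (c + b - d - a))
    l = solve-∀

  result : pair KB t₁ t₁ ≡ pair KB t₀ t₀
  result = ℤP.i-j≡0⇒i≡j _ _ (begin
    pair KB t₁ t₁ - pair KB t₀ t₀
      ≡⟨ move-difference A E r t₀↭ t₁↭ ⟩
    pair KB E E - pair KB A A + (∑ E (ev ℓ) - ∑ A (ev ℓ))
      ≡⟨ cong₂ _+_ (cong₂ _-_ (self (proj₁ (has-unit e₁ E₁)) (proj₁ (has-unit e₂ E₂))) (self (proj₁ (has-unit d₁ D₁)) (proj₁ (has-unit d₂ D₂)))) sums ⟩
    + 0 + - (ε c * curl ℓ i j c)
      ≡⟨ cong (λ w → + 0 + - (ε c * w)) curl0 ⟩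
    + 0 + - (ε c * + 0)
      ≡⟨ cong (λ w → + 0 + - w) (ℤP.*-zeroʳ (ε c)) ⟩
    + 0 ∎)

-- Trits

∀Dir? : {P : Dir → Set} → (∀ δ → Dec (P δ)) → Dec (∀ δ → P δ)
∀Dir? P? = map′ (λ { (a , b , c , d , e , f) → λ { +x → a ; -x → b ; +y → c ; -y → d ; +z → e ; -z → f } })
  (λ h → h +x , h -x , h +y , h -y , h +z , h -z)
  (P? +x ×-dec P? -x ×-dec P? +y ×-dec P? -y ×-dec P? +z ×-dec P? -z)

data Three : Set where
  k₀ k₁ k₂ : Three

next : Three → Three
next k₀ = k₁
next k₁ = k₂
next k₂ = k₀

_≟₃_ : (j k : Three) → Dec (j ≡ k)
k₀ ≟₃ k₀ = yes refl
k₀ ≟₃ k₁ = no λ ()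
k₀ ≟₃ k₂ = no λ ()
k₁ ≟₃ k₀ = no λ ()
k₁ ≟₃ k₁ = yes refl
k₁ ≟₃ k₂ = no λ ()
k₂ ≟₃ k₀ = no λ ()
k₂ ≟₃ k₁ = no λ ()
k₂ ≟₃ k₂ = yes refl

∀Three? : {P : Three → Set} → (∀ k → Dec (P k)) → Dec (∀ k → P k)
∀Three? P? = map′ (λ { (a , b , c) → λ { k₀ → a ; k₁ → b ; k₂ → c } }) (λ h → h k₀ , h k₁ , h k₂)
  (P? k₀ ×-dec P? k₁ ×-dec P? k₂)

∀Axis? : {P : Axis → Set} → (∀ k → Dec (P k)) → Dec (∀ k → P k)
∀Axis? P? = map′ (λ { (a , b , c) → λ { ax → a ; ay → b ; az → c } }) (λ h → h ax , h ay , h az)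
  (P? ax ×-dec P? ay ×-dec P? az)

threes : List Three
threes = k₀ ∷ k₁ ∷ k₂ ∷ []

∈-threes : ∀ k → k ∈ threes
∈-threes k₀ = here refl
∈-threes k₁ = there (here refl)
∈-threes k₂ = there (there (here refl))

∑₃-cong : ∀ (f g : Three → ℤ) → (∀ k → f k ≡ g k) → ∑ threes f ≡ ∑ threes g
∑₃-cong f g e = ∑-cong threes λ k _ → e k

exhaust : ∀ a b c → a ≢ b → a ≢ c → b ≢ c → ∀ k → k ∈ a ∷ b ∷ c ∷ []
exhaust = from-yes (∀Three? λ a → ∀Three? λ b → ∀Three? λ c → ¬? (a ≟₃ b) →-dec (¬? (a ≟₃ c) →-dec (¬? (b ≟₃ c) →-dec
  ∀Three? λ k → DecMembership._∈?_ _≟₃_ k (a ∷ b ∷ c ∷ []))))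

threes-↭ : ∀ {a b c} → a ≢ b → a ≢ c → b ≢ c → a ∷ b ∷ c ∷ [] ↭ threes
threes-↭ {a} {b} {c} p q r = unique-↭ ((p ∷ q ∷ []) ∷ (r ∷ []) ∷ [] ∷ [])
  (((λ ()) ∷ (λ ()) ∷ []) ∷ ((λ ()) ∷ []) ∷ [] ∷ []) (λ {k} _ → ∈-threes k) (λ {k} _ → exhaust a b c p q r k)

origin : Cube
origin = v3 (+ 0) (+ 0) (+ 0)

lower : Dir → Cube → Cube
lower δ c = base′ (dom c δ)

-- The square at `h` spanned by `α` and `β`, oriented by the loop that leaves `h` along `α` and
-- returns along `β`. Since `nflux` refers to the lowest vertex and the positive directions,
-- negative directions move the vertex and change the sign.
loopFlux : Cube → Dir → Dir → Form
loopFlux h α β i c = sg α * sg β * nflux (axisOf α) (axisOf β) (lower β (lower α h)) i c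

loopSide : Cube → Dir → Dir → Cube → ℤ
loopSide h α β c = sg α * sg β * nside (axisOf α) (axisOf β) (lower β (lower α h)) c

-- A frame (α, β, γ) of determinant 1 at h is a hexagon of cubes around the diagonal from h to
-- h + α + β + γ; the dominoes μ → μ + ν with (μ, ν) = (α, β), (β, γ), (γ, α) are those with χ = 1.
data Kind : Set where
  plus minus : Kind

module Frame (fr : Three → Dir) where

  -- Indexed so that in both kinds the domino number `k` is parallel to `fr (next k)`; equal indices
  -- are opposite edges of the hexagon.
  edge : Kind → Three → Dir × Dir
  edge plus k = fr k , fr (next k)
  edge minus k = fr (next (next k)) , fr (next k)

  edges : Kind → List Domino
  edges κ = map (λ k → dom (vec (proj₁ (edge κ k))) (proj₂ (edge κ k))) threes

  sumForm : (Dir → Dir → Form) → Form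
  sumForm F i c = ∑ threes (λ k → F (fr k) (fr (next k)) i c)

  sumSide : (Dir → Dir → Cube → ℤ) → Cube → ℤ
  sumSide F c = ∑ threes (λ k → F (fr k) (fr (next k)) c)

  cell₁ cell₂ : Kind → Three → V3
  cell₁ κ k = vec (proj₁ (edge κ k))
  cell₂ κ k = vec (proj₁ (edge κ k)) ⊕ vec (proj₂ (edge κ k))

frame : Dir → Dir → Dir → Three → Dir
frame α β γ k₀ = α
frame α β γ k₁ = β
frame α β γ k₂ = γ

module _ (α β γ : Dir) where
  open Frame (frame α β γ)

  IsEdge : V3 → V3 → Kind → Three → Set
  IsEdge a b κ k = (a ≡ cell₁ κ k × b ≡ cell₂ κ k) ⊎ (a ≡ cell₂ κ k × b ≡ cell₁ κ k)

  hexagon : List V3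
  hexagon = map (cell₁ plus) threes ++ map (cell₂ plus) threes

  private
    isEdge? : ∀ a b κ k → Dec (IsEdge a b κ k)
    isEdge? a b κ k = (a ≟V cell₁ κ k ×-dec b ≟V cell₂ κ k) ⊎-dec (a ≟V cell₂ κ k ×-dec b ≟V cell₁ κ k)

  -- The finite part of the trit computation, with the corner at the origin; it is decided by
  -- evaluation for all 24 frames. In `flux-out`, an arrow leaving the corner away from the hexagon
  -- crosses one of the three squares, against its normal. `side-minus` is the contribution of the
  -- removed dominoes to the error terms, and `pair-plus` and `pair-minus` are their mutual
  -- crossings after and before the trit.
  record FrameFacts : Set where
    field
      rotation : ∀ δ₁ δ₂ δ₃ → det (vec δ₁) (vec δ₂) (vec δ₃) ≡ + 1 →
        vec δ₁ ⊕ vec δ₂ ⊕ vec δ₃ ≡ vec α ⊕ vec β ⊕ vec γ → Any (λ k → (δ₁ , δ₂) ≡ edge plus k) threes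
      hexagon-edges : All (λ u → ∀ δ → u ⊕ vec δ ∈ hexagon →
        Any (λ k → IsEdge u (u ⊕ vec δ) plus k ⊎ IsEdge u (u ⊕ vec δ) minus k) threes) hexagon
      flux-out : ∀ δ → All (λ k → δ ≢ frame α β γ k) threes → ev (sumForm (loopFlux origin)) (dom origin δ) ≡ - + 1
      side-minus : bd (edges minus) (sumSide (loopSide origin)) ≡ - + 1
      pair-plus : pair KB (edges plus) (edges plus) ≡ + 1
      pair-minus : pair KB (edges minus) (edges minus) ≡ - + 1
      axes : ∀ i → Any (λ k → axisOf (frame α β γ k) ≡ i × axisOf (frame α β γ (next k)) ≢ i) threes

  private
    Raw : Set
    Raw = (∀ δ₁ δ₂ δ₃ → det (vec δ₁) (vec δ₂) (vec δ₃) ≡ + 1 →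
        vec δ₁ ⊕ vec δ₂ ⊕ vec δ₃ ≡ vec α ⊕ vec β ⊕ vec γ → Any (λ k → (δ₁ , δ₂) ≡ edge plus k) threes)
      × All (λ u → ∀ δ → u ⊕ vec δ ∈ hexagon →
        Any (λ k → IsEdge u (u ⊕ vec δ) plus k ⊎ IsEdge u (u ⊕ vec δ) minus k) threes) hexagon
      × (∀ δ → All (λ k → δ ≢ frame α β γ k) threes → ev (sumForm (loopFlux origin)) (dom origin δ) ≡ - + 1)
      × (bd (edges minus) (sumSide (loopSide origin)) ≡ - + 1)
      × (pair KB (edges plus) (edges plus) ≡ + 1)
      × (pair KB (edges minus) (edges minus) ≡ - + 1)
      × (∀ i → Any (λ k → axisOf (frame α β γ k) ≡ i × axisOf (frame α β γ (next k)) ≢ i) threes)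

    raw? : Dec Raw
    raw? = (∀Dir? λ δ₁ → ∀Dir? λ δ₂ → ∀Dir? λ δ₃ → (det (vec δ₁) (vec δ₂) (vec δ₃) ℤP.≟ + 1) →-dec
        (((vec δ₁ ⊕ vec δ₂ ⊕ vec δ₃) ≟V (vec α ⊕ vec β ⊕ vec γ)) →-dec Any.any? (λ k → ≡-dec _≟Dir_ _≟Dir_ (δ₁ , δ₂) (edge plus k)) threes))
      ×-dec All.all? (λ u → ∀Dir? λ δ → DecMembership._∈?_ _≟V_ _ _ →-dec Any.any? (λ k → isEdge? _ _ plus k ⊎-dec isEdge? _ _ minus k) threes) hexagon
      ×-dec (∀Dir? λ δ → All.all? (λ k → ¬? (_ ≟Dir _)) threes →-dec (_ ℤP.≟ _))
      ×-dec (_ ℤP.≟ _)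
      ×-dec (_ ℤP.≟ _)
      ×-dec (_ ℤP.≟ _)
      ×-dec (∀Axis? λ i → Any.any? (λ k → axis-≟ _ _ ×-dec ¬? (axis-≟ _ _)) threes)

  frameFacts? : Dec FrameFacts
  frameFacts? = map′
    (λ { (a , b , c , d , e , f , g) → record { rotation = a ; hexagon-edges = b ; flux-out = c ; side-minus = d ; pair-plus = e ; pair-minus = f ; axes = g } })
    (λ F → let open FrameFacts F in rotation , hexagon-edges , flux-out , side-minus , pair-plus , pair-minus , axes)
    raw?

abstract
  frameFacts : ∀ α β γ → det (vec α) (vec β) (vec γ) ≡ + 1 → FrameFacts α β γ
  frameFacts = from-yes (∀Dir? λ α → ∀Dir? λ β → ∀Dir? λ γ → (det (vec α) (vec β) (vec γ) ℤP.≟ + 1) →-dec frameFacts? α β γ)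

private
  mm-shift : ∀ a b w → mm (a + w) (b + w) ≡ mm a b
  mm-shift a b w = cong mI (l a b w)
    where
    l : ∀ a b w → a + w - (b + w) ≡ a - b
    l = solve-∀
  ss-shift : ∀ a b w → ss (a + w) (b + w) ≡ ss a b
  ss-shift a b w = cong sI (l a b w)
    where
    l : ∀ a b w → a + w - (b + w) ≡ a - b
    l = solve-∀
  θ-shift : ∀ a b w → θ (a + w) (b + w) ≡ θ a b
  θ-shift a b w = cong tI (l a b w)
    where
    l : ∀ a b w → a + w - (b + w) ≡ a - b
    l = solve-∀

⊕-swap : ∀ a b c → a ⊕ b ⊕ c ≡ a ⊕ c ⊕ b
⊕-swap a b c = V3-≡ (l (x a) (x b) (x c)) (l (y a) (y b) (y c)) (l (z a) (z b) (z c))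
  where
  l : ∀ a b c → a + b + c ≡ a + c + b
  l = solve-∀

⊕-assoc : ∀ a b c → a ⊕ b ⊕ c ≡ a ⊕ (b ⊕ c)
⊕-assoc a b c = V3-≡ (ℤP.+-assoc (x a) (x b) (x c)) (ℤP.+-assoc (y a) (y b) (y c)) (ℤP.+-assoc (z a) (z b) (z c))

⊕-comm : ∀ a b → a ⊕ b ≡ b ⊕ a
⊕-comm a b = V3-≡ (ℤP.+-comm (x a) (x b)) (ℤP.+-comm (y a) (y b)) (ℤP.+-comm (z a) (z b))

⊕-⊖ : ∀ a b → (a ⊕ b) ⊖ a ≡ b
⊕-⊖ a b = V3-≡ (l (x a) (x b)) (l (y a) (y b)) (l (z a) (z b))
  where
  l : ∀ a b → a + b - a ≡ b
  l = solve-∀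

⊕-cancel : ∀ a {b c} → a ⊕ b ≡ a ⊕ c → b ≡ c
⊕-cancel a {b} {c} e = trans (sym (⊕-⊖ a b)) (trans (cong (_⊖ a) e) (⊕-⊖ a c))

det-cong : ∀ {a b c a′ b′ c′} → a ≡ a′ → b ≡ b′ → c ≡ c′ → det a b c ≡ det a′ b′ c′
det-cong refl refl refl = refl

origin-⊕ : ∀ c → origin ⊕ c ≡ c
origin-⊕ c = V3-≡ (ℤP.+-identityˡ (x c)) (ℤP.+-identityˡ (y c)) (ℤP.+-identityˡ (z c))

shiftD : V3 → Domino → Domino
shiftD w d = dom (wc d ⊕ w) (dir d)

module _ (w : V3) where

  up-shift : ∀ i c → up i (c ⊕ w) ≡ up i c ⊕ w
  up-shift ax c = V3-≡ (l (x c) (x w)) refl refl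
    where
    l : ∀ a b → a + b + + 1 ≡ a + + 1 + b
    l = solve-∀
  up-shift ay c = V3-≡ refl (l (y c) (y w)) refl
    where
    l : ∀ a b → a + b + + 1 ≡ a + + 1 + b
    l = solve-∀
  up-shift az c = V3-≡ refl refl (l (z c) (z w))
    where
    l : ∀ a b → a + b + + 1 ≡ a + + 1 + b
    l = solve-∀

  bc-shift : ∀ d → bc (shiftD w d) ≡ bc d ⊕ w
  bc-shift d = ⊕-swap (wc d) w (vec (dir d))

  lower-shift : ∀ δ c → lower δ (c ⊕ w) ≡ lower δ c ⊕ w
  lower-shift δ c = go δ
    where
    s = ⊕-swap c w
    go : ∀ δ → lower δ (c ⊕ w) ≡ lower δ c ⊕ w
    go +x = refl
    go -x = s (vec -x)
    go +y = refl
    go -y = s (vec -y)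
    go +z = refl
    go -z = s (vec -z)

  KB-shift : ∀ i a j b → KB i (a ⊕ w) j (b ⊕ w) ≡ KB i a j b
  KB-shift ax a ay b rewrite mm-shift (x b) (x a) (x w) | mm-shift (y a) (y b) (y w) | θ-shift (z a) (z b) (z w) = refl
  KB-shift ay a ax b rewrite mm-shift (x a) (x b) (x w) | mm-shift (y b) (y a) (y w) | θ-shift (z a) (z b) (z w) = refl
  KB-shift ax a ax b = refl
  KB-shift ax a az b = refl
  KB-shift ay a ay b = refl
  KB-shift ay a az b = refl
  KB-shift az a ax b = refl
  KB-shift az a ay b = refl
  KB-shift az a az b = refl

  flux-shift : ∀ n p i b → flux n (p ⊕ w) i (b ⊕ w) ≡ flux n p i b
  flux-shift ax p ax b rewrite mm-shift (x p) (x b) (x w) | mm-shift (y b) (y p) (y w) | mm-shift (z b) (z p) (z w) = refl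
  flux-shift ay p ay b rewrite mm-shift (x b) (x p) (x w) | mm-shift (y p) (y b) (y w) | mm-shift (z b) (z p) (z w) = refl
  flux-shift az p az b rewrite mm-shift (x b) (x p) (x w) | mm-shift (y b) (y p) (y w) | mm-shift (z p) (z b) (z w) = refl
  flux-shift ax p ay b = refl
  flux-shift ax p az b = refl
  flux-shift ay p ax b = refl
  flux-shift ay p az b = refl
  flux-shift az p ax b = refl
  flux-shift az p ay b = refl

  nflux-shift : ∀ i j p k b → nflux i j (p ⊕ w) k (b ⊕ w) ≡ nflux i j p k b
  nflux-shift ax ay p k b = flux-shift az p k b
  nflux-shift ay ax p k b = cong -_ (flux-shift az p k b)
  nflux-shift ax az p k b = cong -_ (flux-shift ay p k b)
  nflux-shift az ax p k b = flux-shift ay p k b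
  nflux-shift ay az p k b = flux-shift ax p k b
  nflux-shift az ay p k b = cong -_ (flux-shift ax p k b)
  nflux-shift ax ax p k b = refl
  nflux-shift ay ay p k b = refl
  nflux-shift az az p k b = refl

  side-shift : ∀ p q → side (p ⊕ w) (q ⊕ w) ≡ side p q
  side-shift p q rewrite mm-shift (x q) (x p) (x w) | mm-shift (y q) (y p) (y w) | ss-shift (z q) (z p) (z w) = refl

  nside-shift : ∀ i j p q → nside i j (p ⊕ w) (q ⊕ w) ≡ nside i j p q
  nside-shift ax ay p q = side-shift p q
  nside-shift ay ax p q = cong -_ (side-shift p q)
  nside-shift ax ax p q = refl
  nside-shift ax az p q = refl
  nside-shift ay ay p q = refl
  nside-shift ay az p q = refl
  nside-shift az ax p q = refl
  nside-shift az ay p q = refl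
  nside-shift az az p q = refl

  loopFlux-shift : ∀ h α β i c → loopFlux (h ⊕ w) α β i (c ⊕ w) ≡ loopFlux h α β i c
  loopFlux-shift h α β i c rewrite lower-shift α h | lower-shift β (lower α h) =
    cong (sg α * sg β *_) (nflux-shift (axisOf α) (axisOf β) (lower β (lower α h)) i c)

  loopSide-shift : ∀ h α β c → loopSide (h ⊕ w) α β (c ⊕ w) ≡ loopSide h α β c
  loopSide-shift h α β c rewrite lower-shift α h | lower-shift β (lower α h) =
    cong (sg α * sg β *_) (nside-shift (axisOf α) (axisOf β) (lower β (lower α h)) c)

  pair-shift : ∀ f g → pair KB (map (shiftD w) f) (map (shiftD w) g) ≡ pair KB f g
  pair-shift f g = trans (∑-map (shiftD w) f _) (∑-cong f λ a _ → trans (∑-map (shiftD w) g _) (∑-cong g λ b _ →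
    cong (λ k → sg (dir a) * (sg (dir b) * k))
      (trans (cong₂ (λ p q → KB (axis′ a) p (axis′ b) q) (lower-shift (dir a) (wc a)) (lower-shift (dir b) (wc b)))
             (KB-shift (axis′ a) (base′ a) (axis′ b) (base′ b)))))

-- Here `dom a δ` is an arbitrary arrow, whose first cube may be black. The colour of `a` decides
-- whether the domino runs along this arrow or against it.
ev-dir : ∀ ℓ d {a δ} → ε (wc d) ≡ + 1 → HasCells d a (a ⊕ vec δ) → ev ℓ d ≡ ε a * ev ℓ (dom a δ)
ev-dir ℓ d {a} {δ} w h with arrow-ends (dom a δ)
... | inj₁ (s , e , e′) rewrite s | e =
  trans (ev-unit ℓ d w (HasCells-≡ d refl (sym e′) h)) (cong (ε a *_) (sym (ℤP.*-identityˡ _)))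
... | inj₂ (s , e , e′) rewrite s =
  trans (ev-unit ℓ d w (HasCells-≡ d (sym e) (sym e′) (HasCells-sym d h)))
    (trans (cong (_* L) (trans (cong ε e) (ε-bc (dom a δ)))) (l (ε a) L))
  where
  L = ℓ (axisOf δ) (lower δ a)
  l : ∀ a b → - a * b ≡ a * (- + 1 * b)
  l = solve-∀

has-axis : ∀ d {a δ} → HasCells d a (a ⊕ vec δ) → axis′ d ≡ axisOf δ
has-axis d {a} {δ} h with arrow-ends (dom a δ)
... | inj₁ (_ , e , e′) = proj₁ (has-unit d (HasCells-≡ d (sym e) (sym (trans (cong (up (axisOf δ)) e) (trans (cong (up (axisOf δ)) (sym e)) e′))) h))
... | inj₂ (_ , e , e′) = proj₁ (has-unit d (HasCells-≡ d (sym e) (sym e′) (HasCells-sym d h)))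

loop-curl : ∀ ℓ h α β →
  ev ℓ (dom h α) + ev ℓ (dom (h ⊕ vec α) β) - ev ℓ (dom (h ⊕ vec β) α) - ev ℓ (dom h β)
  ≡ sg α * sg β * curl ℓ (axisOf α) (axisOf β) (lower β (lower α h))
loop-curl ℓ h α β = begin
  s * ℓ i p + ev ℓ (dom (h ⊕ vec α) β) - s * ℓ i (lower α (h ⊕ vec β)) - ev ℓ (dom h β)
    ≡⟨ cong (λ c → s * ℓ i p + ev ℓ (dom (h ⊕ vec α) β) - s * ℓ i c - ev ℓ (dom h β)) (lower-shift (vec β) α h) ⟩
  s * ℓ i p + ev ℓ (dom (h ⊕ vec α) β) - s * ℓ i (p ⊕ vec β) - ev ℓ (dom h β)
    ≡⟨ r₁ s (ℓ i p) (ev ℓ (dom (h ⊕ vec α) β)) (ℓ i (p ⊕ vec β)) (ev ℓ (dom h β)) ⟩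
  s * (ℓ i p - ℓ i (p ⊕ vec β)) + (ev ℓ (dom (h ⊕ vec α) β) - ev ℓ (dom h β))
    ≡⟨ cong₂ (λ a b → s * a + b) second (first (λ c → ev ℓ (dom c β)) h α) ⟩
  s * (t * (ℓ i q - ℓ i (up j q))) + s * (ev ℓ (dom (up i p) β) - ev ℓ (dom p β))
    ≡⟨ cong (λ w → s * (t * (ℓ i q - ℓ i (up j q))) + s * (t * ℓ j w - t * ℓ j q)) (lower-up β p) ⟩
  s * (t * (ℓ i q - ℓ i (up j q))) + s * (t * ℓ j (up i q) - t * ℓ j q)
    ≡⟨ r₂ s t (ℓ i q) (ℓ i (up j q)) (ℓ j (up i q)) (ℓ j q) ⟩
  s * t * curl ℓ i j q ∎
  where
  open ≡-Reasoning
  s = sg α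
  t = sg β
  i = axisOf α
  j = axisOf β
  p = lower α h
  q = lower β p
  r₁ : ∀ s a b c d → s * a + b - s * c - d ≡ s * (a - c) + (b - d)
  r₁ = solve-∀
  r₂ : ∀ s t a b c d → s * (t * (a - b)) + s * (t * c - t * d) ≡ s * t * (a + c - b - d)
  r₂ = solve-∀
  first : ∀ (φ : Cube → ℤ) c δ → φ (c ⊕ vec δ) - φ c ≡ sg δ * (φ (up (axisOf δ) (lower δ c)) - φ (lower δ c))
  first φ c δ with arrow-ends (dom c δ)
  ... | inj₁ (e , e₁ , e₂) rewrite e | e₂ | e₁ = sym (ℤP.*-identityˡ _)
  ... | inj₂ (e , e₁ , e₂) rewrite e | e₂ | e₁ = r (φ (c ⊕ vec δ)) (φ c)
    where
    r : ∀ a b → a - b ≡ - + 1 * (b - a)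
    r = solve-∀
  second : ℓ i p - ℓ i (p ⊕ vec β) ≡ t * (ℓ i q - ℓ i (up j q))
  second = trans (r (ℓ i p) (ℓ i (p ⊕ vec β))) (trans (cong -_ (first (ℓ i) p β)) (r′ t (ℓ i (up j q)) (ℓ i q)))
    where
    r : ∀ a b → a - b ≡ - (b - a)
    r = solve-∀
    r′ : ∀ t a b → - (t * (a - b)) ≡ t * (b - a)
    r′ = solve-∀
  lower-up : ∀ δ c → lower δ (up i c) ≡ up i (lower δ c)
  lower-up +x c = refl
  lower-up -x c = sym (up-shift (vec -x) i c)
  lower-up +y c = refl
  lower-up -y c = sym (up-shift (vec -y) i c)
  lower-up +z c = refl
  lower-up -z c = sym (up-shift (vec -z) i c)

data Corner (h : Cube) (α β : Dir) : Cube → Set where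
  c₀₀ : Corner h α β h
  c₁₀ : Corner h α β (h ⊕ vec α)
  c₀₁ : Corner h α β (h ⊕ vec β)
  c₁₁ : Corner h α β (h ⊕ vec α ⊕ vec β)

private
  lower-pair : ∀ δ c → (lower δ c ≡ c × up (axisOf δ) (lower δ c) ≡ c ⊕ vec δ) ⊎ (lower δ c ≡ c ⊕ vec δ × up (axisOf δ) (lower δ c) ≡ c)
  lower-pair δ c with arrow-ends (dom c δ)
  ... | inj₁ (_ , e , e′) = inj₁ (e , e′)
  ... | inj₂ (_ , e , e′) = inj₂ (e , e′)

face-corner : ∀ h α β {c} → Face (axisOf α) (axisOf β) (lower β (lower α h)) c → Corner h α β c
face-corner h α β f = go f
  where
  i = axisOf α
  j = axisOf β
  p = lower α h
  q = lower β p
  C = Corner h α β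
  Cp : C p × C (up i p)
  Cp with lower-pair α h
  ... | inj₁ (e , e′) = subst C (sym e) c₀₀ , subst C (sym e′) c₁₀
  ... | inj₂ (e , e′) = subst C (sym e) c₁₀ , subst C (sym e′) c₀₀
  Cpβ : C (p ⊕ vec β) × C (up i p ⊕ vec β)
  Cpβ with lower-pair α h
  ... | inj₁ (e , e′) = subst (λ w → C (w ⊕ vec β)) (sym e) c₀₁ , subst (λ w → C (w ⊕ vec β)) (sym e′) c₁₁
  ... | inj₂ (e , e′) = subst (λ w → C (w ⊕ vec β)) (sym e) c₁₁ , subst (λ w → C (w ⊕ vec β)) (sym e′) c₀₁
  go : ∀ {c} → Face i j q c → C c
  go {c} f with lower-pair β p
  ... | inj₁ (e , e′) = at f
    where
    at : ∀ {c} → Face i j q c → C c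
    at f₀₀ = subst C (sym e) (proj₁ Cp)
    at f₁₀ = subst C (cong (up i) (sym e)) (proj₂ Cp)
    at f₀₁ = subst C (sym e′) (proj₁ Cpβ)
    at f₁₁ = subst C (trans (sym (up-shift (vec β) i p)) (trans (cong (up i) (sym e′)) (up-comm i j))) (proj₂ Cpβ)
  ... | inj₂ (e , e′) = at f
    where
    at : ∀ {c} → Face i j q c → C c
    at f₀₀ = subst C (sym e) (proj₁ Cpβ)
    at f₁₀ = subst C (trans (sym (up-shift (vec β) i p)) (cong (up i) (sym e))) (proj₂ Cpβ)
    at f₀₁ = subst C (sym e′) (proj₁ Cp)
    at f₁₁ = subst C (trans (cong (up i) (sym e′)) (up-comm i j)) (proj₂ Cp)

vec-injective : ∀ δ δ′ → vec δ ≡ vec δ′ → δ ≡ δ′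
vec-injective = from-yes (∀Dir? λ δ → ∀Dir? λ δ′ → (vec δ ≟V vec δ′) →-dec (δ ≟Dir δ′))

opp : Dir → Dir
opp +x = -x
opp -x = +x
opp +y = -y
opp -y = +y
opp +z = -z
opp -z = +z

⊕-opp : ∀ c δ → c ⊕ vec δ ⊕ vec (opp δ) ≡ c
⊕-opp c δ = trans (⊕-assoc c (vec δ) (vec (opp δ))) (trans (cong (c ⊕_) (cancel δ)) (trans (⊕-comm c origin) (origin-⊕ c)))
  where
  cancel : ∀ δ → vec δ ⊕ vec (opp δ) ≡ origin
  cancel = from-yes (∀Dir? λ δ → (vec δ ⊕ vec (opp δ)) ≟V origin)

same-cells : ∀ {d e a b} → ε (wc d) ≡ + 1 → ε (wc e) ≡ + 1 → HasCells d a b → HasCells e a b → d ≡ e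
same-cells {dom w δ} {dom .w δ′} _ _ (inj₁ (refl , p)) (inj₁ (refl , q)) = cong (dom w) (vec-injective δ δ′ (⊕-cancel w (trans p (sym q))))
same-cells {dom w δ} {dom .w δ′} _ _ (inj₂ (refl , p)) (inj₂ (refl , q)) = cong (dom w) (vec-injective δ δ′ (⊕-cancel w (trans p (sym q))))
same-cells {d} {e} u u′ (inj₁ (_ , p)) (inj₂ (q , _)) with () ← trans (sym u′) (trans (cong ε (trans q (sym p))) (trans (ε-bc d) (cong -_ u)))
same-cells {d} {e} u u′ (inj₂ (q , _)) (inj₁ (_ , p)) with () ← trans (sym u) (trans (cong ε (trans q (sym p))) (trans (ε-bc e) (cong -_ u′)))

chi-path : ∀ {h h′ e} → ChiPlus h h′ e → Σ Dir λ δ₁ → Σ Dir λ δ₂ → Σ Dir λ δ₃ →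
  det (vec δ₁) (vec δ₂) (vec δ₃) ≡ + 1 × HasCells e (h ⊕ vec δ₁) (h ⊕ vec δ₁ ⊕ vec δ₂) × h′ ≡ h ⊕ vec δ₁ ⊕ vec δ₂ ⊕ vec δ₃
chi-path {h} {h′} {e} (a , b , hc , (δ₁ , refl) , (δ₃ , refl) , χ) with second hc
  where
  second : ∀ {a b} → HasCells e a b → Σ Dir λ δ → b ≡ a ⊕ vec δ
  second (inj₁ (refl , refl)) = dir e , refl
  second (inj₂ (refl , refl)) = opp (dir e) , sym (⊕-opp (wc e) (dir e))
... | δ₂ , refl = δ₁ , δ₂ , δ₃ , trans (sym χ′) χ , hc , refl
  where
  χ′ : det ((h ⊕ vec δ₁) ⊖ h) ((h ⊕ vec δ₁ ⊕ vec δ₂) ⊖ (h ⊕ vec δ₁)) ((h ⊕ vec δ₁ ⊕ vec δ₂ ⊕ vec δ₃) ⊖ (h ⊕ vec δ₁ ⊕ vec δ₂))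
     ≡ det (vec δ₁) (vec δ₂) (vec δ₃)
  χ′ = det-cong (⊕-⊖ h (vec δ₁)) (⊕-⊖ (h ⊕ vec δ₁) (vec δ₂)) (⊕-⊖ (h ⊕ vec δ₁ ⊕ vec δ₂) (vec δ₃))

proj-⊕ : ∀ i c δ → axisOf δ ≡ i → proj i (c ⊕ vec δ) ≡ proj i c
proj-⊕ i c +x refl = cong₂ _,_ (ℤP.+-identityʳ (y c)) (ℤP.+-identityʳ (z c))
proj-⊕ i c -x refl = cong₂ _,_ (ℤP.+-identityʳ (y c)) (ℤP.+-identityʳ (z c))
proj-⊕ i c +y refl = cong₂ _,_ (ℤP.+-identityʳ (x c)) (ℤP.+-identityʳ (z c))
proj-⊕ i c -y refl = cong₂ _,_ (ℤP.+-identityʳ (x c)) (ℤP.+-identityʳ (z c))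
proj-⊕ i c +z refl = cong₂ _,_ (ℤP.+-identityʳ (x c)) (ℤP.+-identityʳ (y c))
proj-⊕ i c -z refl = cong₂ _,_ (ℤP.+-identityʳ (x c)) (ℤP.+-identityʳ (y c))

along-⊕ : ∀ i c δ → axisOf δ ≢ i → along i (c ⊕ vec δ) ≡ along i c
along-⊕ ax c +x n = ⊥-elim (n refl)
along-⊕ ax c -x n = ⊥-elim (n refl)
along-⊕ ax c +y n = ℤP.+-identityʳ (x c)
along-⊕ ax c -y n = ℤP.+-identityʳ (x c)
along-⊕ ax c +z n = ℤP.+-identityʳ (x c)
along-⊕ ax c -z n = ℤP.+-identityʳ (x c)
along-⊕ ay c +x n = ℤP.+-identityʳ (y c)
along-⊕ ay c -x n = ℤP.+-identityʳ (y c)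
along-⊕ ay c +y n = ⊥-elim (n refl)
along-⊕ ay c -y n = ⊥-elim (n refl)
along-⊕ ay c +z n = ℤP.+-identityʳ (y c)
along-⊕ ay c -z n = ℤP.+-identityʳ (y c)
along-⊕ az c +x n = ℤP.+-identityʳ (z c)
along-⊕ az c -x n = ℤP.+-identityʳ (z c)
along-⊕ az c +y n = ℤP.+-identityʳ (z c)
along-⊕ az c -y n = ℤP.+-identityʳ (z c)
along-⊕ az c +z n = ⊥-elim (n refl)
along-⊕ az c -z n = ⊥-elim (n refl)

∑-single : ∀ {A : Set} {L : List A} → Unique L → ∀ {a} → a ∈ L → (φ : A → ℤ) → (∀ b → b ≢ a → φ b ≡ + 0) → ∑ L φ ≡ φ a
∑-single (a∉ ∷ u) (here refl) φ off = trans (+-congˡ (φ _) (∑-zero _ λ b m → off b λ e → All.lookup a∉ m (sym e))) (ℤP.+-identityʳ _)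
∑-single (a∉ ∷ u) (there m) φ off = trans (cong₂ _+_ (off _ (All.lookup a∉ m)) (∑-single u m φ off)) (ℤP.+-identityˡ _)

point : Cube → Cube → ℤ
point h c = if ⌊ c ≟V h ⌋ then + 1 else + 0

point-refl : ∀ h → point h h ≡ + 1
point-refl h with h ≟V h
... | yes _ = refl
... | no n = ⊥-elim (n refl)

point-off : ∀ h {c} → c ≢ h → point h c ≡ + 0
point-off h {c} n with c ≟V h
... | yes e = ⊥-elim (n e)
... | no _ = refl

εsum-point : ∀ C {h} → InCyl C h → εsum C (point h) ≡ ε h
εsum-point C {h} m = trans (∑-single (cellsOf-unique C) (∈-cellsOf⁺ C m) (λ c → ε c * point h c)
    (λ c n → trans (cong (ε c *_) (point-off h n)) (ℤP.*-zeroʳ (ε c))))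
  (trans (cong (ε h *_) (point-refl h)) (ℤP.*-identityʳ (ε h)))

-- `form K X` is itself `s` times `form K Y`, so the factor enters once for each argument.
pair-represents : ∀ K s X Y → (∀ ℓ → ∑ X (ev ℓ) ≡ s * ∑ Y (ev ℓ)) → pair K X X ≡ s * s * pair K Y Y
pair-represents K s X Y rep = begin
  pair K X X                                ≡⟨ pair-form K X X ⟩
  ∑ X (ev (form K X))                       ≡⟨ rep (form K X) ⟩
  s * ∑ Y (ev (form K X))                   ≡⟨ cong (s *_) (∑-cong Y λ d _ → cong (sg (dir d) *_) (rep (K (axis′ d) (base′ d)))) ⟩
  s * ∑ Y (λ d → sg (dir d) * (s * form K Y (axis′ d) (base′ d))) ≡⟨ cong (s *_) (trans (∑-cong Y λ d _ → r (sg (dir d)) s _) (∑-* Y s _)) ⟩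
  s * (s * ∑ Y (ev (form K Y)))             ≡⟨ cong (λ w → s * (s * w)) (sym (pair-form K Y Y)) ⟩
  s * (s * pair K Y Y)                      ≡⟨ sym (ℤP.*-assoc s s _) ⟩
  s * s * pair K Y Y ∎
  where
  open ≡-Reasoning
  r : ∀ a s b → a * (s * b) ≡ s * (a * b)
  r = solve-∀

record HasEdge (h : Cube) (α β γ : Dir) (κ : Kind) (k : Three) (d : Domino) : Set where
  constructor edge-at
  open Frame (frame α β γ)
  field
    ends : HasCells d (h ⊕ vec (proj₁ (edge κ k))) (h ⊕ vec (proj₁ (edge κ k)) ⊕ vec (proj₂ (edge κ k)))
open HasEdge using (ends)

-- Three unit steps of determinant 1 with the same sum as the frame are a cyclic rotation of it, so
-- the first two of them give an edge of kind `plus`.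
chi-edge : ∀ h h′ α β γ → det (vec α) (vec β) (vec γ) ≡ + 1 → h′ ≡ h ⊕ vec α ⊕ vec β ⊕ vec γ →
  ∀ e → ChiPlus h h′ e → Σ Three λ k → HasEdge h α β γ plus k e
chi-edge h h′ α β γ det-1 diagonal e χ with chi-path {e = e} χ
... | δ₁ , δ₂ , δ₃ , dt , hc , eq with find (FrameFacts.rotation (frameFacts α β γ det-1) δ₁ δ₂ δ₃ dt
        (⊕-cancel h (trans (sym (assoc₃ δ₁ δ₂ δ₃)) (trans (sym eq) (trans diagonal (assoc₃ α β γ))))))
  where
  assoc₃ : ∀ a b c → h ⊕ vec a ⊕ vec b ⊕ vec c ≡ h ⊕ (vec a ⊕ vec b ⊕ vec c)
  assoc₃ a b c = trans (cong (_⊕ vec c) (⊕-assoc h (vec a) (vec b))) (⊕-assoc h (vec a ⊕ vec b) (vec c))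
... | k , _ , e≡ = k , edge-at (subst (λ p → HasCells e (h ⊕ vec (proj₁ p)) (h ⊕ vec (proj₁ p) ⊕ vec (proj₂ p))) e≡ hc)

module HexagonMove (C : Cylinder) {t₀ t₁ : List Domino} (T₀ : IsTiling (InCyl C) t₀) (T₁ : IsTiling (InCyl C) t₁)
  (d₁ d₂ d₃ e₁ e₂ e₃ : Domino)
  (n₁₂ : NonParallel d₁ d₂) (n₁₃ : NonParallel d₁ d₃) (n₂₃ : NonParallel d₂ d₃)
  (same-cover : ∀ q → Cov3 e₁ e₂ e₃ q ⇔ Cov3 d₁ d₂ d₃ q)
  (j₁₂ : Disj e₁ e₂) (j₁₃ : Disj e₁ e₃) (j₂₃ : Disj e₂ e₃)
  (changed : ¬ (OneOf3 e₁ d₁ d₂ d₃ × OneOf3 e₂ d₁ d₂ d₃ × OneOf3 e₃ d₁ d₂ d₃))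
  (rep : Replaces t₀ (d₁ ∷ d₂ ∷ d₃ ∷ []) (e₁ ∷ e₂ ∷ e₃ ∷ []) t₁)
  (h : Cube) (h-free : ¬ Cov3 d₁ d₂ d₃ h)
  (α β γ : Dir) (det-1 : det (vec α) (vec β) (vec γ) ≡ + 1) (m₁ m₂ m₃ : Three)
  (edge₁ : HasEdge h α β γ plus m₁ e₁) (edge₂ : HasEdge h α β γ plus m₂ e₂) (edge₃ : HasEdge h α β γ plus m₃ e₃) where

  private
    fr = frame α β γ
    A E : List Domino
    A = d₁ ∷ d₂ ∷ d₃ ∷ []
    E = e₁ ∷ e₂ ∷ e₃ ∷ []
    A⊆ = proj₁ rep
    module F = FrameFacts (frameFacts α β γ det-1)
    -- The common colour of the neighbours of `h`, at which all edges of the hexagon start.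
    G = - ε h
  open Frame fr
  open ≡-Reasoning

  private
    Edge : Kind → Three → Domino → Set
    Edge = HasEdge h α β γ

  apart : ∀ {d e k l} → Disj d e → Edge plus k d → Edge plus l e → k ≢ l
  apart {d} {e} D p q refl = D _ (proj₁ (HasCells-covers d (ends p))) (proj₁ (HasCells-covers e (ends q)))

  p₁₂ : m₁ ≢ m₂
  p₁₂ = apart {e₁} {e₂} {m₁} {m₂} j₁₂ edge₁ edge₂
  p₁₃ : m₁ ≢ m₃
  p₁₃ = apart {e₁} {e₃} {m₁} {m₃} j₁₃ edge₁ edge₃
  p₂₃ : m₂ ≢ m₃
  p₂₃ = apart {e₂} {e₃} {m₂} {m₃} j₂₃ edge₂ edge₃

  data HexCell : Cube → Set where
    first : ∀ k → HexCell (h ⊕ vec (fr k))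
    second : ∀ k → HexCell (h ⊕ vec (fr k) ⊕ vec (fr (next k)))

  edge-hex : ∀ {e k c} → Edge plus k e → Covers e c → HexCell c
  edge-hex {k = k} (edge-at (inj₁ (p , q))) (inj₁ refl) = subst HexCell (sym p) (first k)
  edge-hex {k = k} (edge-at (inj₁ (p , q))) (inj₂ refl) = subst HexCell (sym q) (second k)
  edge-hex {k = k} (edge-at (inj₂ (p , q))) (inj₁ refl) = subst HexCell (sym p) (second k)
  edge-hex {k = k} (edge-at (inj₂ (p , q))) (inj₂ refl) = subst HexCell (sym q) (first k)

  E-hex : ∀ {c} → Cov3 e₁ e₂ e₃ c → HexCell c
  E-hex (inj₁ k) = edge-hex {e₁} {m₁} edge₁ k
  E-hex (inj₂ (inj₁ k)) = edge-hex {e₂} {m₂} edge₂ k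
  E-hex (inj₂ (inj₂ k)) = edge-hex {e₃} {m₃} edge₃ k

  which : ∀ {e k} → Edge plus k e → e ∈ E → ∀ {l} → l ≡ k → ∀ {c} → c ≡ h ⊕ vec (fr l) ⊎ c ≡ h ⊕ vec (fr l) ⊕ vec (fr (next l)) → Covers e c
  which {e} hc m refl (inj₁ refl) = proj₁ (HasCells-covers e (ends hc))
  which {e} hc m refl (inj₂ refl) = proj₂ (HasCells-covers e (ends hc))

  by-index : ∀ l {c} → c ≡ h ⊕ vec (fr l) ⊎ c ≡ h ⊕ vec (fr l) ⊕ vec (fr (next l)) → Cov3 e₁ e₂ e₃ c
  by-index l k with exhaust m₁ m₂ m₃ p₁₂ p₁₃ p₂₃ l
  ... | here e = inj₁ (which {e₁} {m₁} edge₁ (here refl) e k)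
  ... | there (here e) = inj₂ (inj₁ (which {e₂} {m₂} edge₂ (there (here refl)) e k))
  ... | there (there (here e)) = inj₂ (inj₂ (which {e₃} {m₃} edge₃ (there (there (here refl))) e k))

  hex-A : ∀ {c} → HexCell c → Cov3 d₁ d₂ d₃ c
  hex-A {c} (first k) = Equivalence.to (same-cover c) (by-index k (inj₁ refl))
  hex-A {c} (second k) = Equivalence.to (same-cover c) (by-index k (inj₂ refl))

  A-hex : ∀ {c} → Cov3 d₁ d₂ d₃ c → HexCell c
  A-hex {c} k = E-hex (Equivalence.from (same-cover c) k)

  cov-A : ∀ {c} → Cov3 d₁ d₂ d₃ c → Σ Domino λ d → d ∈ A × Covers d c
  cov-A (inj₁ k) = d₁ , here refl , k
  cov-A (inj₂ (inj₁ k)) = d₂ , there (here refl) , k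
  cov-A (inj₂ (inj₂ k)) = d₃ , there (there (here refl)) , k

  A-cov : ∀ {d c} → d ∈ A → Covers d c → Cov3 d₁ d₂ d₃ c
  A-cov (here refl) k = inj₁ k
  A-cov (there (here refl)) k = inj₂ (inj₁ k)
  A-cov (there (there (here refl))) k = inj₂ (inj₂ k)

  E-cov : ∀ {d c} → d ∈ E → Covers d c → Cov3 e₁ e₂ e₃ c
  E-cov (here refl) k = inj₁ k
  E-cov (there (here refl)) k = inj₂ (inj₁ k)
  E-cov (there (there (here refl))) k = inj₂ (inj₂ k)

  white-A : ∀ {d} → d ∈ A → ε (wc d) ≡ + 1
  white-A m = tiling-white T₀ (All.lookup A⊆ m)

  white-E : ∀ {e} → e ∈ E → ε (wc e) ≡ + 1
  white-E {e} m = tiling-white T₁ (Equivalence.from (proj₂ rep e) (inj₂ m))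

  hex-offset : ∀ {c} → HexCell c → Σ V3 λ u → u ∈ hexagon α β γ × c ≡ h ⊕ u
  hex-offset (first k) = cell₁ plus k , ∈-++⁺ˡ (∈-map⁺ (cell₁ plus) (∈-threes k)) , refl
  hex-offset (second k) = cell₂ plus k , ∈-++⁺ʳ (map (cell₁ plus) threes) (∈-map⁺ (cell₂ plus) (∈-threes k)) , ⊕-assoc h (vec (fr k)) (vec (fr (next k)))

  A-edge : ∀ {d} → d ∈ A → Σ Kind λ κ → Σ Three λ k → Edge κ k d
  A-edge {d} m with hex-offset (A-hex (A-cov m (inj₁ refl))) | hex-offset (A-hex (A-cov m (inj₂ refl)))
  ... | u , u∈ , w≡ | u′ , u′∈ , b≡ with find (All.lookup F.hexagon-edges u∈ (dir d) (subst (_∈ hexagon α β γ) (sym move) u′∈))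
    where
    move : u ⊕ vec (dir d) ≡ u′
    move = ⊕-cancel h (trans (sym (⊕-assoc h u (vec (dir d)))) (trans (cong (_⊕ vec (dir d)) (sym w≡)) b≡))
  ... | k , _ , which-edge = result which-edge
    where
    b≡′ : bc d ≡ h ⊕ (u ⊕ vec (dir d))
    b≡′ = trans (cong (_⊕ vec (dir d)) w≡) (⊕-assoc h u (vec (dir d)))
    assoc : ∀ κ → h ⊕ vec (proj₁ (edge κ k)) ⊕ vec (proj₂ (edge κ k)) ≡ h ⊕ cell₂ κ k
    assoc κ = ⊕-assoc h (vec (proj₁ (edge κ k))) (vec (proj₂ (edge κ k)))
    cells-of : ∀ κ → IsEdge α β γ u (u ⊕ vec (dir d)) κ k → Edge κ k d
    cells-of κ (inj₁ (p , q)) = edge-at (inj₁ (trans w≡ (cong (h ⊕_) p) , trans b≡′ (trans (cong (h ⊕_) q) (sym (assoc κ)))))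
    cells-of κ (inj₂ (p , q)) = edge-at (inj₂ (trans w≡ (trans (cong (h ⊕_) p) (sym (assoc κ))) , trans b≡′ (cong (h ⊕_) q)))
    result : _ → Σ Kind λ κ → Σ Three λ k → Edge κ k d
    result (inj₁ i) = plus , k , cells-of plus i
    result (inj₂ i) = minus , k , cells-of minus i

  edge-axis : ∀ κ k {d} → Edge κ k d → axis′ d ≡ axisOf (fr (next k))
  edge-axis plus k {d} hc = has-axis d {h ⊕ vec (fr k)} {fr (next k)} (ends hc)
  edge-axis minus k {d} hc = has-axis d {h ⊕ vec (fr (next (next k)))} {fr (next k)} (ends hc)

  edge-apart : ∀ κ κ′ {k k′ d d′} → NonParallel d d′ → Edge κ k d → Edge κ′ k′ d′ → k ≢ k′
  edge-apart κ κ′ {k} {k′} {d} {d′} np p q refl = np (trans (edge-axis κ k {d} p) (sym (edge-axis κ′ k′ {d′} q)))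

  -- The two kinds alternate around the hexagon: an edge of kind `plus` shares a cube with every
  -- edge of kind `minus` except the opposite one, which has the same index and is parallel to it.
  mixed : ∀ k k′ {d d′} → d ∈ A → d′ ∈ A → NonParallel d d′ → Edge plus k d → Edge minus k′ d′ → ⊥
  mixed k k′ {d} {d′} m m′ np p q = meet k k′ p q
    where
    clash : ∀ {c} → Covers d c → Covers d′ c → ⊥
    clash a b = np (cong axis′ (tiling-overlap T₀ (All.lookup A⊆ m) (All.lookup A⊆ m′) a b))
    same-index : ∀ k → Edge plus k d → Edge minus k d′ → ⊥
    same-index k p q = edge-apart plus minus {k} {k} {d} {d′} np p q refl
    one : ∀ {a b b′} → HasCells d a b → HasCells d′ a b′ → ⊥
    one p q = clash (proj₁ (HasCells-covers d p)) (proj₁ (HasCells-covers d′ q))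
    two : ∀ {a b a′} → HasCells d a b → HasCells d′ a′ b → ⊥
    two p q = clash (proj₂ (HasCells-covers d p)) (proj₂ (HasCells-covers d′ q))
    meet : ∀ k k′ → Edge plus k d → Edge minus k′ d′ → ⊥
    meet k₀ k₀ p q = same-index k₀ p q
    meet k₁ k₁ p q = same-index k₁ p q
    meet k₂ k₂ p q = same-index k₂ p q
    meet k₀ k₁ p q = one (ends p) (ends q)
    meet k₁ k₂ p q = one (ends p) (ends q)
    meet k₂ k₀ p q = one (ends p) (ends q)
    meet k₀ k₂ p q = two (ends p) (HasCells-≡ d′ refl (⊕-swap h (vec β) (vec α)) (ends q))
    meet k₁ k₀ p q = two (ends p) (HasCells-≡ d′ refl (⊕-swap h (vec γ) (vec β)) (ends q))
    meet k₂ k₁ p q = two (ends p) (HasCells-≡ d′ refl (⊕-swap h (vec α) (vec γ)) (ends q))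

  Triple : Kind → Domino → Domino → Domino → Set
  Triple κ a b c = Σ Three λ k → Σ Three λ l → Σ Three λ m →
    Edge κ k a × Edge κ l b × Edge κ m c × k ≢ l × k ≢ m × l ≢ m

  NonParallel-sym : ∀ {d e} → NonParallel d e → NonParallel e d
  NonParallel-sym n e = n (sym e)

  not-plus : Triple plus d₁ d₂ d₃ → ⊥
  not-plus (k , l , m , a , b , c , p , q , r) =
    changed (one-of {e₁} {m₁} edge₁ (here refl) , one-of {e₂} {m₂} edge₂ (there (here refl)) , one-of {e₃} {m₃} edge₃ (there (there (here refl))))
    where
    one-of : ∀ {e k′} → Edge plus k′ e → e ∈ E → OneOf3 e d₁ d₂ d₃
    one-of {e} {k′} hc e∈ with exhaust k l m p q r k′
    ... | here refl = inj₁ (same-cells (white-E e∈) (white-A (here refl)) (ends hc) (ends a))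
    ... | there (here refl) = inj₂ (inj₁ (same-cells (white-E e∈) (white-A (there (here refl))) (ends hc) (ends b)))
    ... | there (there (here refl)) = inj₂ (inj₂ (same-cells (white-E e∈) (white-A (there (there (here refl)))) (ends hc) (ends c)))

  E-triple : Triple plus e₁ e₂ e₃
  E-triple = m₁ , m₂ , m₃ , edge₁ , edge₂ , edge₃ , p₁₂ , p₁₃ , p₂₃

  -- The removed dominoes are edges of the hexagon and all of one kind, since different kinds
  -- overlap or are parallel. If that kind were `plus`, the trit would change nothing.
  A-triple : Triple minus d₁ d₂ d₃
  A-triple = combine (A-edge (here refl)) (A-edge (there (here refl))) (A-edge (there (there (here refl))))
    where
    Edged : Domino → Set
    Edged d = Σ Kind λ κ → Σ Three λ k → Edge κ k d
    apart₃ : ∀ κ {k l m} → Edge κ k d₁ → Edge κ l d₂ → Edge κ m d₃ → Triple κ d₁ d₂ d₃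
    apart₃ κ {k} {l} {m} a b c = k , l , m , a , b , c ,
      edge-apart κ κ {k} {l} {d₁} {d₂} n₁₂ a b , edge-apart κ κ {k} {m} {d₁} {d₃} n₁₃ a c , edge-apart κ κ {l} {m} {d₂} {d₃} n₂₃ b c
    combine : Edged d₁ → Edged d₂ → Edged d₃ → Triple minus d₁ d₂ d₃
    combine (minus , _ , a) (minus , _ , b) (minus , _ , c) = apart₃ minus a b c
    combine (plus , _ , a) (plus , _ , b) (plus , _ , c) = ⊥-elim (not-plus (apart₃ plus a b c))
    combine (plus , k , a) (minus , l , b) _ = ⊥-elim (mixed k l {d₁} {d₂} (here refl) (there (here refl)) n₁₂ a b)
    combine (minus , k , a) (plus , l , b) _ = ⊥-elim (mixed l k {d₂} {d₁} (there (here refl)) (here refl) (NonParallel-sym {d₁} {d₂} n₁₂) b a)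
    combine (plus , k , a) (plus , l , b) (minus , m , c) = ⊥-elim (mixed k m {d₁} {d₃} (here refl) (there (there (here refl))) n₁₃ a c)
    combine (minus , k , a) (minus , l , b) (plus , m , c) = ⊥-elim (mixed m k {d₃} {d₁} (there (there (here refl))) (here refl) (NonParallel-sym {d₁} {d₃} n₁₃) c a)

  shifted : Kind → List Domino
  shifted κ = map (shiftD h) (edges κ)

  shifted-∑ : ∀ κ (φ : Domino → ℤ) → ∑ (shifted κ) φ ≡ ∑ threes (λ k → φ (dom (h ⊕ vec (proj₁ (edge κ k))) (proj₂ (edge κ k))))
  shifted-∑ κ φ = trans (∑-map (shiftD h) (edges κ) φ)
    (trans (∑-map (λ k → dom (vec (proj₁ (edge κ k))) (proj₂ (edge κ k))) threes (λ d → φ (shiftD h d)))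
    (∑₃-cong (λ k → φ (dom (vec (proj₁ (edge κ k)) ⊕ h) (proj₂ (edge κ k)))) (λ k → φ (dom (h ⊕ vec (proj₁ (edge κ k))) (proj₂ (edge κ k))))
      (λ k → cong (λ c → φ (dom c (proj₂ (edge κ k)))) (⊕-comm (vec (proj₁ (edge κ k))) h))))

  represents : ∀ κ {a b c} → Triple κ a b c → (∀ {d} → d ∈ a ∷ b ∷ c ∷ [] → ε (wc d) ≡ + 1) →
    ∀ ℓ → ∑ (a ∷ b ∷ c ∷ []) (ev ℓ) ≡ G * ∑ (shifted κ) (ev ℓ)
  represents κ {a} {b} {c} (k , l , m , ha , hb , hc , p , q , r) white ℓ = begin
    ∑ (a ∷ b ∷ c ∷ []) (ev ℓ)             ≡⟨ cong₂ _+_ (value {a} {k} (here refl) ha) (cong₂ _+_ (value {b} {l} (there (here refl)) hb) (cong (_+ + 0) (value {c} {m} (there (there (here refl))) hc))) ⟩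
    ∑ (k ∷ l ∷ m ∷ []) (λ k → G * Φ k)    ≡⟨ ∑-↭ (λ k → G * Φ k) (threes-↭ p q r) ⟩
    ∑ threes (λ k → G * Φ k)              ≡⟨ ∑-* threes G Φ ⟩
    G * ∑ threes Φ                        ≡⟨ cong (G *_) (sym (shifted-∑ κ (ev ℓ))) ⟩
    G * ∑ (shifted κ) (ev ℓ) ∎
    where
    Φ : Three → ℤ
    Φ k = ev ℓ (dom (h ⊕ vec (proj₁ (edge κ k))) (proj₂ (edge κ k)))
    value : ∀ {d k} → d ∈ a ∷ b ∷ c ∷ [] → Edge κ k d → ev ℓ d ≡ G * Φ k
    value {d} {k} m hd = trans (ev-dir ℓ d {h ⊕ vec (proj₁ (edge κ k))} {proj₂ (edge κ k)} (white m) (ends hd)) (cong (_* Φ k) (ε-bc (dom h (proj₁ (edge κ k)))))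

  rep-E = represents plus E-triple white-E
  rep-A = represents minus A-triple white-A

  split : Σ (List Domino) λ r → t₀ ↭ A ++ r × t₁ ↭ E ++ r × (∀ {d} → d ∈ r → d ∈ t₀ × d ∉ A)
  split = replaces-split A E T₀ T₁ rep uA uE meets
    where
    np≢ : ∀ {d e} → NonParallel d e → d ≢ e
    np≢ n refl = n refl
    dj≢ : ∀ {d e} → Disj d e → d ≢ e
    dj≢ D refl = D _ (inj₁ refl) (inj₁ refl)
    uA : Unique A
    uA = (np≢ {d₁} {d₂} n₁₂ ∷ np≢ {d₁} {d₃} n₁₃ ∷ []) ∷ (np≢ {d₂} {d₃} n₂₃ ∷ []) ∷ [] ∷ []
    uE : Unique E
    uE = (dj≢ {e₁} {e₂} j₁₂ ∷ dj≢ {e₁} {e₃} j₁₃ ∷ []) ∷ (dj≢ {e₂} {e₃} j₂₃ ∷ []) ∷ [] ∷ []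
    meets : ∀ {e} → e ∈ E → Σ Domino λ a → a ∈ A × Σ Cube λ c → Covers e c × Covers a c
    meets {e} m with cov-A (Equivalence.to (same-cover (wc e)) (E-cov m (inj₁ refl)))
    ... | a , a∈ , k = a , a∈ , wc e , inj₁ refl , k

  r = proj₁ split
  t₀↭ = proj₁ (proj₂ split)
  t₁↭ = proj₁ (proj₂ (proj₂ split))
  r⁻ = proj₂ (proj₂ (proj₂ split))

  r-avoids : ∀ {b c} → b ∈ r → Covers b c → ¬ HexCell c
  r-avoids m k x with cov-A (hex-A x)
  ... | a , a∈ , k′ = proj₂ (r⁻ m) (subst (_∈ A) (tiling-overlap T₀ (All.lookup A⊆ a∈) (proj₁ (r⁻ m)) k′ k) a∈)

  bd-rest : ∀ φ → bd r φ ≡ - εsum C φ - bd A φ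
  bd-rest φ = begin
    bd r φ                        ≡⟨ l (bd A φ) (bd r φ) ⟩
    bd A φ + bd r φ - bd A φ      ≡⟨ cong (_- bd A φ) (sym (bd-++ A r φ)) ⟩
    bd (A ++ r) φ - bd A φ        ≡⟨ cong (_- bd A φ) (sym (bd-↭ φ t₀↭)) ⟩
    bd t₀ φ - bd A φ              ≡⟨ cong (_- bd A φ) (cylinder-fills C T₀ φ) ⟩
    - εsum C φ - bd A φ ∎
    where
    l : ∀ a b → b ≡ a + b - a
    l = solve-∀

  hex-in : ∀ {c} → HexCell c → InCyl C c
  hex-in x with cov-A (hex-A x)
  ... | a , a∈ , k = tiling-inside T₀ (All.lookup A⊆ a∈) k

  -- One neighbour of `h` supplies the projection and another the height. So `h` belongs to the
  -- region although the removed dominoes miss it, and the three squares at `h` lie in the cylinder.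
  h-in : InCyl C h
  h-in with find (F.axes (axis C))
  ... | k , _ , p , n = InCyl-mix C (hex-in (first k)) (hex-in (first (next k)))
    (sym (proj-⊕ (axis C) h (fr k) p)) (sym (along-⊕ (axis C) h (fr (next k)) n))

  corner-cell : ∀ k {c} → Corner h (fr k) (fr (next k)) c → c ≡ h ⊎ HexCell c
  corner-cell k c₀₀ = inj₁ refl
  corner-cell k c₁₀ = inj₂ (first k)
  corner-cell k c₀₁ = inj₂ (first (next k))
  corner-cell k c₁₁ = inj₂ (second k)

  corner-in : ∀ k {c} → Corner h (fr k) (fr (next k)) c → InCyl C c
  corner-in k f with corner-cell k f
  ... | inj₁ refl = h-in
  ... | inj₂ x = hex-in x

  LF : Form
  LF = sumForm (loopFlux h)
  LS : Cube → ℤ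
  LS = sumSide (loopSide h)

  LF-at-h : ∀ δ → ev LF (dom h δ) ≡ ev (sumForm (loopFlux origin)) (dom origin δ)
  LF-at-h δ = cong (sg δ *_) (∑₃-cong (λ k → loopFlux h (fr k) (fr (next k)) (axisOf δ) (lower δ h))
    (λ k → loopFlux origin (fr k) (fr (next k)) (axisOf δ) (lower δ origin)) λ k →
    trans (cong₂ (λ p q → loopFlux p (fr k) (fr (next k)) (axisOf δ) q) (sym (origin-⊕ h))
                 (trans (cong (lower δ) (sym (origin-⊕ h))) (lower-shift h δ origin)))
          (loopFlux-shift h origin (fr k) (fr (next k)) (axisOf δ) (lower δ origin)))

  LS-shift : ∀ c → LS (c ⊕ h) ≡ sumSide (loopSide origin) c
  LS-shift c = ∑₃-cong (λ k → loopSide h (fr k) (fr (next k)) (c ⊕ h)) (λ k → loopSide origin (fr k) (fr (next k)) c) λ k → trans (cong (λ p → loopSide p (fr k) (fr (next k)) (c ⊕ h)) (sym (origin-⊕ h)))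
    (loopSide-shift h origin (fr k) (fr (next k)) c)

  -- The flux out of h: a domino of the rest leaves h away from the hexagon.
  LF-rest : ∀ {b} → b ∈ r → ev LF b ≡ point h (bc b) - point h (wc b)
  LF-rest {b} m with wc b ≟V h | bc b ≟V h
  ... | yes refl | yes e = ⊥-elim (wc≢bc b (sym e))
  ... | yes refl | no n = trans (LF-at-h (dir b)) (F.flux-out (dir b) (out (dir b) (inj₁ (refl , refl))))
    where
    out : ∀ δ → HasCells b (wc b) (wc b ⊕ vec δ) → All (λ k → δ ≢ fr k) threes
    out δ hc = All.tabulate λ { {k} _ refl → r-avoids m (proj₂ (HasCells-covers b hc)) (first k) }
  ... | no n | yes refl = trans (ev-dir LF b {δ = opp (dir b)} white hc)
      (trans (cong₂ _*_ (trans (ε-bc b) (cong -_ white)) (trans (LF-at-h (opp (dir b))) (F.flux-out (opp (dir b)) out))) refl)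
    where
    white = tiling-white T₀ (proj₁ (r⁻ m))
    hc : HasCells b (bc b) (bc b ⊕ vec (opp (dir b)))
    hc = inj₂ (sym (⊕-opp (wc b) (dir b)) , refl)
    out : All (λ k → opp (dir b) ≢ fr k) threes
    out = All.tabulate λ {k} _ e → r-avoids m (proj₂ (HasCells-covers b hc)) (subst HexCell (cong (λ δ → bc b ⊕ vec δ) (sym e)) (first k))
  ... | no n | no n′ = trans (sym (∑-* threes (sg (dir b)) (λ k → loopFlux h (fr k) (fr (next k)) (axis′ b) (base′ b))))
      (∑-zero threes {λ k → sg (dir b) * loopFlux h (fr k) (fr (next k)) (axis′ b) (base′ b)} λ k _ → off k)
    where
    rg : ∀ a s f → a * (s * f) ≡ s * (a * f)
    rg = solve-∀
    off : ∀ k → sg (dir b) * loopFlux h (fr k) (fr (next k)) (axis′ b) (base′ b) ≡ + 0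
    off k = trans (rg (sg (dir b)) (sg (fr k) * sg (fr (next k))) _)
      (trans (cong (sg (fr k) * sg (fr (next k)) *_) (nflux-off (axisOf (fr k)) (axisOf (fr (next k))) _ b no-touch))
             (ℤP.*-zeroʳ (sg (fr k) * sg (fr (next k)))))
      where
      no-touch : ∀ c → Covers b c → ¬ Face (axisOf (fr k)) (axisOf (fr (next k))) (lower (fr (next k)) (lower (fr k) h)) c
      no-touch c cov f with corner-cell k (face-corner h (fr k) (fr (next k)) f)
      ... | inj₂ x = r-avoids m cov x
      ... | inj₁ refl with cov
      ...   | inj₁ e = n (sym e)
      ...   | inj₂ e = n′ (sym e)

  -- Some domino of the rest covers `h`. Evaluating the boundary of the rest on the indicator of `h`
  -- finds its contribution without naming it.
  flux-total : ∑ r (ev LF) ≡ G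
  flux-total = begin
    ∑ r (ev LF)                          ≡⟨ ∑-cong r (λ b m → LF-rest m) ⟩
    bd r (point h)                       ≡⟨ bd-rest (point h) ⟩
    - εsum C (point h) - bd A (point h)  ≡⟨ cong₂ (λ a b → - a - b) (εsum-point C h-in) (∑-zero A λ d m → cong₂ _-_ (miss m (inj₂ refl)) (miss m (inj₁ refl))) ⟩
    - ε h - + 0                          ≡⟨ ℤP.+-identityʳ _ ⟩
    G ∎
    where
    miss : ∀ {d c} → d ∈ A → Covers d c → point h c ≡ + 0
    miss {d} m k = point-off h λ { refl → h-free (A-cov m k) }

  -- Over the whole cylinder the error terms of the three squares cancel by reflection, so the rest
  -- contributes the negative of what the removed dominoes do.
  side-total : bd r LS ≡ G
  side-total = begin
    bd r LS                   ≡⟨ bd-rest LS ⟩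
    - εsum C LS - bd A LS     ≡⟨ cong₂ (λ a b → - a - b) εLS bdA ⟩
    - + 0 - G * - + 1         ≡⟨ rg G ⟩
    G ∎
    where
    rg : ∀ g → - + 0 - g * - + 1 ≡ g
    rg = solve-∀
    rg′ : ∀ e s f → e * (s * f) ≡ s * (e * f)
    rg′ = solve-∀
    εLS : εsum C LS ≡ + 0
    εLS = begin
      ∑ (cellsOf C) (λ c → ε c * LS c)
        ≡⟨ ∑-cong (cellsOf C) (λ c _ → sym (∑-* threes (ε c) (λ k → loopSide h (fr k) (fr (next k)) c))) ⟩
      ∑ (cellsOf C) (λ c → ∑ threes (λ k → ε c * loopSide h (fr k) (fr (next k)) c))
        ≡⟨ ∑-swap (cellsOf C) threes (λ c k → ε c * loopSide h (fr k) (fr (next k)) c) ⟩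
      ∑ threes (λ k → ∑ (cellsOf C) (λ c → ε c * loopSide h (fr k) (fr (next k)) c))
        ≡⟨ ∑-zero threes {λ k → ∑ (cellsOf C) (λ c → ε c * loopSide h (fr k) (fr (next k)) c)} (λ k _ → piece k) ⟩
      + 0 ∎
      where
      piece : ∀ k → ∑ (cellsOf C) (λ c → ε c * loopSide h (fr k) (fr (next k)) c) ≡ + 0
      piece k = trans (∑-cong (cellsOf C) λ c _ → rg′ (ε c) (sg (fr k) * sg (fr (next k))) _)
        (trans (∑-* (cellsOf C) (sg (fr k) * sg (fr (next k))) _)
        (trans (cong (sg (fr k) * sg (fr (next k)) *_) (εsum-nside C (axisOf (fr k)) (axisOf (fr (next k))) _ λ q f → corner-in k (face-corner h (fr k) (fr (next k)) f)))
        (ℤP.*-zeroʳ (sg (fr k) * sg (fr (next k))))))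
    LS₀ = sumSide (loopSide origin)
    bdA : bd A LS ≡ G * - + 1
    bdA = begin
      bd A LS                        ≡⟨ sym (∑-ev-∂ A LS) ⟩
      ∑ A (ev (∂ LS))                ≡⟨ rep-A (∂ LS) ⟩
      G * ∑ (shifted minus) (ev (∂ LS)) ≡⟨ cong (G *_) (∑-ev-∂ (shifted minus) LS) ⟩
      G * bd (shifted minus) LS      ≡⟨ cong (G *_) (trans (∑-map (shiftD h) (edges minus) (λ d → LS (bc d) - LS (wc d)))
                                       (∑-cong (edges minus) {λ d → LS (bc (shiftD h d)) - LS (wc (shiftD h d))} {λ d → LS₀ (bc d) - LS₀ (wc d)}
                                         λ d _ → cong₂ _-_ (trans (cong LS (bc-shift h d)) (LS-shift (bc d))) (LS-shift (wc d)))) ⟩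
      G * bd (edges minus) LS₀       ≡⟨ cong (G *_) F.side-minus ⟩
      G * - + 1 ∎

  -- In the three loops at `h` each spoke is run through once in each direction. What remains is the
  -- hexagon, with its `plus` edges counted positively and its `minus` edges negatively.
  loops : ∀ ℓ → ∑ (shifted plus) (ev ℓ) - ∑ (shifted minus) (ev ℓ)
    ≡ ∑ threes (λ k → sg (fr k) * sg (fr (next k)) * curl ℓ (axisOf (fr k)) (axisOf (fr (next k))) (lower (fr (next k)) (lower (fr k) h)))
  loops ℓ = begin
    ∑ (shifted plus) (ev ℓ) - ∑ (shifted minus) (ev ℓ)
      ≡⟨ cong₂ _-_ (shifted-∑ plus (ev ℓ)) (shifted-∑ minus (ev ℓ)) ⟩
    ∑ threes (λ k → ev ℓ (dom (h ⊕ vec (fr k)) (fr (next k)))) - ∑ threes (λ k → ev ℓ (dom (h ⊕ vec (fr (next (next k)))) (fr (next k))))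
      ≡⟨ rg (a k₀) (a k₁) (a k₂) (b k₀) (b k₁) (b k₂) (o k₀) (o k₁) (o k₂) ⟩
    ∑ threes (λ k → ev ℓ (dom h (fr k)) + ev ℓ (dom (h ⊕ vec (fr k)) (fr (next k))) - ev ℓ (dom (h ⊕ vec (fr (next k))) (fr k)) - ev ℓ (dom h (fr (next k))))
      ≡⟨ ∑₃-cong (λ k → o k + a k - ev ℓ (dom (h ⊕ vec (fr (next k))) (fr k)) - o (next k)) curls (λ k → loop-curl ℓ h (fr k) (fr (next k))) ⟩
    ∑ threes curls ∎
    where
    a b o : Three → ℤ
    a k = ev ℓ (dom (h ⊕ vec (fr k)) (fr (next k)))
    b k = ev ℓ (dom (h ⊕ vec (fr (next (next k)))) (fr (next k)))
    o k = ev ℓ (dom h (fr k))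
    curls : Three → ℤ
    curls k = sg (fr k) * sg (fr (next k)) * curl ℓ (axisOf (fr k)) (axisOf (fr (next k))) (lower (fr (next k)) (lower (fr k) h))
    rg : ∀ a₀ a₁ a₂ b₀ b₁ b₂ o₀ o₁ o₂ → a₀ + (a₁ + (a₂ + + 0)) - (b₀ + (b₁ + (b₂ + + 0)))
      ≡ o₀ + a₀ - b₂ - o₁ + (o₁ + a₁ - b₀ - o₂ + (o₂ + a₂ - b₁ - o₀ + + 0))
    rg = solve-∀

  hexagon-total : ∑ (shifted plus) (ev (form KS r)) - ∑ (shifted minus) (ev (form KS r)) ≡ G + G
  hexagon-total = begin
    ∑ (shifted plus) (ev (form KS r)) - ∑ (shifted minus) (ev (form KS r))
      ≡⟨ loops (form KS r) ⟩
    ∑ threes (λ k → s k * curl (form KS r) (i k) (j k) (p k))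
      ≡⟨ ∑₃-cong (λ k → s k * curl (form KS r) (i k) (j k) (p k)) (λ k → f k + g k)
          (λ k → trans (cong (s k *_) (curl-KS r (i k) (j k) (p k))) (ℤP.*-distribˡ-+ (s k) _ _)) ⟩
    ∑ threes (λ k → f k + g k)
      ≡⟨ ∑-+ threes f g ⟩
    ∑ threes f + ∑ threes g
      ≡⟨ cong₂ _+_ fluxes sides ⟩
    ∑ r (ev LF) + bd r LS
      ≡⟨ cong₂ _+_ flux-total side-total ⟩
    G + G ∎
    where
    s : Three → ℤ
    s k = sg (fr k) * sg (fr (next k))
    i j : Three → Axis
    i k = axisOf (fr k)
    j k = axisOf (fr (next k))
    p : Three → Cube
    p k = lower (fr (next k)) (lower (fr k) h)
    rg : ∀ s a f → s * (a * f) ≡ a * (s * f)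
    rg = solve-∀
    f g : Three → ℤ
    f k = s k * ∑ r (ev (nflux (i k) (j k) (p k)))
    g k = s k * bd r (nside (i k) (j k) (p k))
    lf : Three → Domino → ℤ
    lf k = ev (loopFlux h (fr k) (fr (next k)))
    ls : Three → Domino → ℤ
    ls k b = loopSide h (fr k) (fr (next k)) (bc b) - loopSide h (fr k) (fr (next k)) (wc b)
    fluxes : ∑ threes f ≡ ∑ r (ev LF)
    fluxes = trans (∑₃-cong f (λ k → ∑ r (lf k)) λ k → trans (sym (∑-* r (s k) _)) (∑-cong r λ b _ → rg (s k) (sg (dir b)) _))
      (trans (∑-swap threes r lf) (∑-cong r λ b _ → ∑-* threes (sg (dir b)) (λ k → loopFlux h (fr k) (fr (next k)) (axis′ b) (base′ b))))
    rg′ : ∀ s a b → s * (a - b) ≡ s * a - s * b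
    rg′ = solve-∀
    sides : ∑ threes g ≡ bd r LS
    sides = trans (∑₃-cong g (λ k → ∑ r (ls k)) λ k → trans (sym (∑-* r (s k) _)) (∑-cong r λ b _ → rg′ (s k) _ _))
      (trans (∑-swap threes r ls) (∑-cong r λ b _ → ∑-- threes (λ k → loopSide h (fr k) (fr (next k)) (bc b)) (λ k → loopSide h (fr k) (fr (next k)) (wc b))))

  trit-difference : pair KB t₁ t₁ - pair KB t₀ t₀ ≡ + 4
  trit-difference = begin
    pair KB t₁ t₁ - pair KB t₀ t₀
      ≡⟨ move-difference A E r t₀↭ t₁↭ ⟩
    pair KB E E - pair KB A A + (∑ E (ev (form KS r)) - ∑ A (ev (form KS r)))
      ≡⟨ cong₂ _+_ (cong₂ _-_ square-E square-A) (trans (cong₂ _-_ (rep-E (form KS r)) (rep-A (form KS r))) (rg G _ _)) ⟩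
    G * G * + 1 - G * G * - + 1 + G * (∑ (shifted plus) (ev (form KS r)) - ∑ (shifted minus) (ev (form KS r)))
      ≡⟨ cong (λ w → G * G * + 1 - G * G * - + 1 + G * w) hexagon-total ⟩
    G * G * + 1 - G * G * - + 1 + G * (G + G)
      ≡⟨ rg′ G ⟩
    + 4 * (G * G)
      ≡⟨ cong (+ 4 *_) (trans (rg″ (ε h)) (ε-square h)) ⟩
    + 4 ∎
    where
    rg : ∀ g a b → g * a - g * b ≡ g * (a - b)
    rg = solve-∀
    rg′ : ∀ g → g * g * + 1 - g * g * - + 1 + g * (g + g) ≡ + 4 * (g * g)
    rg′ = solve-∀
    rg″ : ∀ e → - e * - e ≡ e * e
    rg″ = solve-∀
    square-E : pair KB E E ≡ G * G * + 1
    square-E = trans (pair-represents KB G E (shifted plus) rep-E) (cong (G * G *_) (trans (pair-shift h (edges plus) (edges plus)) F.pair-plus))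
    square-A : pair KB A A ≡ G * G * - + 1
    square-A = trans (pair-represents KB G A (shifted minus) rep-A) (cong (G * G *_) (trans (pair-shift h (edges minus) (edges minus)) F.pair-minus))

trit-increases : ∀ C t₀ t₁ → IsTiling (InCyl C) t₀ → IsTiling (InCyl C) t₁ → PositiveTrit t₀ t₁ →
  pair KB t₁ t₁ - pair KB t₀ t₀ ≡ + 4
trit-increases C t₀ t₁ T₀ T₁ (_ , d₁ , d₂ , d₃ , e₁ , e₂ , e₃ , _ , (n₁₂ , n₁₃ , n₂₃) , _ , cov , (j₁₂ , j₁₃ , j₂₃) , changed , rep ,
    (h , h′ , _ , _ , _ , ¬h , _ , χ₁ , χ₂ , χ₃)) with chi-path {e = e₁} χ₁
... | α , β , γ , dt , _ , eq with chi-edge h h′ α β γ dt eq e₁ χ₁ | chi-edge h h′ α β γ dt eq e₂ χ₂ | chi-edge h h′ α β γ dt eq e₃ χ₃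
... | m₁ , edge₁ | m₂ , edge₂ | m₃ , edge₃ =
  HexagonMove.trit-difference C T₀ T₁ d₁ d₂ d₃ e₁ e₂ e₃ n₁₂ n₁₃ n₂₃ cov j₁₂ j₁₃ j₂₃ changed rep h ¬h α β γ dt m₁ m₂ m₃ edge₁ edge₂ edge₃

-- Integrality

infix 4 _≈₂_
record _≈₂_ (m n : ℤ) : Set where
  constructor halved
  field
    half : ℤ
    difference : m ≡ n + + 2 * half

≈₂-reflexive : ∀ {m n} → m ≡ n → m ≈₂ n
≈₂-reflexive {n = n} e = halved (+ 0) (trans e (sym (ℤP.+-identityʳ n)))

≈₂-trans : ∀ {m n p} → m ≈₂ n → n ≈₂ p → m ≈₂ p
≈₂-trans {p = p} (halved j e) (halved k e′) = halved (j + k) (trans e (trans (cong (_+ + 2 * j) e′) (l p j k)))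
  where
  l : ∀ p j k → p + + 2 * k + + 2 * j ≡ p + + 2 * (j + k)
  l = solve-∀

≈₂-+ : ∀ {m n p q} → m ≈₂ n → p ≈₂ q → m + p ≈₂ n + q
≈₂-+ {n = n} {q = q} (halved j refl) (halved k refl) = halved (j + k) (l n q j k)
  where
  l : ∀ n q j k → n + + 2 * j + (q + + 2 * k) ≡ n + q + + 2 * (j + k)
  l = solve-∀

≈₂-* : ∀ s {m n} → m ≈₂ n → s * m ≈₂ s * n
≈₂-* s {n = n} (halved k refl) = halved (s * k) (l s n k)
  where
  l : ∀ s n k → s * (n + + 2 * k) ≡ s * n + + 2 * (s * k)
  l = solve-∀

≈₂-*ʳ : ∀ s {m n} → m ≈₂ n → m * s ≈₂ n * s
≈₂-*ʳ s {m} {n} e = subst (λ w → w ≈₂ n * s) (ℤP.*-comm s m) (subst (λ w → s * m ≈₂ w) (ℤP.*-comm s n) (≈₂-* s e))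

∑-≈₂ : ∀ {A : Set} (L : List A) {f g : A → ℤ} → (∀ a → a ∈ L → f a ≈₂ g a) → ∑ L f ≈₂ ∑ L g
∑-≈₂ [] e = ≈₂-reflexive refl
∑-≈₂ (a ∷ L) e = ≈₂-+ (e a (here refl)) (∑-≈₂ L λ b m → e b (there m))

ε≈₂1 : ∀ c → ε c ≈₂ + 1
ε≈₂1 c with ⌊ ∣ x c + y c + z c ∣ ℕ.% 2 ℕ.≟ 0 ⌋
... | true = halved (+ 0) refl
... | false = halved (- + 1) refl

∑-product : ∀ {A B D : Set} (f : A → B → D) xs ys (φ : D → ℤ) →
  ∑ (cartesianProductWith f xs ys) φ ≡ ∑ xs (λ a → ∑ ys (λ b → φ (f a b)))
∑-product f [] ys φ = refl
∑-product f (a ∷ xs) ys φ = trans (∑-++ (map (f a) ys) _ φ) (cong₂ _+_ (∑-map (f a) ys φ) (∑-product f xs ys φ))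

∑-const : ∀ l n k → ∑ (heights l n) (λ _ → k) ≡ + n * k
∑-const l zero k = refl
∑-const l (suc n) k = trans (+-congˡ k (∑-const (l + + 1) n k)) (r (+ n) k)
  where
  r : ∀ n k → k + n * k ≡ (+ 1 + n) * k
  r = solve-∀

consecutive-even : ∀ n → + n * (+ n - + 1) ≈₂ + 0
consecutive-even zero = ≈₂-reflexive refl
consecutive-even (suc n) with consecutive-even n
... | halved k e = halved (k + + n) (trans (l (+ n)) (trans (cong (_+ + 2 * + n) e) (l′ k (+ n))))
  where
  l : ∀ n → (+ 1 + n) * (+ 1 + n - + 1) ≡ n * (n - + 1) + + 2 * n
  l = solve-∀
  l′ : ∀ k n → + 0 + + 2 * k + + 2 * n ≡ + 0 + + 2 * (k + n)
  l′ = solve-∀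

-- The signed crossings of the diagram after the upper arrows are pushed off by a small
-- positive multiple of e_x + e_y; KB counts the average over the four push-offs, times 4.
KL : Kernel
KL ax a ay b = dd (x a + + 1) (x b) * dd (y a) (y b) * θ (z a) (z b)
KL ay a ax b = - (dd (x a) (x b) * dd (y a + + 1) (y b) * θ (z a) (z b))
KL _ _ _ _ = + 0

-- `overhead j b` is a function on the ends of the upper arrow for a fixed lower arrow, and
-- `beneath i a` one on the ends of the lower arrow for a fixed upper arrow. Their differentials
-- carry the other three push-offs contained in `KB` over to the one counted by `KL`.
overhead beneath : Axis → Cube → Cube → ℤ
overhead ax b c = + 2 * (dd (x c) (x b) * dd (y c) (y b) * θ (z c) (z b))
overhead ay b c = - (dd (x c) (x b) * mm (y c) (y b) * θ (z c) (z b))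
overhead az b c = + 0
beneath ax a c = + 2 * (dd (x a + + 1) (x c) * dd (y a) (y c) * θ (z a) (z c))
beneath ay a c = - (dd (x a) (x c) * mm (y c) (y a) * θ (z a) (z c))
beneath az a c = + 0

-- The remainder where a vertical arrow reaches the height of a horizontal one and `θ` jumps. It is
-- nonzero only if the two arrows share a cube, which never happens for dominoes of different
-- directions in a tiling.
contact : Kernel
contact az a ay b = dd (x a) (x b) * mm (y a) (y b) * dd (z a) (z b)
contact az a ax b = - (+ 2 * (dd (x a) (x b) * dd (y a) (y b) * dd (z a) (z b)))
contact ax a az b = + 2 * (dd (x a + + 1) (x b) * dd (y a) (y b) * dd (z a) (z b + + 1))
contact ay a az b = - (dd (x a) (x b) * mm (y b) (y a) * dd (z a) (z b + + 1))
contact _ _ _ _ = + 0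

private
  KB-KL : ∀ i a j b → KB i a j b ≡
    + 4 * KL i a j b + ∂ (overhead j b) i a + ∂ (beneath i a) j b + contact i a j b
  KB-KL ax a ay b rewrite mm-split (x b) (x a) | dd-sym (x a) (x b) | dd-sym (x a + + 1) (x b) | mm-split (y a) (y b) =
    l (dd (x a) (x b)) (dd (x a + + 1) (x b)) (dd (y a) (y b)) (dd (y a) (y b + + 1)) (θ (z a) (z b))
    where
    l : ∀ p p′ q q′ t → (p + p′) * (q + q′) * t ≡ + 4 * (p′ * q * t) + (- (p′ * (q + q′) * t) - - (p * (q + q′) * t))
      + (+ 2 * (p′ * q′ * t) - + 2 * (p′ * q * t)) + + 0
    l = solve-∀
  KB-KL ay a ax b rewrite mm-split (x a) (x b) | mm-split (y b) (y a) | dd-sym (y a) (y b) | dd-sym (y a + + 1) (y b) =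
    l (dd (x a) (x b)) (dd (x a) (x b + + 1)) (dd (y a) (y b)) (dd (y a + + 1) (y b)) (θ (z a) (z b))
    where
    l : ∀ p p′ q q′ t → - ((p + p′) * (q + q′) * t) ≡ + 4 * - (p * q′ * t) + (+ 2 * (p * q′ * t) - + 2 * (p * q * t))
      + (- (p′ * (q + q′) * t) - - (p * (q + q′) * t)) + + 0
    l = solve-∀
  KB-KL ax a ax b rewrite dd-up (x a) (x b) = l (dd (x a) (x b)) (dd (x a + + 1) (x b)) (dd (y a) (y b)) (θ (z a) (z b))
    where
    l : ∀ p p′ q t → + 0 ≡ + 4 * + 0 + (+ 2 * (p′ * q * t) - + 2 * (p * q * t)) + (+ 2 * (p * q * t) - + 2 * (p′ * q * t)) + + 0
    l = solve-∀
  KB-KL ay a ay b rewrite mm-flip (y a) (y b) | mm-flip (y b) (y a) = l (dd (x a) (x b)) (mm (y a) (y b)) (mm (y b) (y a)) (θ (z a) (z b))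
    where
    l : ∀ p q q′ t → + 0 ≡ + 4 * + 0 + (- (p * q′ * t) - - (p * q * t)) + (- (p * q * t) - - (p * q′ * t)) + + 0
    l = solve-∀
  KB-KL az a ay b rewrite θ-up (z a) (z b) = l (dd (x a) (x b)) (mm (y a) (y b)) (θ (z a) (z b)) (dd (z a) (z b))
    where
    l : ∀ p q t d → + 0 ≡ + 4 * + 0 + (- (p * q * (t + d)) - - (p * q * t)) + (+ 0 - + 0) + p * q * d
    l = solve-∀
  KB-KL az a ax b rewrite θ-up (z a) (z b) = l (dd (x a) (x b)) (dd (y a) (y b)) (θ (z a) (z b)) (dd (z a) (z b))
    where
    l : ∀ p q t d → + 0 ≡ + 4 * + 0 + (+ 2 * (p * q * (t + d)) - + 2 * (p * q * t)) + (+ 0 - + 0) + - (+ 2 * (p * q * d))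
    l = solve-∀
  KB-KL ax a az b rewrite θ-upʳ (z a) (z b) = l (dd (x a + + 1) (x b)) (dd (y a) (y b)) (θ (z a) (z b)) (dd (z a) (z b + + 1))
    where
    l : ∀ p q t d → + 0 ≡ + 4 * + 0 + (+ 0 - + 0) + (+ 2 * (p * q * (t - d)) - + 2 * (p * q * t)) + + 2 * (p * q * d)
    l = solve-∀
  KB-KL ay a az b rewrite θ-upʳ (z a) (z b) = l (dd (x a) (x b)) (mm (y b) (y a)) (θ (z a) (z b)) (dd (z a) (z b + + 1))
    where
    l : ∀ p q t d → + 0 ≡ + 4 * + 0 + (+ 0 - + 0) + (- (p * q * (t - d)) - - (p * q * t)) + - (p * q * d)
    l = solve-∀
  KB-KL az a az b = refl

  dd-product : ∀ {a b c} → a * b * c ≢ + 0 → a ≢ + 0 × b ≢ + 0 × c ≢ + 0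
  dd-product {a} {b} {c} n = *-nonzeroˡ {b = b} (*-nonzeroˡ n) , *-nonzeroʳ {a} (*-nonzeroˡ n) , *-nonzeroʳ {a * b} n

  Meets : Axis → Cube → Axis → Cube → Set
  Meets i a j b = Σ Cube λ c → (c ≡ a ⊎ c ≡ up i a) × (c ≡ b ⊎ c ≡ up j b)

  contact-meets : ∀ i a j b → contact i a j b ≢ + 0 → i ≢ j × Meets i a j b
  contact-meets ax a ax b n = ⊥-elim (n refl)
  contact-meets ax a ay b n = ⊥-elim (n refl)
  contact-meets ay a ax b n = ⊥-elim (n refl)
  contact-meets ay a ay b n = ⊥-elim (n refl)
  contact-meets az a az b n = ⊥-elim (n refl)
  contact-meets az a ay b n with dd-product {dd (x a) (x b)} {mm (y a) (y b)} n
  ... | p , q , r with dd-≡ {x a} {x b} p | mm-∈₂ {y a} {y b} q | dd-≡ {z a} {z b} r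
  ... | e | inj₁ e′ | e″ = (λ ()) , a , inj₁ refl , inj₁ (V3-≡ e e′ e″)
  ... | e | inj₂ e′ | e″ = (λ ()) , a , inj₁ refl , inj₂ (V3-≡ e e′ e″)
  contact-meets az a ax b n with dd-product {dd (x a) (x b)} {dd (y a) (y b)} {dd (z a) (z b)} (λ e → n (cong (λ w → - (+ 2 * w)) e))
  ... | p , q , r = (λ ()) , a , inj₁ refl , inj₁ (V3-≡ (dd-≡ {x a} p) (dd-≡ {y a} q) (dd-≡ {z a} r))
  contact-meets ax a az b n with dd-product {dd (x a + + 1) (x b)} {dd (y a) (y b)} {dd (z a) (z b + + 1)} (λ e → n (cong (+ 2 *_) e))
  ... | p , q , r = (λ ()) , up ax a , inj₂ refl , inj₂ (V3-≡ (dd-≡ {x a + + 1} p) (dd-≡ {y a} q) (dd-≡ {z a} r))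
  contact-meets ay a az b n with dd-product {dd (x a) (x b)} {mm (y b) (y a)} {dd (z a) (z b + + 1)} (λ e → n (cong -_ e))
  ... | p , q , r with dd-≡ {x a} {x b} p | mm-∈₂ {y b} {y a} q | dd-≡ {z a} {z b + + 1} r
  ... | e | inj₁ e′ | e″ = (λ ()) , a , inj₁ refl , inj₂ (V3-≡ e (sym e′) e″)
  ... | e | inj₂ e′ | e″ = (λ ()) , up ay a , inj₂ refl , inj₂ (V3-≡ e (sym e′) e″)

  covers-end : ∀ d {c} → c ≡ base′ d ⊎ c ≡ up (axis′ d) (base′ d) → Covers d c
  covers-end d (inj₁ refl) = covers-base d
  covers-end d (inj₂ refl) = covers-up d

  contact-zero : ∀ {R t} → IsTiling R t → ∀ {a b} → a ∈ t → b ∈ t → contact (axis′ a) (base′ a) (axis′ b) (base′ b) ≡ + 0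
  contact-zero T {a} {b} a∈ b∈ with contact (axis′ a) (base′ a) (axis′ b) (base′ b) ℤP.≟ + 0
  ... | yes e = e
  ... | no n with contact-meets (axis′ a) (base′ a) (axis′ b) (base′ b) n
  ... | i≢j , c , p , q = ⊥-elim (i≢j (cong axis′ (tiling-overlap T a∈ b∈ (covers-end a p) (covers-end b q))))

module Boundary (K K′ : Kernel) (U V : Axis → Cube → Cube → ℤ) where
  -- Summing a differential over a chain leaves the boundary of the chain. Done in one variable,
  -- this produces a 1-form in the other, to be summed over the same chain.
  pair-boundary : ∀ t →
    (∀ {a b} → a ∈ t → b ∈ t → let i = axis′ a ; c = base′ a ; j = axis′ b ; c′ = base′ b in
      K i c j c′ ≡ K′ i c j c′ + ∂ (U j c′) i c + ∂ (V i c) j c′) →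
    pair K t t ≡ pair K′ t t + ∑ t (ev (λ j c → bd t (U j c))) + ∑ t (ev (λ i c → bd t (V i c)))
  pair-boundary t identity = begin
    pair K t t
      ≡⟨ ∑-cong t (λ a a∈ → trans (∑-cong t λ b b∈ → term a∈ b∈) (trans (∑-+ t _ _) (cong₂ _+_ (∑-+ t _ _) refl))) ⟩
    ∑ t (λ a → ∑ t (ev² K′ a) + ∑ t (λ b → sg (dir b) * ev (∂ (U (axis′ b) (base′ b))) a) + ∑ t (λ b → sg (dir a) * ev (∂ (V (axis′ a) (base′ a))) b))
      ≡⟨ trans (∑-+ t _ _) (cong₂ _+_ (∑-+ t _ _) refl) ⟩
    pair K′ t t + ∑ t (λ a → ∑ t (λ b → sg (dir b) * ev (∂ (U (axis′ b) (base′ b))) a)) + ∑ t (λ a → ∑ t (λ b → sg (dir a) * ev (∂ (V (axis′ a) (base′ a))) b))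
      ≡⟨ cong₂ (λ p q → pair K′ t t + p + q)
           (trans (∑-swap t t _) (∑-cong t λ b _ → trans (∑-* t (sg (dir b)) _) (cong (sg (dir b) *_) (∑-ev-∂ t (U (axis′ b) (base′ b))))))
           (∑-cong t λ a _ → trans (∑-* t (sg (dir a)) _) (cong (sg (dir a) *_) (∑-ev-∂ t (V (axis′ a) (base′ a))))) ⟩
    pair K′ t t + ∑ t (ev (λ j c → bd t (U j c))) + ∑ t (ev (λ i c → bd t (V i c))) ∎
    where
    open ≡-Reasoning
    l : ∀ s s′ k u v → s * (s′ * (k + u + v)) ≡ s * (s′ * k) + s′ * (s * u) + s * (s′ * v)
    l = solve-∀
    term : ∀ {a b} → a ∈ t → b ∈ t → ev² K a b ≡ ev² K′ a b
      + sg (dir b) * ev (∂ (U (axis′ b) (base′ b))) a + sg (dir a) * ev (∂ (V (axis′ a) (base′ a))) b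
    term {a} {b} a∈ b∈ = trans (cong (λ w → sg (dir a) * (sg (dir b) * w)) (identity a∈ b∈)) (l (sg (dir a)) (sg (dir b)) _ _ _)

module Vertical (l : ℤ) (D : List Sq) (N : ℕ) {t : List Domino} (T : IsTiling (InCyl (cyl az l D N)) t) where
  private
    C = cyl az l D N
    fills = cylinder-fills C T
    D′ = deduplicate _≟Sq_ D
    above below : Cube → ℤ
    above b = εsum C (λ c → dd (x c) (x b) * dd (y c) (y b) * θ (z c) (z b))
    below a = εsum C (λ c → dd (x a + + 1) (x c) * dd (y a) (y c) * θ (z a) (z c))
    abovePart belowPart : Form
    abovePart ax c = above c
    abovePart _ c = + 0
    belowPart ax c = below c
    belowPart _ c = + 0

    double : ∀ h → εsum C (λ c → + 2 * h c) ≡ + 2 * εsum C h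
    double h = trans (∑-cong (cellsOf C) λ c _ → r (ε c) (h c)) (∑-* (cellsOf C) (+ 2) _)
      where
      r : ∀ e a → e * (+ 2 * a) ≡ + 2 * (e * a)
      r = solve-∀

    vanish : - εsum C (λ _ → + 0) ≡ + 0
    vanish = cong -_ (∑-zero (cellsOf C) λ c _ → ℤP.*-zeroʳ (ε c))

    -- The columns through the two cubes of a y-arrow are reflected into each other. So y-arrows
    -- leave no remainder, and the parity argument concerns x-arrows only.
    strip-y : ∀ b (g : ℤ → ℤ) → InCyl C b → InCyl C (up ay b) →
      - εsum C (λ c → - (dd (x c) (x b) * mm (y c) (y b) * g (z c))) ≡ + 0
    strip-y b g b∈ u∈ = cong -_ (trans (εsum-neg C (λ c → dd (x c) (x b) * mm (y c) (y b) * g (z c)))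
      (cong -_ (εsum-strip l D N (x b) (y b) (z b) g λ { _ (inj₁ refl) → b∈ ; _ (inj₂ refl) → u∈ })))

    bd-upper : ∀ i b → InCyl C b → InCyl C (up i b) → bd t (overhead i b) ≡ - (+ 2) * abovePart i b
    bd-upper ax b _ _ = trans (fills (overhead ax b))
      (trans (cong -_ (double λ c → dd (x c) (x b) * dd (y c) (y b) * θ (z c) (z b))) (ℤP.neg-distribˡ-* (+ 2) (above b)))
    bd-upper ay b b∈ u∈ = trans (fills (overhead ay b)) (strip-y b (λ k → θ k (z b)) b∈ u∈)
    bd-upper az b _ _ = trans (fills (overhead az b)) vanish

    bd-lower : ∀ i a → InCyl C a → InCyl C (up i a) → bd t (beneath i a) ≡ - (+ 2) * belowPart i a
    bd-lower ax a _ _ = trans (fills (beneath ax a))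
      (trans (cong -_ (double λ c → dd (x a + + 1) (x c) * dd (y a) (y c) * θ (z a) (z c))) (ℤP.neg-distribˡ-* (+ 2) (below a)))
    bd-lower ay a a∈ u∈ = trans (fills (beneath ay a))
      (trans (cong -_ (∑-cong (cellsOf C) λ c _ → cong (λ w → ε c * - (w * mm (y c) (y a) * θ (z a) (z c))) (dd-sym (x c) (x a))))
             (strip-y a (θ (z a)) a∈ u∈))
    bd-lower az a _ _ = trans (fills (beneath az a)) vanish

    D′-single : ∀ {p q} → (p , q) ∈ D → ∀ w → ∑ D′ (λ s → dd (proj₁ s) p * dd (proj₂ s) q * w) ≡ w
    D′-single {p} {q} m w = trans (∑-single (DecUniqueP.deduplicate-! _≟Sq_ D) (∈-deduplicate⁺ _≟Sq_ m)
        (λ s → dd (proj₁ s) p * dd (proj₂ s) q * w) off)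
      (trans (cong₂ (λ a b → a * b * w) (dd-refl p) (dd-refl q)) (r w))
      where
      r : ∀ w → + 1 * + 1 * w ≡ w
      r = solve-∀
      off : ∀ s → s ≢ (p , q) → dd (proj₁ s) p * dd (proj₂ s) q * w ≡ + 0
      off (a , b) n with dd-cases a p | dd-cases b q
      ... | inj₁ e | _ rewrite e = refl
      ... | inj₂ _ | inj₁ e rewrite e | ℤP.*-zeroʳ (dd a p) = refl
      ... | inj₂ (_ , refl) | inj₂ (_ , refl) = ⊥-elim (n refl)

    column-parity : ∀ {p q} → (p , q) ∈ D → ∀ (w : ℤ → ℤ) →
      εsum C (λ c → dd (x c) p * dd (y c) q * w (z c)) ≈₂ ∑ (heights l N) w
    column-parity {p} {q} m w = ≈₂-trans
      (∑-≈₂ (cellsOf C) {g = λ c → + 1 * (dd (x c) p * dd (y c) q * w (z c))} (λ c _ → ≈₂-*ʳ (dd (x c) p * dd (y c) q * w (z c)) (ε≈₂1 c)))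
      (≈₂-reflexive (trans (∑-cong (cellsOf C) λ c _ → ℤP.*-identityˡ _)
        (trans (∑-product (emb az) (heights l N) D′ _) (∑-cong (heights l N) λ k _ → D′-single m (w k)))))

    θ-total : ∀ p q → θ q p + θ p q ≡ + 1 - dd p q
    θ-total p q = trans (cong (λ w → tI w + tI (p - q)) (sub-swap p q)) (go (p - q))
      where
      sub-swap : ∀ p q → q - p ≡ - (p - q)
      sub-swap = solve-∀
      go : ∀ n → tI (- n) + tI n ≡ + 1 - dI n
      go (+ 0) = refl
      go (+ suc k) = refl
      go -[1+ k ] = refl

    -- Modulo 2 the colours disappear, and the cubes above the arrow in one column together with
    -- those below it in the other fill all layers but one.
    columns-parity : ∀ b → InCyl C b → InCyl C (up ax b) → above b + below b ≈₂ + N - + 1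
    columns-parity b b∈ u∈ = ≈₂-trans (≈₂-+ (column-parity (proj₁ b∈) (λ k → θ k (z b)))
        (≈₂-trans (≈₂-reflexive (∑-cong (cellsOf C) λ c _ → cong (ε c *_) (cong₂ (λ p q → p * q * θ (z b) (z c)) (dd-sym (x c) (x b + + 1)) (dd-sym (y c) (y b)))))
                  (column-parity (proj₁ u∈) (θ (z b)))))
      (≈₂-reflexive (begin
        ∑ (heights l N) (λ k → θ k (z b)) + ∑ (heights l N) (θ (z b))     ≡⟨ sym (∑-+ (heights l N) _ _) ⟩
        ∑ (heights l N) (λ k → θ k (z b) + θ (z b) k)                     ≡⟨ ∑-cong (heights l N) (λ k _ → θ-total (z b) k) ⟩
        ∑ (heights l N) (λ k → + 1 - dd (z b) k)                          ≡⟨ ∑-- (heights l N) _ _ ⟩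
        ∑ (heights l N) (λ _ → + 1) - ∑ (heights l N) (dd (z b))          ≡⟨ cong₂ _-_ (trans (∑-const l N (+ 1)) (ℤP.*-identityʳ (+ N)))
             (trans (∑-cong (heights l N) λ k _ → sym (ℤP.*-identityʳ _)) (∑-pick (heights-unique l N) (∈-heights⁺ (proj₁ (proj₂ b∈)) (proj₂ (proj₂ b∈))) (λ _ → + 1))) ⟩
        + N - + 1 ∎))
      where open ≡-Reasoning

    moment-parity : εsum C x ≈₂ + N * ∑ D′ proj₁
    moment-parity = ≈₂-trans (∑-≈₂ (cellsOf C) {g = λ c → + 1 * x c} (λ c _ → ≈₂-*ʳ (x c) (ε≈₂1 c)))
      (≈₂-reflexive (trans (∑-cong (cellsOf C) λ c _ → ℤP.*-identityˡ _)
        (trans (∑-product (emb az) (heights l N) D′ x) (∑-const l N _))))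

    along-x : ∀ s i c → (i ≡ ax → InCyl C c × InCyl C (up ax c)) →
      s * (abovePart i c + belowPart i c) ≈₂ (+ N - + 1) * (s * ∂ x i c)
    along-x s ax c m = ≈₂-trans (≈₂-* s (columns-parity c (proj₁ (m refl)) (proj₂ (m refl)))) (≈₂-reflexive (r s (+ N) (x c)))
      where
      r : ∀ s n a → s * (n - + 1) ≡ (n - + 1) * (s * (a + + 1 - a))
      r = solve-∀
    along-x s ay c m = ≈₂-reflexive (r s (+ N) (x c))
      where
      r : ∀ s n a → s * + 0 ≡ (n - + 1) * (s * (a - a))
      r = solve-∀
    along-x s az c m = ≈₂-reflexive (r s (+ N) (x c))
      where
      r : ∀ s n a → s * + 0 ≡ (n - + 1) * (s * (a - a))
      r = solve-∀

    -- Modulo 2 every x-arrow contributes `N - 1` times its sign, so the total is `N - 1` times the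
    -- boundary of the tiling on the coordinate function `x`. That boundary is a multiple of `N`
    -- modulo 2, since all layers have the same sum of x-coordinates, and `N (N - 1)` is even.
    even-part : ∑ t (ev (λ i c → abovePart i c + belowPart i c)) ≈₂ + 0
    even-part = ≈₂-trans (∑-≈₂ t λ d m → along-x (sg (dir d)) (axis′ d) (base′ d) λ e →
        tiling-inside T m (covers-base d) , tiling-inside T m (covers-up′ d e))
      (≈₂-trans (≈₂-reflexive (trans (∑-* t (+ N - + 1) _) (cong ((+ N - + 1) *_) (trans (∑-ev-∂ t x) (fills x)))))
      (≈₂-trans (≈₂-* (+ N - + 1) (≈₂-trans (≈₂-reflexive (r (εsum C x))) (≈₂-* (- + 1) moment-parity)))
      (≈₂-trans (≈₂-reflexive (r′ (+ N) (∑ D′ proj₁))) (≈₂-trans (≈₂-* (- ∑ D′ proj₁) (consecutive-even N)) (≈₂-reflexive (ℤP.*-zeroʳ (- ∑ D′ proj₁)))))))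
      where
      r : ∀ a → - a ≡ - + 1 * a
      r = solve-∀
      r′ : ∀ n a → (n - + 1) * (- + 1 * (n * a)) ≡ - a * (n * (n - + 1))
      r′ = solve-∀

  private
    quarters : Σ ℤ λ k → pair KB t t ≡ + 4 * k
    quarters = L - half , (begin
     pair KB t t
       ≡⟨ Boundary.pair-boundary KB (λ i a j b → + 4 * KL i a j b + contact i a j b) overhead beneath t (λ {a} {b} _ _ → trans (KB-KL (axis′ a) (base′ a) (axis′ b) (base′ b)) (r₀ (KL (axis′ a) (base′ a) (axis′ b) (base′ b)) (∂ (overhead (axis′ b) (base′ b)) (axis′ a) (base′ a)) (∂ (beneath (axis′ a) (base′ a)) (axis′ b) (base′ b)) (contact (axis′ a) (base′ a) (axis′ b) (base′ b)))) ⟩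
     pair (λ i a j b → + 4 * KL i a j b + contact i a j b) t t + ∑ t (ev (λ j c → bd t (overhead j c))) + ∑ t (ev (λ i c → bd t (beneath i c)))
       ≡⟨ cong₂ _+_ (cong₂ _+_ (trans (∑-cong t λ a a∈ → trans (∑-cong t λ b b∈ → four a∈ b∈) (∑-* t (+ 4) (ev² KL a))) (∑-* t (+ 4) (λ a → ∑ t (ev² KL a))))
            (part overhead abovePart bd-upper)) (part beneath belowPart bd-lower) ⟩
     + 4 * L + - (+ 2) * ∑ t (ev abovePart) + - (+ 2) * ∑ t (ev belowPart)
       ≡⟨ r₁ L (∑ t (ev abovePart)) (∑ t (ev belowPart)) ⟩
     + 4 * L - + 2 * (∑ t (ev abovePart) + ∑ t (ev belowPart))
       ≡⟨ cong (λ w → + 4 * L - + 2 * w) (trans (sym (trans (∑-cong t λ d _ → ev-+ abovePart belowPart d) (∑-+ t (ev abovePart) (ev belowPart)))) difference) ⟩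
     + 4 * L - + 2 * (+ 0 + + 2 * half)
       ≡⟨ r₂ L half ⟩
     + 4 * (L - half) ∎)
     where
     open _≈₂_ even-part
     open ≡-Reasoning
     L = pair KL t t
     r₀ : ∀ k u v c → + 4 * k + u + v + c ≡ + 4 * k + c + u + v
     r₀ = solve-∀
     r₁ : ∀ a b c → + 4 * a + - (+ 2) * b + - (+ 2) * c ≡ + 4 * a - + 2 * (b + c)
     r₁ = solve-∀
     r₂ : ∀ a k → + 4 * a - + 2 * (+ 0 + + 2 * k) ≡ + 4 * (a - k)
     r₂ = solve-∀
     r₃ : ∀ s s′ k → s * (s′ * (+ 4 * k + + 0)) ≡ + 4 * (s * (s′ * k))
     r₃ = solve-∀
     four : ∀ {a b} → a ∈ t → b ∈ t → ev² (λ i a j b → + 4 * KL i a j b + contact i a j b) a b ≡ + 4 * ev² KL a b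
     four {a} {b} a∈ b∈ = trans (cong (λ w → sg (dir a) * (sg (dir b) * (+ 4 * KL (axis′ a) (base′ a) (axis′ b) (base′ b) + w))) (contact-zero T a∈ b∈))
       (r₃ (sg (dir a)) (sg (dir b)) (KL (axis′ a) (base′ a) (axis′ b) (base′ b)))
     r₄ : ∀ s a → s * (- (+ 2) * a) ≡ - (+ 2) * (s * a)
     r₄ = solve-∀
     part : ∀ (W : Axis → Cube → Cube → ℤ) (P : Form) → (∀ i b → InCyl C b → InCyl C (up i b) → bd t (W i b) ≡ - (+ 2) * P i b) →
       ∑ t (ev (λ i c → bd t (W i c))) ≡ - (+ 2) * ∑ t (ev P)
     part W P h = trans (∑-cong t λ d m → trans (cong (sg (dir d) *_) (h (axis′ d) (base′ d) (tiling-inside T m (covers-base d)) (tiling-inside T m (covers-up d))))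
       (r₄ (sg (dir d)) (P (axis′ d) (base′ d)))) (∑-* t (- (+ 2)) (ev P))

  abstract
    integral : Σ ℤ λ k → pair KB t t ≡ + 4 * k
    integral = quarters

-- Reference chains

-- From here on `Domino` also serves as the type of arbitrary arrows: the first cube of a reversed
-- domino is its black one.
rev : Domino → Domino
rev d = dom (bc d) (opp (dir d))

bc-rev : ∀ d → bc (rev d) ≡ wc d
bc-rev d = ⊕-opp (wc d) (dir d)

covers-rev : ∀ d {c} → Covers (rev d) c → Covers d c
covers-rev d (inj₁ e) = inj₂ e
covers-rev d (inj₂ e) = inj₁ (trans e (bc-rev d))

ev-rev : ∀ ℓ d → ev ℓ (rev d) ≡ - ev ℓ d
ev-rev ℓ d = go (dir d) refl
  where
  l : ∀ a → - + 1 * a ≡ - (+ 1 * a)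
  l = solve-∀
  l′ : ∀ a → + 1 * a ≡ - (- + 1 * a)
  l′ = solve-∀
  go : ∀ δ → dir d ≡ δ → ev ℓ (rev (dom (wc d) δ)) ≡ - ev ℓ (dom (wc d) δ)
  go +x refl = trans (cong (λ c → - + 1 * ℓ ax c) (bc-rev d)) (l _)
  go -x refl = l′ _
  go +y refl = trans (cong (λ c → - + 1 * ℓ ay c) (bc-rev d)) (l _)
  go -y refl = l′ _
  go +z refl = trans (cong (λ c → - + 1 * ℓ az c) (bc-rev d)) (l _)
  go -z refl = l′ _

∑-rev : ∀ ℓ f → ∑ (map rev f) (ev ℓ) ≡ - ∑ f (ev ℓ)
∑-rev ℓ f = trans (∑-map rev f (ev ℓ)) (trans (∑-cong f λ d _ → ev-rev ℓ d) (∑-neg f (ev ℓ)))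

-- The chain `f` together with the reversed `g` is closed and stays in the cylinder.
exact-fills : ∀ C → IsCylinder C → ∀ ℓ → ClosedOn (InCyl C) ℓ → ∀ L f g → Fills L f → Fills L g →
  Inside (InCyl C) f → Inside (InCyl C) g → ∑ f (ev ℓ) ≡ ∑ g (ev ℓ)
exact-fills C cyl-C ℓ closed L f g F G inf ing = ℤP.i-j≡0⇒i≡j (∑ f (ev ℓ)) (∑ g (ev ℓ))
  (trans (sym (difference ℓ)) (exact C cyl-C ℓ closed (f ++ map rev g) inside closed-chain))
  where
  difference : ∀ ℓ → ∑ (f ++ map rev g) (ev ℓ) ≡ ∑ f (ev ℓ) - ∑ g (ev ℓ)
  difference ℓ = trans (∑-++ f (map rev g) (ev ℓ)) (+-congˡ (∑ f (ev ℓ)) (∑-rev ℓ g))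
  closed-chain : Closed (f ++ map rev g)
  closed-chain h = trans (sym (∑-ev-∂ (f ++ map rev g) h)) (trans (difference (∂ h))
    (ℤP.i≡j⇒i-j≡0 (trans (trans (∑-ev-∂ f h) (F h)) (sym (trans (∑-ev-∂ g h) (G h))))))
  inside : Inside (InCyl C) (f ++ map rev g)
  inside m k with ∈-++⁻ f m
  ... | inj₁ a = inf a k
  ... | inj₂ b with ∈-map⁻ rev b
  ... | d , d∈ , refl = ing d∈ (covers-rev d k)

private
  upDir : Axis → Dir
  upDir i = orient (+ 1) i
  downDir : Axis → Dir
  downDir i = opp (upDir i)

  ⊕-upDir : ∀ i c → c ⊕ vec (upDir i) ≡ up i c
  ⊕-upDir ax c = ⊕-unit ax c
  ⊕-upDir ay c = ⊕-unit ay c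
  ⊕-upDir az c = ⊕-unit az c

  ⊕-downDir : ∀ i c → up i c ⊕ vec (downDir i) ≡ c
  ⊕-downDir i c = trans (cong (_⊕ vec (downDir i)) (sym (⊕-upDir i c))) (⊕-opp c (upDir i))

  emb-up : ∀ i k s → emb i (k + + 1) s ≡ up i (emb i k s)
  emb-up ax k s = refl
  emb-up ay k s = refl
  emb-up az k s = refl

column : Axis → ℤ → Sq → ℕ → List Domino
column i l s zero = []
column i l s (suc n) = dom (emb i (l + + n + + 1) s) (downDir i) ∷ column i l s n

bd-column : ∀ i l s n h → bd (column i l s n) h ≡ h (emb i l s) - h (emb i (l + + n) s)
bd-column i l s zero h = sym (trans (cong (λ w → h (emb i l s) - h (emb i w s)) (ℤP.+-identityʳ l)) (ℤP.+-inverseʳ (h (emb i l s))))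
bd-column i l s (suc n) h = trans (cong₂ _+_ (cong₂ (λ p q → h p - h q) lower-end upper-end) (bd-column i l s n h))
  (r (h (emb i (l + + n) s)) (h (emb i (l + + suc n) s)) (h (emb i l s)))
  where
  lower-end : bc (dom (emb i (l + + n + + 1) s) (downDir i)) ≡ emb i (l + + n) s
  lower-end = trans (cong (_⊕ vec (downDir i)) (emb-up i (l + + n) s)) (⊕-downDir i (emb i (l + + n) s))
  r₀ : ∀ l n → l + n + + 1 ≡ l + (+ 1 + n)
  r₀ = solve-∀
  upper-end : emb i (l + + n + + 1) s ≡ emb i (l + + suc n) s
  upper-end = cong (λ w → emb i w s) (r₀ l (+ n))
  r : ∀ a b c → a - b + (c - a) ≡ c - b
  r = solve-∀

column-covers : ∀ i l s n {d c} → d ∈ column i l s n → Covers d c → Σ ℕ λ m → m ℕ.≤ n × c ≡ emb i (l + + m) s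
column-covers i l s (suc n) (here refl) (inj₁ refl) = suc n , ℕP.≤-refl , cong (λ w → emb i w s) (r l (+ n))
  where
  r : ∀ l n → l + n + + 1 ≡ l + (+ 1 + n)
  r = solve-∀
column-covers i l s (suc n) (here refl) (inj₂ refl) = n , ℕP.n≤1+n n , trans (cong (_⊕ vec (downDir i)) (emb-up i (l + + n) s)) (⊕-downDir i (emb i (l + + n) s))
column-covers i l s (suc n) (there m) k with column-covers i l s n m k
... | j , j≤ , e = j , ℕP.≤-trans j≤ (ℕP.n≤1+n n) , e

column-axis : ∀ i l s n {d} → d ∈ column i l s n → axis′ d ≡ i
column-axis ax l s (suc n) (here refl) = refl
column-axis ay l s (suc n) (here refl) = refl
column-axis az l s (suc n) (here refl) = refl
column-axis i l s (suc n) (there m) = column-axis i l s n m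

private
  axes₁ axes₂ : Axis → Axis
  axes₁ ax = ay
  axes₁ ay = ax
  axes₁ az = ax
  axes₂ ax = az
  axes₂ ay = az
  axes₂ az = ay

  step-dir : ∀ {s s′} → SqAdj s s′ → Axis → Dir
  step-dir (inj₁ (_ , inj₁ _)) i = upDir (axes₂ i)
  step-dir (inj₁ (_ , inj₂ _)) i = downDir (axes₂ i)
  step-dir (inj₂ (_ , inj₁ _)) i = upDir (axes₁ i)
  step-dir (inj₂ (_ , inj₂ _)) i = downDir (axes₁ i)

  emb₁ : ∀ i k a b → emb i k (a + + 1 , b) ≡ up (axes₁ i) (emb i k (a , b))
  emb₁ ax k a b = refl
  emb₁ ay k a b = refl
  emb₁ az k a b = refl

  emb₂ : ∀ i k a b → emb i k (a , b + + 1) ≡ up (axes₂ i) (emb i k (a , b))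
  emb₂ ax k a b = refl
  emb₂ ay k a b = refl
  emb₂ az k a b = refl

  step-end : ∀ {s s′} (a : SqAdj s s′) i k → emb i k s ⊕ vec (step-dir a i) ≡ emb i k s′
  step-end {a , b} (inj₁ (refl , inj₁ refl)) i k = trans (⊕-upDir (axes₂ i) _) (sym (emb₂ i k a b))
  step-end {_} {a , b} (inj₁ (refl , inj₂ refl)) i k = trans (cong (_⊕ vec (downDir (axes₂ i))) (emb₂ i k a b)) (⊕-downDir (axes₂ i) _)
  step-end {a , b} (inj₂ (refl , inj₁ refl)) i k = trans (⊕-upDir (axes₁ i) _) (sym (emb₁ i k a b))
  step-end {_} {a , b} (inj₂ (refl , inj₂ refl)) i k = trans (cong (_⊕ vec (downDir (axes₁ i))) (emb₁ i k a b)) (⊕-downDir (axes₁ i) _)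

planarPath : Axis → ℤ → ∀ {P s s′} → Conn P s s′ → List Domino
planarPath i k (here _) = []
planarPath i k (step {s = s} _ a c) = dom (emb i k s) (step-dir a i) ∷ planarPath i k c

bd-planarPath : ∀ i k {P s s′} (c : Conn P s s′) h → bd (planarPath i k c) h ≡ h (emb i k s′) - h (emb i k s)
bd-planarPath i k {s = s} (here _) h = sym (ℤP.+-inverseʳ (h (emb i k s)))
bd-planarPath i k (step {s} {s′} {s″} _ a c) h = trans (cong₂ _+_ (cong (λ p → h p - h (emb i k s)) (step-end a i k)) (bd-planarPath i k c h))
  (r (h (emb i k s′)) (h (emb i k s)) (h (emb i k s″)))
  where
  r : ∀ a b c → a - b + (c - a) ≡ c - b
  r = solve-∀

conn-start : ∀ {P s s′} → Conn P s s′ → P s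
conn-start (here p) = p
conn-start (step p _ _) = p

planarPath-covers : ∀ i k {P s s′} (c : Conn P s s′) {d q} → d ∈ planarPath i k c → Covers d q → Σ Sq λ s → P s × q ≡ emb i k s
planarPath-covers i k (step p a c) (here refl) (inj₁ refl) = _ , p , refl
planarPath-covers i k (step p a c) (here refl) (inj₂ refl) = _ , conn-start c , step-end a i k
planarPath-covers i k (step p a c) (there m) q = planarPath-covers i k c m q

module Reference (C : Cylinder) (cyl-C : IsCylinder C) where
  private
    i = axis C
    l = level C
    D = base C
    N = depth C
    N≥1 = proj₂ cyl-C
    connected = proj₁ (proj₂ (proj₁ cyl-C))

    a-square : ∀ D′ → D′ ≢ [] → Σ Sq (_∈ D′)
    a-square [] n = ⊥-elim (n refl)
    a-square (s ∷ _) n = s , here refl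

    s₀ = proj₁ (a-square D (proj₁ (proj₁ cyl-C)))
    s₀∈ = proj₂ (a-square D (proj₁ (proj₁ cyl-C)))

  -- Membership is decided so that the path becomes a function of the square alone. Cubes in a line
  -- along the axis then share it, as their cancellation under a reflection along the axis requires.
  toBase : Sq → List Domino
  toBase s with DecMembership._∈?_ _≟Sq_ s D
  ... | yes m = planarPath i l (connected s s₀ m s₀∈)
  ... | no _ = []

  private
    bd-toBase : ∀ {s} → s ∈ D → ∀ h → bd (toBase s) h ≡ h (emb i l s₀) - h (emb i l s)
    bd-toBase {s} m h with DecMembership._∈?_ _≟Sq_ s D
    ... | yes m′ = bd-planarPath i l (connected s s₀ m′ s₀∈) h
    ... | no n = ⊥-elim (n m)

  toBase-covers : ∀ s {d q} → d ∈ toBase s → Covers d q → Σ Sq λ s → s ∈ D × q ≡ emb i l s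
  toBase-covers s m k with DecMembership._∈?_ _≟Sq_ s D
  ... | yes m′ = planarPath-covers i l (connected s s₀ m′ s₀∈) m k

  private
    fall : Cube → List Domino
    fall c = column i l (proj i c) ∣ along i c - l ∣

    height : ∀ {c} → InCyl C c → l + + ∣ along i c - l ∣ ≡ along i c
    height {c} (_ , a , _) = trans (cong (λ w → l + w) (ℤP.0≤i⇒+∣i∣≡i (ℤP.i≤j⇒0≤j-i a))) (r l (along i c))
      where
      r : ∀ l a → l + (a - l) ≡ a
      r = solve-∀

    path : Cube → List Domino
    path c = fall c ++ toBase (proj i c)

    bd-path : ∀ {c} → InCyl C c → ∀ h → bd (path c) h ≡ h (emb i l s₀) - h c
    bd-path {c} c∈ h = trans (bd-++ (fall c) (toBase (proj i c)) h)
      (trans (cong₂ _+_ (trans (bd-column i l (proj i c) ∣ along i c - l ∣ h) (cong (λ q → h (emb i l (proj i c)) - h q) top)) (bd-toBase (proj₁ c∈) h))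
             (r (h (emb i l (proj i c))) (h c) (h (emb i l s₀))))
      where
      top : emb i (l + + ∣ along i c - l ∣) (proj i c) ≡ c
      top = trans (cong (λ w → emb i w (proj i c)) (height c∈)) (emb-split i c)
      r : ∀ a b c → a - b + (c - a) ≡ c - b
      r = solve-∀

    signed : ℤ → List Domino → List Domino
    signed (+ _) f = f
    signed -[1+ _ ] f = map rev f

    ∑-signed : ∀ c f ℓ → ∑ (signed (ε c) f) (ev ℓ) ≡ ε c * ∑ f (ev ℓ)
    ∑-signed c f ℓ with ⌊ ∣ x c + y c + z c ∣ ℕ.% 2 ℕ.≟ 0 ⌋
    ... | true = sym (ℤP.*-identityˡ _)
    ... | false = trans (∑-rev ℓ f) (r (∑ f (ev ℓ)))
      where
      r : ∀ a → - a ≡ - + 1 * a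
      r = solve-∀

    signed-covers : ∀ s f {d c} → d ∈ signed s f → Covers d c → Σ Domino λ e → e ∈ f × Covers e c
    signed-covers (+ _) f m k = _ , m , k
    signed-covers -[1+ _ ] f m k with ∈-map⁻ rev m
    ... | e , e∈ , refl = e , e∈ , covers-rev e k

  -- Every cube is joined to one fixed bottom cube, first straight along the axis and then inside
  -- the bottom layer, and the path is taken with the colour of the cube as its sign. The
  -- contributions at the fixed cube cancel if there are as many white cubes as black ones, and the
  -- boundary is then that of a tiling.
  reference : List Domino
  reference = concatMap (λ c → signed (ε c) (path c)) (cellsOf C)

  ∑-reference : ∀ ℓ → ∑ reference (ev ℓ) ≡ εsum C (λ c → ∑ (path c) (ev ℓ))
  ∑-reference ℓ = trans (∑-concatMap (λ c → signed (ε c) (path c)) (cellsOf C) (ev ℓ)) (∑-cong (cellsOf C) λ c _ → ∑-signed c (path c) ℓ)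

  reference-fills : εsum C (λ _ → + 1) ≡ + 0 → Fills (cellsOf C) reference
  reference-fills balanced h = begin
    bd reference h                                     ≡⟨ sym (∑-ev-∂ reference h) ⟩
    ∑ reference (ev (∂ h))                             ≡⟨ ∑-reference (∂ h) ⟩
    ∑ (cellsOf C) (λ c → ε c * ∑ (path c) (ev (∂ h)))  ≡⟨ ∑-cong (cellsOf C) (λ c m → trans (cong (ε c *_) (trans (∑-ev-∂ (path c) h) (bd-path (∈-cellsOf⁻ C m) h))) (r (ε c) (h (emb i l s₀)) (h c))) ⟩
    ∑ (cellsOf C) (λ c → h (emb i l s₀) * (ε c * + 1) - ε c * h c) ≡⟨ ∑-- (cellsOf C) (λ c → h (emb i l s₀) * (ε c * + 1)) (λ c → ε c * h c) ⟩
    ∑ (cellsOf C) (λ c → h (emb i l s₀) * (ε c * + 1)) - εsum C h  ≡⟨ cong (_- εsum C h) (trans (∑-* (cellsOf C) (h (emb i l s₀)) (λ c → ε c * + 1)) (trans (cong (h (emb i l s₀) *_) balanced) (ℤP.*-zeroʳ (h (emb i l s₀))))) ⟩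
    + 0 - εsum C h                                     ≡⟨ ℤP.+-identityˡ _ ⟩
    - εsum C h ∎
    where
    open ≡-Reasoning
    r : ∀ e a b → e * (a - b) ≡ a * (e * + 1) - e * b
    r = solve-∀

  reference-inside : Inside (InCyl C) reference
  reference-inside m k with find-concat (cellsOf C) m
    where
    find-concat : ∀ L {d} → d ∈ concatMap (λ c → signed (ε c) (path c)) L → Σ Cube λ c → c ∈ L × d ∈ signed (ε c) (path c)
    find-concat (c ∷ L) m with ∈-++⁻ (signed (ε c) (path c)) m
    ... | inj₁ a = c , here refl , a
    ... | inj₂ b with find-concat L b
    ... | c′ , c′∈ , q = c′ , there c′∈ , q
  ... | c , c∈ , m′ with signed-covers (ε c) (path c) m′ k
  ... | e , e∈ , k′ with ∈-++⁻ (fall c) e∈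
  ... | inj₁ a with column-covers i l (proj i c) ∣ along i c - l ∣ a k′
  ...   | j , j≤ , refl = subst (_∈ D) (sym (proj-emb i _ _)) (proj₁ inC) ,
          subst (l ℤ.≤_) (sym (along-emb i _ _)) (ℤP.i≤i+j l (+ j)) ,
          subst (ℤ._< l + + N) (sym (along-emb i _ _)) (ℤP.≤-<-trans (ℤP.≤-trans (ℤP.+-monoʳ-≤ l (ℤ.+≤+ j≤)) (ℤP.≤-reflexive (height inC))) (proj₂ (proj₂ inC)))
    where inC = ∈-cellsOf⁻ C c∈
  reference-inside m k | c , c∈ , m′ | e , e∈ , k′ | inj₂ b with toBase-covers (proj i c) b k′
  ...   | s , s∈ , refl = subst (_∈ D) (sym (proj-emb i _ _)) s∈ ,
          subst (l ℤ.≤_) (sym (along-emb i _ _)) ℤP.≤-refl ,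
          subst (ℤ._< l + + N) (sym (along-emb i _ _)) (subst (ℤ._< l + + N) (ℤP.+-identityʳ l) (ℤP.+-monoʳ-< l (ℤ.+<+ N≥1)))

  -- The straight parts of the paths are parallel to the axis, where the form vanishes.
  ∑-reference-planar : ∀ ℓ → (∀ c → ℓ i c ≡ + 0) → ∑ reference (ev ℓ) ≡ εsum C (λ c → ∑ (toBase (proj i c)) (ev ℓ))
  ∑-reference-planar ℓ zero-along = trans (∑-reference ℓ) (∑-cong (cellsOf C) λ c _ → cong (ε c *_)
    (trans (∑-++ (fall c) (toBase (proj i c)) (ev ℓ)) (trans (cong (_+ ∑ (toBase (proj i c)) (ev ℓ)) (∑-zero (fall c) (λ d m → none c m))) (ℤP.+-identityˡ _))))
    where
    none : ∀ c {d} → d ∈ fall c → ev ℓ d ≡ + 0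
    none c {d} m = trans (cong (sg (dir d) *_) (trans (cong (λ j → ℓ j (base′ d)) (column-axis i l (proj i c) ∣ along i c - l ∣ m)) (zero-along (base′ d)))) (ℤP.*-zeroʳ (sg (dir d)))

tiling-balanced : ∀ C {t} → IsTiling (InCyl C) t → εsum C (λ _ → + 1) ≡ + 0
tiling-balanced C {t} T = trans (sym (ℤP.neg-involutive _)) (cong -_ (trans (sym (cylinder-fills C T (λ _ → + 1))) (∑-zero t λ _ _ → refl)))

closed-when : ∀ {R : Region} ℓ →
  (∀ c → (∀ q → Face ax ay c q → R q) → curl ℓ ax ay c ≡ + 0) →
  (∀ c → (∀ q → Face ax az c q → R q) → curl ℓ ax az c ≡ + 0) →
  (∀ c → (∀ q → Face ay az c q → R q) → curl ℓ ay az c ≡ + 0) → ClosedOn R ℓ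
closed-when {R} ℓ p q r i j c i≢j a b d e = go i j faces
  where
  faces : ∀ s → Face i j c s → R s
  faces _ f₀₀ = a
  faces _ f₁₀ = b
  faces _ f₀₁ = d
  faces _ f₁₁ = e
  flip : ∀ i j → (∀ s → Face i j c s → R s) → ∀ s → Face j i c s → R s
  flip i j h s f = h s (Face-swap f)
  go : ∀ i j → (∀ s → Face i j c s → R s) → curl ℓ i j c ≡ + 0
  go ax ax h = curl-diagonal ℓ ax c
  go ay ay h = curl-diagonal ℓ ay c
  go az az h = curl-diagonal ℓ az c
  go ax ay h = p c h
  go ax az h = q c h
  go ay az h = r c h
  go ay ax h = trans (curl-swap ℓ ax ay c) (cong -_ (p c (flip ay ax h)))
  go az ax h = trans (curl-swap ℓ ax az c) (cong -_ (q c (flip az ax h)))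
  go az ay h = trans (curl-swap ℓ ay az c) (cong -_ (r c (flip az ay h)))

-- Turning the direction of projection

pair-perm : ∀ π K f g → pair K (map (permD π) f) (map (permD π) g)
  ≡ pair (λ i a j b → K (pa π i) (pc π a) (pa π j) (pc π b)) f g
pair-perm π K f g = trans (∑-map (permD π) f _) (∑-cong f λ a _ → trans (∑-map (permD π) g _) (∑-cong g λ b _ → both a b))
  where
  both : ∀ a b → ev² K (permD π a) (permD π b) ≡ ev² (λ i c j c′ → K (pa π i) (pc π c) (pa π j) (pc π c′)) a b
  both a b = trans (ev-perm π (λ i c → ev (K i c) (permD π b)) a) (cong (sg (dir a) *_) (ev-perm π (K (pa π (axis′ a)) (pc π (base′ a))) b))

-- The linking kernel for projection along x, obtained by rotating the one for z.
KSx : Kernel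
KSx i a j b = KS (pa rot i) (pc rot a) (pa rot j) (pc rot b)

-- The solid swept by an arrow parallel to the y-axis while the direction of projection turns
-- from x to z; its differential is the difference of the two linking kernels.
sweep : Axis → Cube → Cube → ℤ
sweep ay b c = ss (x c) (x b) * ss (z c) (z b) * mm (y c) (y b)
sweep _ b c = + 0

private
  KS-KSx : ∀ i a j b → KS i a j b ≡ KSx i a j b + ∂ (sweep j b) i a + ∂ (sweep i a) j b
  KS-KSx ax a ax b = refl
  KS-KSx ax a az b = refl
  KS-KSx az a ax b = refl
  KS-KSx az a az b = refl
  KS-KSx ax a ay b rewrite ss-up (x a) (x b) | ss-θ (z a) (z b) = l (ss (x a) (x b)) (mm (x b) (x a)) (mm (y a) (y b)) (θ (z a) (z b)) (θ (z b) (z a))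
    where
    l : ∀ s m n t t′ → m * n * t + - (m * n * t′) ≡ + 0 + ((s + m) * (t - t′) * n - s * (t - t′) * n) + (+ 0 - + 0)
    l = solve-∀
  KS-KSx ay a ax b rewrite ss-up (x b) (x a) | ss-anti (z a) (z b) | ss-θ (z a) (z b) = l (ss (x b) (x a)) (mm (x a) (x b)) (mm (y b) (y a)) (θ (z a) (z b)) (θ (z b) (z a))
    where
    l : ∀ s m n t t′ → - (m * n * t) + m * n * t′ ≡ + 0 + (+ 0 - + 0) + ((s + m) * - (t - t′) * n - s * - (t - t′) * n)
    l = solve-∀
  KS-KSx az a ay b rewrite ss-up (z a) (z b) | ss-θ (x a) (x b) = l (ss (z a) (z b)) (mm (z b) (z a)) (mm (y a) (y b)) (θ (x a) (x b)) (θ (x b) (x a))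
    where
    l : ∀ s m n t t′ → + 0 ≡ - (n * m * t) + n * m * t′ + ((t - t′) * (s + m) * n - (t - t′) * s * n) + (+ 0 - + 0)
    l = solve-∀
  KS-KSx ay a az b rewrite ss-up (z b) (z a) | ss-anti (x a) (x b) | ss-θ (x a) (x b) = l (ss (z b) (z a)) (mm (z a) (z b)) (mm (y b) (y a)) (θ (x a) (x b)) (θ (x b) (x a))
    where
    l : ∀ s m n t t′ → + 0 ≡ n * m * t + - (n * m * t′) + (+ 0 - + 0) + (- (t - t′) * (s + m) * n - - (t - t′) * s * n)
    l = solve-∀
  KS-KSx ay a ay b rewrite ss-anti (x a) (x b) | ss-anti (z a) (z b) | mm-flip (y a) (y b) | mm-flip (y b) (y a) =
    l (ss (x a) (x b)) (ss (z a) (z b)) (mm (y a) (y b)) (mm (y b) (y a))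
    where
    l : ∀ p q m n → + 0 ≡ + 0 + (p * q * n - p * q * m) + (- p * - q * m - - p * - q * n)
    l = solve-∀

  double-cancel : ∀ {a b} → a + a ≡ b + b → a ≡ b
  double-cancel {a} {b} e = ℤP.*-cancelˡ-≡ (+ 2) a b (trans (l a) (trans e (sym (l b))))
    where
    l : ∀ a → + 2 * a ≡ a + a
    l = solve-∀

  par-cases : ∀ n → par n ≡ + 1 ⊎ par n ≡ - + 1
  par-cases n with ⌊ ∣ n ∣ ℕ.% 2 ℕ.≟ 0 ⌋
  ... | true = inj₁ refl
  ... | false = inj₂ refl

module AlongX (l : ℤ) (D : List Sq) (N : ℕ) (cyl-C : IsCylinder (cyl ax l D N))
  {t : List Domino} (T : IsTiling (InCyl (cyl ax l D N)) t) where
  private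
    C = cyl ax l D N
    fills = cylinder-fills C T

    -- Up to sign, the boundary of the tiling on the solid swept by an arrow, as a 1-form in this
    -- arrow. It depends on the cylinder alone.
    H : Form
    H ay b = εsum C (sweep ay b)
    H _ b = + 0

    bd-sweep : ∀ j b → bd t (sweep j b) ≡ - H j b
    bd-sweep ax b = ∑-zero t λ _ _ → refl
    bd-sweep ay b = fills (sweep ay b)
    bd-sweep az b = ∑-zero t λ _ _ → refl

    εsum-- : ∀ f g → εsum C f - εsum C g ≡ εsum C (λ c → f c - g c)
    εsum-- f g = trans (sym (∑-- (cellsOf C) (λ c → ε c * f c) (λ c → ε c * g c))) (∑-cong (cellsOf C) λ c _ → r (ε c) (f c) (g c))
      where
      r : ∀ e a b → e * a - e * b ≡ e * (a - b)
      r = solve-∀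

    -- Moving a y-arrow sideways changes its swept solid by a column over a horizontal square, or by
    -- a row of cubes through a vertical one. In both, the colours cancel because the square lies in
    -- the cylinder.
    H-closed : ClosedOn (InCyl C) H
    H-closed = closed-when H xy-face (λ _ _ → refl) yz-face
      where
      xy-face : ∀ c → (∀ q → Face ax ay c q → InCyl C q) → curl H ax ay c ≡ + 0
      xy-face c face = trans (r (εsum C (sweep ay (up ax c))) (εsum C (sweep ay c)))
        (trans (εsum-- (sweep ay (up ax c)) (sweep ay c))
        (trans (∑-cong (cellsOf C) λ q _ → cong (ε q *_) (pointwise q))
        (trans (εsum-neg C (λ q → mm (x q) (x c) * mm (y q) (y c) * ss (z q) (z c)))
               (cong -_ (εsum-column C (x c) (y c) (z c) (λ k → ss k (z c)) corner)))))
        where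
        r : ∀ a b → + 0 + a - + 0 - b ≡ a - b
        r = solve-∀
        r′ : ∀ s m k n → (s - m) * k * n - s * k * n ≡ - (m * n * k)
        r′ = solve-∀
        pointwise : ∀ q → sweep ay (up ax c) q - sweep ay c q ≡ - (mm (x q) (x c) * mm (y q) (y c) * ss (z q) (z c))
        pointwise q = trans (cong (λ w → w * ss (z q) (z c) * mm (y q) (y c) - sweep ay c q) (ss-upʳ (x q) (x c)))
          (r′ (ss (x q) (x c)) (mm (x q) (x c)) (ss (z q) (z c)) (mm (y q) (y c)))
        corner : ∀ p q → p ∈₂ x c → q ∈₂ y c → InCyl C (v3 p q (z c))
        corner _ _ (inj₁ refl) (inj₁ refl) = face _ f₀₀
        corner _ _ (inj₁ refl) (inj₂ refl) = face _ f₀₁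
        corner _ _ (inj₂ refl) (inj₁ refl) = face _ f₁₀
        corner _ _ (inj₂ refl) (inj₂ refl) = face _ f₁₁
      yz-face : ∀ c → (∀ q → Face ay az c q → InCyl C q) → curl H ay az c ≡ + 0
      yz-face c face = trans (r (εsum C (sweep ay c)) (εsum C (sweep ay (up az c))))
        (trans (εsum-- (sweep ay c) (sweep ay (up az c)))
        (trans (∑-cong (cellsOf C) λ q _ → cong (ε q *_) (pointwise q))
               (εsum-side l D N (y c) (z c) (x c) (λ k → ss k (x c)) corner)))
        where
        r : ∀ a b → a + + 0 - b - + 0 ≡ a - b
        r = solve-∀
        r′ : ∀ s m k n → s * k * n - s * (k - m) * n ≡ s * n * m
        r′ = solve-∀
        pointwise : ∀ q → sweep ay c q - sweep ay (up az c) q ≡ ss (x q) (x c) * mm (y q) (y c) * mm (z q) (z c)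
        pointwise q = trans (cong (λ w → sweep ay c q - ss (x q) (x c) * w * mm (y q) (y c)) (ss-upʳ (z q) (z c)))
          (r′ (ss (x q) (x c)) (mm (z q) (z c)) (ss (z q) (z c)) (mm (y q) (y c)))
        corner : ∀ p q → p ∈₂ y c → q ∈₂ z c → InCyl C (v3 (x c) p q)
        corner _ _ (inj₁ refl) (inj₁ refl) = face _ f₀₀
        corner _ _ (inj₁ refl) (inj₂ refl) = face _ f₀₁
        corner _ _ (inj₂ refl) (inj₁ refl) = face _ f₁₀
        corner _ _ (inj₂ refl) (inj₂ refl) = face _ f₁₁

    module Ref = Reference C cyl-C

    par-end : ∀ m → par (l + (l + m)) ≡ par m
    par-end m = trans (par-+ l (l + m)) (trans (cong (par l *_) (par-+ l m)) (trans (sym (ℤP.*-assoc (par l) (par l) (par m)))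
      (trans (cong (_* par m) (par-square l)) (ℤP.*-identityˡ (par m)))))

    reflect-< : ∀ {a b k} → a ℤ.< b → k - b ℤ.< k - a
    reflect-< {k = k} h = ℤP.+-monoʳ-< k (ℤP.neg-mono-< h)
    reflect-≤ : ∀ {a b k} → a ℤ.≤ b → k - b ℤ.≤ k - a
    reflect-≤ {k = k} h = ℤP.+-monoʳ-≤ k (ℤP.neg-mono-≤ h)

    ss-one : ∀ {p q} → q ℤ.< p → ss p q ≡ + 1
    ss-one {p} {q} h = trans (ss-θ p q) (cong₂ _-_ (θ-one h) (θ-zero (ℤP.<⇒≤ h)))

    -- The layers are even in number and cancel under reflection.
    reference-even : par (+ N) ≡ + 1 → ∑ Ref.reference (ev H) ≡ + 0
    reference-even even = trans (Ref.∑-reference-planar H (λ _ → refl))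
      (εsum-mirror C ax k (trans (par-end (+ N - + 1)) (trans (par-dn (+ N)) (cong -_ even))) (λ c → ∑ (Ref.toBase (proj ax c)) (ev H))
        λ c c∈ _ → (proj₁ c∈ , low (proj₂ (proj₂ c∈)) , high (proj₁ (proj₂ c∈))) , refl)
      where
      k = l + (l + (+ N - + 1))
      r₁ : ∀ l n → l + (l + (n - + 1)) - (l + (n - + 1)) ≡ l
      r₁ = solve-∀
      r₂ : ∀ l n → l + (l + (n - + 1)) - l ≡ l + (n - + 1)
      r₂ = solve-∀
      r₃ : ∀ l n → l + (n - + 1) + + 1 ≡ l + n
      r₃ = solve-∀
      low : ∀ {a} → a ℤ.< l + + N → l ℤ.≤ k - a
      low {a} h = subst (ℤ._≤ k - a) (r₁ l (+ N)) (reflect-≤ {k = k} (<+1⇒≤ (subst (a ℤ.<_) (sym (r₃ l (+ N))) h)))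
      high : ∀ {a} → l ℤ.≤ a → k - a ℤ.< l + + N
      high {a} h = subst (k - a ℤ.<_) (r₃ l (+ N)) (ℤP.≤-<-trans (reflect-≤ {k = k} h) (subst (ℤ._< l + (+ N - + 1) + + 1) (sym (r₂ l (+ N))) (i<i+1 _)))

    -- The layers above the lowest one are even in number and cancel under reflection.
    H-bottom : par (+ N) ≡ - + 1 → ∀ i c → x c ≡ l → H i c ≡ + 0
    H-bottom odd-N ax c e = refl
    H-bottom odd-N az c e = refl
    -- The bottom layer has weight 0 and every layer above it has sign 1 relative to it, so a
    -- reflection of the upper layers preserves the value.
    H-bottom odd-N ay c refl = εsum-mirror C ax k (trans (par-end (+ N)) odd-N) (sweep ay c) λ q q∈ n →
      let l<q = ℤP.≤∧≢⇒< (proj₁ (proj₂ q∈)) (λ e → *-nonzeroˡ {b = ss (z q) (z c)} (*-nonzeroˡ n) (self e)) in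
      (proj₁ q∈ , ℤP.<⇒≤ (above (proj₂ (proj₂ q∈))) , below l<q) ,
      cong (λ w → w * ss (z q) (z c) * mm (y q) (y c)) (trans (ss-one (above (proj₂ (proj₂ q∈)))) (sym (ss-one l<q)))
      where
      k = l + (l + + N)
      self : ∀ {a} → l ≡ a → ss a l ≡ + 0
      self refl = cong sI (ℤP.+-inverseʳ l)
      r₁ : ∀ l n → l + (l + n) - (l + n) ≡ l
      r₁ = solve-∀
      r₂ : ∀ l n → l + (l + n) - l ≡ l + n
      r₂ = solve-∀
      above : ∀ {a} → a ℤ.< l + + N → l ℤ.< k - a
      above {a} h = subst (ℤ._< k - a) (r₁ l (+ N)) (reflect-< {k = k} h)
      below : ∀ {a} → l ℤ.< a → k - a ℤ.< l + + N
      below {a} h = subst (k - a ℤ.<_) (r₂ l (+ N)) (reflect-< {k = k} h)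

    reference-odd : par (+ N) ≡ - + 1 → ∑ Ref.reference (ev H) ≡ + 0
    reference-odd odd-N = trans (Ref.∑-reference-planar H (λ _ → refl)) (∑-zero (cellsOf C) λ c _ →
      trans (cong (ε c *_) (∑-zero (Ref.toBase (proj ax c)) λ d m → at-bottom d (Ref.toBase-covers (proj ax c) m (covers-base d)))) (ℤP.*-zeroʳ (ε c)))
      where
      at-bottom : ∀ d → Σ Sq (λ s → s ∈ D × base′ d ≡ emb ax l s) → ev H d ≡ + 0
      at-bottom d (_ , _ , e) = trans (cong (sg (dir d) *_) (H-bottom odd-N (axis′ d) (base′ d) (cong x e))) (ℤP.*-zeroʳ (sg (dir d)))

    -- A closed form has the same sum over the tiling as over the reference chain, whose symmetry
    -- along the axis makes the sum computable.
    H-total : ∑ t (ev H) ≡ + 0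
    H-total = trans (exact-fills C cyl-C H H-closed (cellsOf C) t Ref.reference fills (Ref.reference-fills (tiling-balanced C T))
        (tiling-inside T) Ref.reference-inside) (go (par-cases (+ N)))
      where
      go : par (+ N) ≡ + 1 ⊎ par (+ N) ≡ - + 1 → ∑ Ref.reference (ev H) ≡ + 0
      go (inj₁ e) = reference-even e
      go (inj₂ e) = reference-odd e

    sweep-total : ∑ t (ev (λ j c → bd t (sweep j c))) ≡ + 0
    sweep-total = trans (∑-cong t λ d _ → trans (cong (sg (dir d) *_) (bd-sweep (axis′ d) (base′ d))) (sym (ℤP.neg-distribʳ-* (sg (dir d)) (H (axis′ d) (base′ d)))))
      (trans (∑-neg t (ev H)) (cong -_ H-total))

  -- On equal arguments `KS` is twice `KB`, so it suffices to compare the linking kernels of the two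
  -- projections.
  pair-rot : pair KB t t ≡ pair KB (map (permD rot) t) (map (permD rot) t)
  pair-rot = double-cancel (trans (sym (pair-KS t t)) (trans same (pair-KS t′ t′)))
    where
    t′ = map (permD rot) t
    same : pair KS t t ≡ pair KS t′ t′
    same = trans (Boundary.pair-boundary KS KSx sweep sweep t (λ {a} {b} _ _ → KS-KSx (axis′ a) (base′ a) (axis′ b) (base′ b)))
      (trans (cong₂ (λ p q → pair KSx t t + p + q) sweep-total sweep-total)
      (trans (trans (ℤP.+-identityʳ (pair KSx t t + + 0)) (ℤP.+-identityʳ (pair KSx t t))) (sym (pair-perm rot KS t t))))

-- Exchanging x and y is a reflection that keeps the direction of projection, so every crossing
-- changes its sign.
pair-xy : ∀ t → pair KB (map (permD xy) t) (map (permD xy) t) ≡ - pair KB t t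
pair-xy t = trans (pair-perm xy KB t t) (trans (∑-cong t λ a _ → trans (∑-cong t λ b _ → term a b) (∑-neg t (ev² KB a))) (∑-neg t _))
  where
  KB-xy : ∀ i a j b → KB (pa xy i) (pc xy a) (pa xy j) (pc xy b) ≡ - KB i a j b
  KB-xy ax a ay b = l (mm (x b) (x a)) (mm (y a) (y b)) (θ (z a) (z b))
    where
    l : ∀ m n t → - (n * m * t) ≡ - (m * n * t)
    l = solve-∀
  KB-xy ay a ax b = l (mm (x a) (x b)) (mm (y b) (y a)) (θ (z a) (z b))
    where
    l : ∀ m n t → n * m * t ≡ - - (m * n * t)
    l = solve-∀
  KB-xy ax a ax b = refl
  KB-xy ax a az b = refl
  KB-xy ay a ay b = refl
  KB-xy ay a az b = refl
  KB-xy az a ax b = refl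
  KB-xy az a ay b = refl
  KB-xy az a az b = refl
  l : ∀ s t k → s * (t * - k) ≡ - (s * (t * k))
  l = solve-∀
  term : ∀ a b → ev² (λ i c j c′ → KB (pa xy i) (pc xy c) (pa xy j) (pc xy c′)) a b ≡ - ev² KB a b
  term a b = trans (cong (λ w → sg (dir a) * (sg (dir b) * w)) (KB-xy (axis′ a) (base′ a) (axis′ b) (base′ b)))
    (l (sg (dir a)) (sg (dir b)) (KB (axis′ a) (base′ a) (axis′ b) (base′ b)))

private
  integral-x : ∀ l D N → IsCylinder (cyl ax l D N) → ∀ t → IsTiling (InCyl (cyl ax l D N)) t → Σ ℤ λ k → pair KB t t ≡ + 4 * k
  integral-x l D N cyl-C t T = proj₁ k , trans (AlongX.pair-rot l D N cyl-C T) (proj₂ k)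
    where k = Vertical.integral l D N (tiling-perm rot {R′ = InCyl (cyl az l D N)} (λ _ h → h) (λ _ h → h) T)

integral : ∀ C → IsCylinder C → ∀ t → IsTiling (InCyl C) t → Σ ℤ λ k → pair KB t t ≡ + 4 * k
integral (cyl az l D N) _ t T = Vertical.integral l D N T
integral (cyl ax l D N) cyl-C t T = integral-x l D N cyl-C t T
integral (cyl ay l D N) cyl-C t T = - proj₁ k ,
  trans (sym (ℤP.neg-involutive _)) (trans (cong -_ (trans (sym (pair-xy t)) (proj₂ k))) (ℤP.neg-distribʳ-* (+ 4) (proj₁ k)))
  where k = integral-x l D N cyl-C (map (permD xy) t) (tiling-perm xy {R′ = InCyl (cyl ax l D N)} (λ _ h → h) (λ _ h → h) T)

-- Duplex regions

flatKernel groundKernel : Kernel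
flatKernel ax a ay b = mm (x b) (x a) * mm (y a) (y b)
flatKernel ay a ax b = - (mm (x a) (x b) * mm (y b) (y a))
flatKernel _ _ _ _ = + 0
groundKernel i a j b = flatKernel i a j b * dd (z b) (+ 0)

private
  flat-antisym : ∀ i a j b → flatKernel j b i a ≡ - flatKernel i a j b
  flat-antisym ax a ay b = refl
  flat-antisym ay a ax b = sym (ℤP.neg-involutive _)
  flat-antisym ax a ax b = refl
  flat-antisym ax a az b = refl
  flat-antisym ay a ay b = refl
  flat-antisym ay a az b = refl
  flat-antisym az a ax b = refl
  flat-antisym az a ay b = refl
  flat-antisym az a az b = refl

  KB-flat : ∀ i a j b → KB i a j b ≡ flatKernel i a j b * θ (z a) (z b)
  KB-flat ax a ay b = refl
  KB-flat ay a ax b = ℤP.neg-distribˡ-* (mm (x a) (x b) * mm (y b) (y a)) (θ (z a) (z b))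
  KB-flat ax a ax b = refl
  KB-flat ax a az b = refl
  KB-flat ay a ay b = refl
  KB-flat ay a az b = refl
  KB-flat az a ax b = refl
  KB-flat az a ay b = refl
  KB-flat az a az b = refl

  flat-ground : ∀ i a j b → flatKernel i a j b ≡ flatKernel i (v3 (x a) (y a) (+ 0)) j b
  flat-ground ax a ay b = refl
  flat-ground ay a ax b = refl
  flat-ground ax a ax b = refl
  flat-ground ax a az b = refl
  flat-ground ay a ay b = refl
  flat-ground ay a az b = refl
  flat-ground az a ax b = refl
  flat-ground az a ay b = refl
  flat-ground az a az b = refl

  pair-antisym : ∀ K t → (∀ i a j b → K j b i a ≡ - K i a j b) → pair K t t ≡ + 0
  pair-antisym K t anti = ≡-neg⇒0 (trans (pair-∑ K t t) (trans (∑-cong t λ b _ → trans (∑-cong t λ a _ → term a b) (∑-neg t (ev² K b))) (∑-neg t _)))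
    where
    l : ∀ s s′ k → s * (s′ * - k) ≡ - (s′ * (s * k))
    l = solve-∀
    term : ∀ a b → ev² K a b ≡ - ev² K b a
    term a b = trans (cong (λ w → sg (dir a) * (sg (dir b) * w)) (anti (axis′ b) (base′ b) (axis′ a) (base′ a))) (l (sg (dir a)) (sg (dir b)) _)

  two-levels : ∀ {k} → + 0 ℤ.≤ k → k ℤ.< + 2 → k ≡ + 0 ⊎ k ≡ + 1
  two-levels {+ 0} _ _ = inj₁ refl
  two-levels {+ 1} _ _ = inj₂ refl
  two-levels {+ suc (suc n)} _ (ℤ.+<+ (ℕ.s≤s (ℕ.s≤s ())))

block : ℤ → ℤ → Cube → ℤ
block p q c = mm (x c) p * mm (y c) q * dd (z c) (+ 0)

-- What remains of the curl of the ground crossings once the differential of `block` is split off: a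
-- vertical arrow rising from the ground inside the block counts once.
jewels : ℤ → ℤ → Form
jewels p q az b = mm (x b) p * mm (y b) q * (dd (z b) (+ 0) - dd (z b + + 1) (+ 0))
jewels p q _ b = + 0

private
  ground-curl : ∀ p q j b → curl (λ i c → groundKernel i c j b) ax ay (v3 p q (+ 0)) ≡ ∂ (block p q) j b + jewels p q j b
  ground-curl p q ax b rewrite mm-flip p (x b) | mm-flip (x b) p = l (mm (x b) p) (mm p (x b)) (mm (y b) q) (dd (z b) (+ 0))
    where
    l : ∀ m m′ n d → + 0 + - (m * n) * d - + 0 - - (m′ * n) * d ≡ m′ * n * d - m * n * d + + 0
    l = solve-∀
  ground-curl p q ay b rewrite mm-flip q (y b) | mm-flip (y b) q = l (mm (x b) p) (mm (y b) q) (mm q (y b)) (dd (z b) (+ 0))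
    where
    l : ∀ m n n′ d → m * n′ * d + + 0 - m * n * d - + 0 ≡ m * n′ * d - m * n * d + + 0
    l = solve-∀
  ground-curl p q az b = l (mm (x b) p * mm (y b) q) (dd (z b) (+ 0)) (dd (z b + + 1) (+ 0))
    where
    l : ∀ m d d′ → + 0 ≡ m * d′ - m * d + m * (d - d′)
    l = solve-∀

abstract
  -- The range gets an extra row and column on the lower side, because the corners of the square
  -- `(a , b)` carry the indices `a - 1`, `a` and `b - 1`, `b`.
  square-with-margin : ∀ (D : List Sq) → Σ ℤ λ lo → Σ ℕ λ n → ∀ {a b} → (a , b) ∈ D →
    (a ∈ heights lo n × a - + 1 ∈ heights lo n) × (b ∈ heights lo n × b - + 1 ∈ heights lo n)
  square-with-margin D with in-square D
  ... | l , n , range = l - + 1 , suc n , λ m → extend (proj₁ (range m)) , extend (proj₂ (range m))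
    where
    r₁ : ∀ k → k - + 1 + + 1 ≡ k
    r₁ = solve-∀
    r₂ : ∀ l n → l - + 1 + (+ 1 + n) ≡ l + n
    r₂ = solve-∀
    below : ∀ k → k - + 1 ℤ.< k
    below k = subst (k - + 1 ℤ.<_) (r₁ k) (i<i+1 (k - + 1))
    extend : ∀ {k} → k ∈ heights l n → k ∈ heights (l - + 1) (suc n) × k - + 1 ∈ heights (l - + 1) (suc n)
    extend {k} m with ∈-heights⁻ {l} {n} m
    ... | a , b = ∈-heights⁺ (ℤP.≤-trans (ℤP.<⇒≤ (below l)) a) top , ∈-heights⁺ (ℤP.+-monoˡ-≤ (- + 1) a) (ℤP.<-trans (below k) top)
      where
      top : k ℤ.< l - + 1 + + suc n
      top = subst (k ℤ.<_) (sym (r₂ l (+ n))) b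

module Duplex (D : List Sq) (cb : IsCylBase D) {t : List Domino} (T : IsTiling (InCyl (duplex D)) t) where
  private
    C = duplex D
    fills = cylinder-fills C T

    inside : Inside (InCyl C) t
    inside = tiling-inside T

    level-of : ∀ {c} → InCyl C c → z c ≡ + 0 ⊎ z c ≡ + 1
    level-of (_ , a , b) = two-levels a b

    base-level : ∀ {d} → d ∈ t → z (base′ d) ≡ + 0 ⊎ z (base′ d) ≡ + 1
    base-level {d} m = level-of (inside m (covers-base d))

    -- The two cubes over a square have opposite colours, and reflection in the middle plane
    -- exchanges them.
    flat-closed : FlatClosed t
    flat-closed H = trans (fills (λ c → H (x c) (y c))) (cong -_ (εsum-mirror C az (+ 1) refl (λ c → H (x c) (y c)) λ c c∈ _ →
      (proj₁ c∈ , other c (level-of c∈)) , refl))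
      where
      other : ∀ c → z c ≡ + 0 ⊎ z c ≡ + 1 → + 0 ℤ.≤ + 1 - z c × + 1 - z c ℤ.< + 0 + + 2
      other c (inj₁ refl) = ℤ.+≤+ ℕ.z≤n , ℤ.+<+ (ℕ.s≤s (ℕ.s≤s ℕ.z≤n))
      other c (inj₂ refl) = ℤ.+≤+ ℕ.z≤n , ℤ.+<+ (ℕ.s≤s ℕ.z≤n)

    J : PForm
    J i p q = form groundKernel t i (v3 p q (+ 0))

    bothGround : Kernel
    bothGround i a j b = flatKernel i a j b * (dd (z a) (+ 0) * dd (z b) (+ 0))

    θ-ground : ∀ {p q} → p ≡ + 0 ⊎ p ≡ + 1 → q ≡ + 0 ⊎ q ≡ + 1 → θ p q ≡ dd q (+ 0) - dd p (+ 0) * dd q (+ 0)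
    θ-ground (inj₁ refl) (inj₁ refl) = refl
    θ-ground (inj₁ refl) (inj₂ refl) = refl
    θ-ground (inj₂ refl) (inj₁ refl) = refl
    θ-ground (inj₂ refl) (inj₂ refl) = refl

    -- With two layers, `θ` is the indicator that the lower arrow lies on the ground minus the
    -- indicator that both arrows do. The second part gives an antisymmetric kernel, whose pairing
    -- of the tiling with itself is 0.
    pair-ground : pair KB t t ≡ ∑ t (ev (planar J))
    pair-ground = begin
      pair KB t t
        ≡⟨ ∑-cong t (λ a a∈ → trans (∑-cong t λ b b∈ → term a∈ b∈) (∑-- t (ev² groundKernel a) (ev² bothGround a))) ⟩
      ∑ t (λ a → ∑ t (ev² groundKernel a) - ∑ t (ev² bothGround a))
        ≡⟨ ∑-- t (λ a → ∑ t (ev² groundKernel a)) (λ a → ∑ t (ev² bothGround a)) ⟩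
      pair groundKernel t t - pair bothGround t t
        ≡⟨ cong₂ _-_ (trans (pair-form groundKernel t t) (∑-cong t λ a _ → cong (sg (dir a) *_) (∑-cong t λ b _ → cong (λ w → sg (dir b) * (w * dd (z (base′ b)) (+ 0))) (flat-ground (axis′ a) (base′ a) (axis′ b) (base′ b)))))
             (pair-antisym bothGround t λ i a j b → trans (cong (_* (dd (z b) (+ 0) * dd (z a) (+ 0))) (flat-antisym i a j b)) (r′ (flatKernel i a j b) (dd (z a) (+ 0)) (dd (z b) (+ 0)))) ⟩
      ∑ t (ev (planar J)) - + 0
        ≡⟨ ℤP.+-identityʳ _ ⟩
      ∑ t (ev (planar J)) ∎
      where
      open ≡-Reasoning
      r′ : ∀ k p q → - k * (q * p) ≡ - (k * (p * q))
      r′ = solve-∀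
      r : ∀ s s′ k p q → s * (s′ * (k * (q - p * q))) ≡ s * (s′ * (k * q)) - s * (s′ * (k * (p * q)))
      r = solve-∀
      term : ∀ {a b} → a ∈ t → b ∈ t → ev² KB a b ≡ ev² groundKernel a b - ev² bothGround a b
      term {a} {b} a∈ b∈ = trans (cong (λ w → sg (dir a) * (sg (dir b) * w)) (trans (KB-flat (axis′ a) (base′ a) (axis′ b) (base′ b))
          (cong (flatKernel (axis′ a) (base′ a) (axis′ b) (base′ b) *_) (θ-ground (base-level a∈) (base-level b∈)))))
        (r (sg (dir a)) (sg (dir b)) (flatKernel (axis′ a) (base′ a) (axis′ b) (base′ b)) (dd (z (base′ a)) (+ 0)) (dd (z (base′ b)) (+ 0)))

    J-az : ∀ p q → J az p q ≡ + 0
    J-az p q = ∑-zero t λ d _ → trans (cong (sg (dir d) *_) (none (axis′ d) (base′ d))) (ℤP.*-zeroʳ (sg (dir d)))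
      where
      none : ∀ j b → groundKernel az (v3 p q (+ 0)) j b ≡ + 0
      none ax b = refl
      none ay b = refl
      none az b = refl

    lo = proj₁ (square-with-margin D)
    n = proj₁ (proj₂ (square-with-margin D))
    D-range = proj₂ (proj₂ (square-with-margin D))
    rng = heights lo n

    wind : ℤ → ℤ → ℤ
    wind = windAt t

    wind-in : ∀ p q → wind p q ≢ + 0 → ∀ p′ q′ → p′ ∈₂ p → q′ ∈₂ q → (p′ , q′) ∈ D
    wind-in = wind-block D (proj₂ (proj₂ cb)) t flat-closed (λ m k → proj₁ (inside m k)) (lo + + n)
      (λ m → proj₂ (∈-heights⁻ {lo} {n} (proj₁ (proj₁ (D-range m)))))

    jewelSum : ℤ → ℤ → ℤ
    jewelSum p q = ∑ t (ev (jewels p q))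

    -- Where the winding number is nonzero, the block of four squares lies in `D`, so the boundary
    -- of the tiling on it cancels.
    curl-jewels : ∀ p q → wind p q * pcurl J p q ≡ wind p q * jewelSum p q
    curl-jewels p q = go (wind p q ℤP.≟ + 0)
      where
      split : pcurl J p q ≡ bd t (block p q) + jewelSum p q
      split = trans (curl-form groundKernel t ax ay (v3 p q (+ 0)))
        (trans (∑-cong t λ d _ → trans (cong (sg (dir d) *_) (ground-curl p q (axis′ d) (base′ d))) (ev-+ (∂ (block p q)) (jewels p q) d))
        (trans (∑-+ t (ev (∂ (block p q))) (ev (jewels p q))) (cong (_+ jewelSum p q) (∑-ev-∂ t (block p q)))))
      go : Dec (wind p q ≡ + 0) → wind p q * pcurl J p q ≡ wind p q * jewelSum p q
      go (yes e) = trans (cong (_* pcurl J p q) e) (sym (cong (_* jewelSum p q) e))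
      go (no nz) = cong (wind p q *_) (trans split (trans (cong (_+ jewelSum p q) (trans (fills (block p q))
          (cong -_ (εsum-column C p q (+ 0) (λ k → dd k (+ 0)) λ a b α β → wind-in p q nz a b α β , ℤP.≤-refl , ℤ.+<+ (ℕ.s≤s ℕ.z≤n)))))
        (ℤP.+-identityˡ (jewelSum p q))))

    jewel-level : ∀ {d} → d ∈ t → axis′ d ≡ az → z (base′ d) ≡ + 0
    jewel-level {d} m e with base-level m | proj₂ (proj₂ (inside m (covers-up′ d e)))
    ... | inj₁ h | _ = h
    ... | inj₂ h | top = ⊥-elim (ℤP.<-irrefl refl (subst (λ w → w + + 1 ℤ.< + 2) h top))

    -- A vertical domino fills both cubes over its square and leaves no room for a horizontal one.
    untouched : ∀ {d} → d ∈ t → axis′ d ≡ az → Untouched t (x (base′ d)) (y (base′ d))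
    untouched {d} m e e∈ (na , c , k , xe , ye) = na (trans (cong axis′ (tiling-overlap T e∈ m k (here-covers (level-of (inside e∈ k))))) e)
      where
      here-covers : z c ≡ + 0 ⊎ z c ≡ + 1 → Covers d c
      here-covers (inj₁ h) = subst (Covers d) (sym (V3-≡ xe ye (trans h (sym (jewel-level m e))))) (covers-base d)
      here-covers (inj₂ h) = subst (Covers d) (sym (V3-≡ xe ye (trans h (sym (cong (_+ + 1) (jewel-level m e)))))) (covers-up′ d e)

    Weight : Form
    Weight az c = wind (x c) (y c)
    Weight _ c = + 0

    pick₂ : ∀ (φ : ℤ → ℤ) {w} → w ∈ rng → w - + 1 ∈ rng → ∑ rng (λ p → mm w p * φ p) ≡ φ w + φ (w - + 1)
    pick₂ φ {w} a b = trans (∑-cong rng λ p _ → trans (cong (_* φ p) (trans (mm-split w p) (+-congˡ (dd w p) (cong dI (r₁ w p))))) (r₂ (dd w p) (dd (w - + 1) p) (φ p)))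
      (trans (∑-+ rng _ _) (cong₂ _+_ (∑-pick (heights-unique lo n) a φ) (∑-pick (heights-unique lo n) b φ)))
      where
      r₁ : ∀ w p → w - (p + + 1) ≡ w - + 1 - p
      r₁ = solve-∀
      r₂ : ∀ a b c → (a + b) * c ≡ a * c + b * c
      r₂ = solve-∀

    -- No curve meets the square of a jewel, so its four corners have the same winding number. This
    -- is the origin of the factor 4.
    corners : ∀ {d} → d ∈ t → axis′ d ≡ az → let p = x (base′ d) ; q = y (base′ d) in
      ∑ rng (λ a → ∑ rng (λ b → mm p a * (mm q b * wind a b))) ≡ + 4 * wind p q
    corners {d} m e = begin
      ∑ rng (λ a → ∑ rng (λ b → mm p a * (mm q b * wind a b)))
        ≡⟨ ∑-cong rng (λ a _ → trans (∑-* rng (mm p a) _) (cong (mm p a *_) (pick₂ (wind a) (proj₁ (proj₂ R)) (proj₂ (proj₂ R))))) ⟩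
      ∑ rng (λ a → mm p a * (wind a q + wind a (q - + 1)))
        ≡⟨ pick₂ (λ a → wind a q + wind a (q - + 1)) (proj₁ (proj₁ R)) (proj₂ (proj₁ R)) ⟩
      wind p q + wind p (q - + 1) + (wind (p - + 1) q + wind (p - + 1) (q - + 1))
        ≡⟨ cong₂ _+_ (cong (λ w → wind p q + w) (wind-below t flat-closed p p (inj₁ refl) (r₁ q) un))
             (cong₂ _+_ left (trans (wind-below t flat-closed (p - + 1) p (inj₂ (r₁ p)) (r₁ q) un) left)) ⟩
      wind p q + wind p q + (wind p q + wind p q)
        ≡⟨ r₂ (wind p q) ⟩
      + 4 * wind p q ∎
      where
      open ≡-Reasoning
      p = x (base′ d)
      q = y (base′ d)
      un = untouched m e
      R = D-range (proj₁ (inside m (covers-base d)))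
      r₁ : ∀ w → w ≡ w - + 1 + + 1
      r₁ = solve-∀
      r₂ : ∀ w → w + w + (w + w) ≡ + 4 * w
      r₂ = solve-∀
      left = wind-left t q (r₁ p) un

    jewel-value : ∀ {d} → d ∈ t → ∑ rng (λ p → ∑ rng (λ q → wind p q * ev (jewels p q) d)) ≡ + 4 * ev Weight d
    jewel-value {d} m = go (axis′ d) refl
      where
      s = sg (dir d)
      r₀ : ∀ w s → w * (s * + 0) ≡ + 0
      r₀ = solve-∀
      r₁ : ∀ s → + 4 * (s * + 0) ≡ + 0
      r₁ = solve-∀
      r₂ : ∀ w s m n k → k ≡ + 1 → w * (s * (m * n * k)) ≡ s * (m * (n * w))
      r₂ w s m n _ refl = r w s m n
        where
        r : ∀ w s m n → w * (s * (m * n * + 1)) ≡ s * (m * (n * w))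
        r = solve-∀
      r₃ : ∀ s w → s * (+ 4 * w) ≡ + 4 * (s * w)
      r₃ = solve-∀
      go : ∀ i → axis′ d ≡ i → ∑ rng (λ p → ∑ rng (λ q → wind p q * (s * jewels p q i (base′ d)))) ≡ + 4 * (s * Weight i (base′ d))
      go ax _ = trans (∑-zero rng λ p _ → ∑-zero rng λ q _ → r₀ (wind p q) s) (sym (r₁ s))
      go ay _ = trans (∑-zero rng λ p _ → ∑-zero rng λ q _ → r₀ (wind p q) s) (sym (r₁ s))
      go az e = trans (∑-cong rng λ p _ → trans (∑-cong rng λ q _ →
            r₂ (wind p q) s (mm (x (base′ d)) p) (mm (y (base′ d)) q) _ (cong (λ w → dd w (+ 0) - dd (w + + 1) (+ 0)) (jewel-level m e)))
          (∑-* rng s (λ q → mm (x (base′ d)) p * (mm (y (base′ d)) q * wind p q))))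
        (trans (∑-* rng s (λ p → ∑ rng (λ q → mm (x (base′ d)) p * (mm (y (base′ d)) q * wind p q))))
        (trans (cong (s *_) (corners m e)) (r₃ s (wind (x (base′ d)) (y (base′ d))))))

    base-range : ∀ {d} → d ∈ t → InRange lo n d
    base-range {d} m = proj₁ (proj₁ (D-range (proj₁ (inside m (covers-base d))))) , proj₁ (proj₂ (D-range (proj₁ (inside m (covers-base d)))))

    -- Over a square of colour 1 the ground cube is white and the jewel points up; over the others
    -- it points down. So the sign of the arrow is the colour of the square.
    weight-term : ∀ {d} → d ∈ t → ev Weight d ≡
      (if isVert d then sqColour (x (wc d)) (y (wc d)) * windAt t (x (wc d)) (y (wc d)) else + 0)
    weight-term {dom w +x} m = refl
    weight-term {dom w -x} m = refl
    weight-term {dom w +y} m = refl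
    weight-term {dom w -y} m = refl
    weight-term {dom w +z} m = cong (_* wind (x w) (y w)) (trans (sym (tiling-white T m)) (cong par (trans (cong (λ k → x w + y w + k) (jewel-level m refl)) (ℤP.+-identityʳ (x w + y w)))))
    weight-term {dom w -z} m = cong₂ _*_ colour (cong₂ wind (ℤP.+-identityʳ (x w)) (ℤP.+-identityʳ (y w)))
      where
      r : ∀ k → k ≡ k + - + 1 + + 1
      r = solve-∀
      top : z w ≡ + 1
      top = trans (r (z w)) (cong (_+ + 1) (jewel-level m refl))
      colour : - + 1 ≡ sqColour (x w) (y w)
      colour = trans (cong -_ (sym (tiling-white T m))) (trans (cong (λ k → - par (x w + y w + k)) top)
        (trans (cong -_ (par-up (x w + y w))) (ℤP.neg-involutive _)))

  pair-duplex : pair KB t t ≡ + 4 * Pderiv1 t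
  pair-duplex = begin
    pair KB t t
      ≡⟨ pair-ground ⟩
    ∑ t (ev (planar J))
      ≡⟨ stokes lo n t base-range flat-closed J J-az ⟩
    ∑ rng (λ p → ∑ rng (λ q → wind p q * pcurl J p q))
      ≡⟨ ∑-cong rng (λ p _ → ∑-cong rng λ q _ → trans (curl-jewels p q) (sym (∑-* t (wind p q) (ev (jewels p q))))) ⟩
    ∑ rng (λ p → ∑ rng (λ q → ∑ t (λ d → wind p q * ev (jewels p q) d)))
      ≡⟨ ∑-cong rng (λ p _ → ∑-swap rng t (λ q d → wind p q * ev (jewels p q) d)) ⟩
    ∑ rng (λ p → ∑ t (λ d → ∑ rng (λ q → wind p q * ev (jewels p q) d)))
      ≡⟨ ∑-swap rng t (λ p d → ∑ rng (λ q → wind p q * ev (jewels p q) d)) ⟩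
    ∑ t (λ d → ∑ rng (λ p → ∑ rng (λ q → wind p q * ev (jewels p q) d)))
      ≡⟨ ∑-cong t (λ d m → trans (jewel-value m) (cong (+ 4 *_) (weight-term m))) ⟩
    ∑ t (λ d → + 4 * (if isVert d then sqColour (x (wc d)) (y (wc d)) * windAt t (x (wc d)) (y (wc d)) else + 0))
      ≡⟨ ∑-* t (+ 4) _ ⟩
    + 4 * Pderiv1 t ∎
    where open ≡-Reasoning

-- Decomposition into cylinders

∉-++ : ∀ {A : Set} {xs ys : List A} → Unique (xs ++ ys) → ∀ {a} → a ∈ xs → a ∉ ys
∉-++ {xs = _ ∷ xs} (h ∷ u) (here refl) n = All.lookup h (∈-++⁺ʳ xs n) refl
∉-++ (h ∷ u) (there m) n = ∉-++ u m n

CoversIn : List Cube → List Domino → Set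
CoversIn L f = ∀ {d c} → d ∈ f → Covers d c → c ∈ L

Fills-++ : ∀ {L L′ f f′} → Fills L f → Fills L′ f′ → Fills (L ++ L′) (f ++ f′)
Fills-++ {L} {L′} {f} {f′} p q h = trans (bd-++ f f′ h) (trans (cong₂ _+_ (p h) (q h))
  (trans (sym (ℤP.neg-distrib-+ (∑ L (λ c → ε c * h c)) (∑ L′ (λ c → ε c * h c)))) (cong -_ (sym (∑-++ L L′ (λ c → ε c * h c))))))

CoversIn-++ : ∀ {L L′ f f′} → CoversIn L f → CoversIn L′ f′ → CoversIn (L ++ L′) (f ++ f′)
CoversIn-++ {L} {f = f} p q m k with ∈-++⁻ f m
... | inj₁ a = ∈-++⁺ˡ (p a k)
... | inj₂ b = ∈-++⁺ʳ L (q b k)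

-- Against a fixed filling of the complement of C′ in C, all fillings of C′ link alike.
linking-constant : ∀ C C′ → IsCylinder C′ → ∀ Lʳ rest → cellsOf C ↭ cellsOf C′ ++ Lʳ →
  Fills Lʳ rest → CoversIn Lʳ rest → ∀ f g → Fills (cellsOf C′) f → Fills (cellsOf C′) g →
  CoversIn (cellsOf C′) f → CoversIn (cellsOf C′) g → pair KS f rest ≡ pair KS g rest
linking-constant C C′ cyl-C′ Lʳ rest perm F I f g Ff Fg If Ig =
  trans (pair-form KS f rest) (trans (exact-fills C′ cyl-C′ (form KS rest) closed (cellsOf C′) f g Ff Fg
    (λ m k → ∈-cellsOf⁻ C′ (If m k)) (λ m k → ∈-cellsOf⁻ C′ (Ig m k))) (sym (pair-form KS g rest)))
  where
  open ≡-Reasoning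
  unique : Unique (cellsOf C′ ++ Lʳ)
  unique = AllPairs-resp-↭ (λ n e → n (sym e)) perm (cellsOf-unique C)
  closed : ClosedOn (InCyl C′) (form KS rest)
  closed i j c _ a b d e = begin
    curl (form KS rest) i j c                                    ≡⟨ curl-KS rest i j c ⟩
    ∑ rest (ev (nflux i j c)) + bd rest (nside i j c)            ≡⟨ cong₂ _+_ (∑-zero rest λ x m → nflux-off i j c x λ q k φ → ∉-++ unique (∈-cellsOf⁺ C′ (faces q φ)) (I m k)) (trans (F (nside i j c)) (cong -_ outside)) ⟩
    + 0 ∎
    where
    faces : ∀ q → Face i j c q → InCyl C′ q
    faces _ f₀₀ = a
    faces _ f₁₀ = b
    faces _ f₀₁ = d
    faces _ f₁₁ = e
    in-C : ∀ {q} → InCyl C′ q → InCyl C q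
    in-C m = ∈-cellsOf⁻ C (∈-resp-↭ (↭-sym perm) (∈-++⁺ˡ (∈-cellsOf⁺ C′ m)))
    φ : Cube → ℤ
    φ q = ε q * nside i j c q
    -- The coloured sum vanishes over the large cylinder and over the small one, hence over the
    -- complement, which need not be a cylinder.
    outside : ∑ Lʳ φ ≡ + 0
    outside = begin
      ∑ Lʳ φ                        ≡⟨ sym (ℤP.+-identityˡ (∑ Lʳ φ)) ⟩
      + 0 + ∑ Lʳ φ                  ≡⟨ cong (_+ ∑ Lʳ φ) (sym (εsum-nside C′ i j c faces)) ⟩
      ∑ (cellsOf C′) φ + ∑ Lʳ φ     ≡⟨ sym (∑-++ (cellsOf C′) Lʳ φ) ⟩
      ∑ (cellsOf C′ ++ Lʳ) φ        ≡⟨ sym (∑-↭ φ perm) ⟩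
      ∑ (cellsOf C) φ               ≡⟨ εsum-nside C i j c (λ q f → in-C (faces q f)) ⟩
      + 0 ∎

square : List Domino → ℤ
square f = pair KB f f

insert-square : ∀ ctx f R → square (ctx ++ (f ++ R)) ≡ square f + pair KS f (ctx ++ R) + square (ctx ++ R)
insert-square ctx f R = trans (pair-↭ KB perm perm) (pair-square-++ f (ctx ++ R))
  where
  perm : ctx ++ (f ++ R) ↭ f ++ (ctx ++ R)
  perm = ↭-trans (↭-sym (PermP.++-assoc ctx f R)) (↭-trans (PermP.++⁺ʳ R (PermP.++-comm ctx f)) (PermP.++-assoc f ctx R))

union : ∀ {m} → (Fin m → List Domino) → List Domino
union u = concat (tabulate u)

cellsOfAll : ∀ {m} → (Fin m → Cylinder) → List Cube
cellsOfAll Cs = concat (tabulate (λ i → cellsOf (Cs i)))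

union-fills : ∀ {m} (Cs : Fin m → Cylinder) u → (∀ i → Fills (cellsOf (Cs i)) (u i)) → Fills (cellsOfAll Cs) (union u)
union-fills {zero} Cs u F h = refl
union-fills {suc m} Cs u F = Fills-++ {cellsOf (Cs Fin.zero)} {f = u Fin.zero} (F Fin.zero) (union-fills (λ i → Cs (Fin.suc i)) (λ i → u (Fin.suc i)) (λ i → F (Fin.suc i)))

union-covers : ∀ {m} (Cs : Fin m → Cylinder) u → (∀ i → CoversIn (cellsOf (Cs i)) (u i)) → CoversIn (cellsOfAll Cs) (union u)
union-covers {suc m} Cs u F = CoversIn-++ {cellsOf (Cs Fin.zero)} {f = u Fin.zero} (F Fin.zero) (union-covers (λ i → Cs (Fin.suc i)) (λ i → u (Fin.suc i)) (λ i → F (Fin.suc i)))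

-- The fillings t i are replaced by the fillings g i one at a time; ctx holds those already replaced.
exchange : ∀ C {m} (Cs : Fin m → Cylinder) → (∀ i → IsCylinder (Cs i)) → ∀ Lᶜ ctx →
  Fills Lᶜ ctx → CoversIn Lᶜ ctx → cellsOf C ↭ Lᶜ ++ cellsOfAll Cs →
  (t g : Fin m → List Domino) → (∀ i → Fills (cellsOf (Cs i)) (t i)) → (∀ i → Fills (cellsOf (Cs i)) (g i)) →
  (∀ i → CoversIn (cellsOf (Cs i)) (t i)) → (∀ i → CoversIn (cellsOf (Cs i)) (g i)) →
  square (ctx ++ union t) - ∑ (tabulate t) square ≡ square (ctx ++ union g) - ∑ (tabulate g) square
exchange C {zero} Cs cyls Lᶜ ctx F I perm t g Ft Fg It Ig = refl
exchange C {suc m} Cs cyls Lᶜ ctx F I perm t g Ft Fg It Ig = begin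
  square (ctx ++ (t₀ ++ T)) - (square t₀ + ∑ (tabulate t′) square)
    ≡⟨ cong (λ w → w - (square t₀ + ∑ (tabulate t′) square)) (insert-square ctx t₀ T) ⟩
  square t₀ + pair KS t₀ (ctx ++ T) + square (ctx ++ T) - (square t₀ + ∑ (tabulate t′) square)
    ≡⟨ cong (λ w → square t₀ + w + square (ctx ++ T) - (square t₀ + ∑ (tabulate t′) square)) same-linking ⟩
  square t₀ + pair KS g₀ (ctx ++ T) + square (ctx ++ T) - (square t₀ + ∑ (tabulate t′) square)
    ≡⟨ r (square t₀) (pair KS g₀ (ctx ++ T)) (square (ctx ++ T)) (∑ (tabulate t′) square) (square g₀) ⟩
  square g₀ + pair KS g₀ (ctx ++ T) + square (ctx ++ T) - ∑ (tabulate t′) square - square g₀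
    ≡⟨ cong (λ w → w - ∑ (tabulate t′) square - square g₀) (trans (sym (insert-square ctx g₀ T)) (cong square (sym (ListP.++-assoc ctx g₀ T)))) ⟩
  square ((ctx ++ g₀) ++ T) - ∑ (tabulate t′) square - square g₀
    ≡⟨ cong (_- square g₀) (exchange C Cs′ (λ i → cyls (Fin.suc i)) (Lᶜ ++ L₀) (ctx ++ g₀) (Fills-++ {Lᶜ} {f = ctx} F (Fg Fin.zero)) (CoversIn-++ {Lᶜ} {f = ctx} I (Ig Fin.zero))
         (↭-trans perm (↭-sym (PermP.++-assoc Lᶜ L₀ (cellsOfAll Cs′)))) t′ g′ (λ i → Ft (Fin.suc i)) (λ i → Fg (Fin.suc i)) (λ i → It (Fin.suc i)) (λ i → Ig (Fin.suc i))) ⟩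
  square ((ctx ++ g₀) ++ union g′) - ∑ (tabulate g′) square - square g₀
    ≡⟨ cong (λ w → square w - ∑ (tabulate g′) square - square g₀) (ListP.++-assoc ctx g₀ (union g′)) ⟩
  square (ctx ++ (g₀ ++ union g′)) - ∑ (tabulate g′) square - square g₀
    ≡⟨ r′ (square (ctx ++ (g₀ ++ union g′))) (∑ (tabulate g′) square) (square g₀) ⟩
  square (ctx ++ (g₀ ++ union g′)) - (square g₀ + ∑ (tabulate g′) square) ∎
  where
  open ≡-Reasoning
  t₀ = t Fin.zero
  g₀ = g Fin.zero
  t′ : Fin m → List Domino
  t′ i = t (Fin.suc i)
  g′ : Fin m → List Domino
  g′ i = g (Fin.suc i)
  Cs′ : Fin m → Cylinder
  Cs′ i = Cs (Fin.suc i)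
  L₀ = cellsOf (Cs Fin.zero)
  T = union t′
  r : ∀ a b c d e → a + b + c - (a + d) ≡ e + b + c - d - e
  r = solve-∀
  r′ : ∀ a b c → a - b - c ≡ a - (c + b)
  r′ = solve-∀
  perm₀ : cellsOf C ↭ L₀ ++ (Lᶜ ++ cellsOfAll Cs′)
  perm₀ = ↭-trans perm (↭-trans (↭-sym (PermP.++-assoc Lᶜ L₀ (cellsOfAll Cs′))) (↭-trans (PermP.++⁺ʳ (cellsOfAll Cs′) (PermP.++-comm Lᶜ L₀)) (PermP.++-assoc L₀ Lᶜ (cellsOfAll Cs′))))
  same-linking : pair KS t₀ (ctx ++ T) ≡ pair KS g₀ (ctx ++ T)
  same-linking = linking-constant C (Cs Fin.zero) (cyls Fin.zero) (Lᶜ ++ cellsOfAll Cs′) (ctx ++ T) perm₀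
    (Fills-++ {Lᶜ} {f = ctx} F (union-fills Cs′ t′ (λ i → Ft (Fin.suc i)))) (CoversIn-++ {Lᶜ} {f = ctx} I (union-covers Cs′ t′ (λ i → It (Fin.suc i))))
    t₀ g₀ (Ft Fin.zero) (Fg Fin.zero) (It Fin.zero) (Ig Fin.zero)

union-tiling : ∀ C {m} (Cs : Fin m → Cylinder) → (∀ c → InCyl C c ⇔ ∃ λ i → InCyl (Cs i) c) →
  (∀ i j c → i ≢ j → InCyl (Cs i) c → ¬ InCyl (Cs j) c) → (t : Fin m → List Domino) →
  (∀ i → IsTiling (InCyl (Cs i)) (t i)) → IsTiling (InCyl C) (union t)
union-tiling C Cs cover apart t T =
    AllP.concat⁺ (AllP.tabulate⁺ λ i → proj₁ (T i))
  , AllP.concat⁺ (AllP.tabulate⁺ λ i → All.map (λ h c k → Equivalence.from (cover c) (i , h c k)) (proj₁ (proj₂ (T i))))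
  , (λ c m → covered c (Equivalence.to (cover c) m))
  , AllPairsP.concat⁺ (AllP.tabulate⁺ λ i → tiling-disjoint (T i)) (AllPairsP.tabulate⁺ λ {i} {j} i≢j →
      All.tabulate λ d∈ → All.tabulate λ e∈ c k k′ → apart i j c i≢j (tiling-inside (T i) d∈ k) (tiling-inside (T j) e∈ k′))
  where
  covered : ∀ c → (∃ λ i → InCyl (Cs i) c) → Any (λ d → Covers d c) (union t)
  covered c (i , m) with tiling-covered (T i) m
  ... | d , d∈ , k = lose (∈-concat⁺′ d∈ (∈-tabulate⁺ i)) k

cells-partition : ∀ C {m} (Cs : Fin m → Cylinder) → (∀ c → InCyl C c ⇔ ∃ λ i → InCyl (Cs i) c) →
  (∀ i j c → i ≢ j → InCyl (Cs i) c → ¬ InCyl (Cs j) c) → cellsOf C ↭ cellsOfAll Cs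
cells-partition C Cs cover apart = unique-↭ (cellsOf-unique C)
  (UniqueP.concat⁺ (AllP.tabulate⁺ λ i → cellsOf-unique (Cs i)) (AllPairsP.tabulate⁺ λ {i} {j} i≢j {c} (m , m′) →
    apart i j c i≢j (∈-cellsOf⁻ (Cs i) m) (∈-cellsOf⁻ (Cs j) m′)))
  into onto
  where
  into : ∀ {c} → c ∈ cellsOf C → c ∈ cellsOfAll Cs
  into {c} m with Equivalence.to (cover c) (∈-cellsOf⁻ C m)
  ... | i , h = ∈-concat⁺′ (∈-cellsOf⁺ (Cs i) h) (∈-tabulate⁺ i)
  onto : ∀ {c} → c ∈ cellsOfAll Cs → c ∈ cellsOf C
  onto {c} m with ∈-concat⁻′ (tabulate (λ i → cellsOf (Cs i))) m
  ... | L , c∈ , L∈ with ∈-tabulate⁻ L∈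
  ... | i , refl = ∈-cellsOf⁺ C (Equivalence.from (cover c) (i , ∈-cellsOf⁻ (Cs i) c∈))

-- Defined for all integers, since divisibility by 4 is derived only once tilings of the pieces are
-- given.
quarter : ℤ → ℤ
quarter (+ n) = + (n ℕ./ 4)
quarter -[1+ n ] = - (+ (suc n ℕ./ 4))

quarter-4* : ∀ k → quarter (+ 4 * k) ≡ k
quarter-4* (+ k) = trans (cong quarter (sym (ℤP.pos-* 4 k))) (cong +_ (trans (cong (ℕ._/ 4) (ℕP.*-comm 4 k)) (ℕDM.m*n/n≡m k 4)))
quarter-4* -[1+ k ] = cong (λ n → - (+ n)) (trans (cong (ℕ._/ 4) (ℕP.*-comm 4 (suc k))) (ℕDM.m*n/n≡m (suc k) 4))

squares-quarter : ∀ {m} (Cs : Fin m → Cylinder) → (∀ i → IsCylinder (Cs i)) → (t : Fin m → List Domino) →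
  (∀ i → IsTiling (InCyl (Cs i)) (t i)) → Σ ℤ λ k → ∑ (tabulate t) square ≡ + 4 * k
squares-quarter {zero} Cs cyls t T = + 0 , refl
squares-quarter {suc m} Cs cyls t T with integral (Cs Fin.zero) (cyls Fin.zero) (t Fin.zero) (T Fin.zero)
  | squares-quarter (λ i → Cs (Fin.suc i)) (λ i → cyls (Fin.suc i)) (λ i → t (Fin.suc i)) (λ i → T (Fin.suc i))
... | k , e | k′ , e′ = k + k′ , trans (cong₂ _+_ e e′) (sym (ℤP.*-distribˡ-+ (+ 4) k k′))

sum-Tw : ∀ {m} (t : Fin m → List Domino) → sumℚ (tabulate (λ i → Tw (t i))) ≡ ∑ (tabulate t) square ℚ./ 4
sum-Tw {zero} t = refl
sum-Tw {suc m} t = trans (cong₂ ℚ._+_ (Tw-pair (t Fin.zero)) (sum-Tw (λ i → t (Fin.suc i))))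
  (sym (quarters-+ (square (t Fin.zero)) (∑ (tabulate (λ i → t (Fin.suc i))) square)))

module Decomposition (C : Cylinder) (cyl-C : IsCylinder C) {m : ℕ} (Cs : Fin m → Cylinder) (cyls : ∀ i → IsCylinder (Cs i))
  (cover : ∀ c → InCyl C c ⇔ ∃ λ i → InCyl (Cs i) c) (apart : ∀ i j c → i ≢ j → InCyl (Cs i) c → ¬ InCyl (Cs j) c) where
  private
    ref : Fin m → List Domino
    ref i = Reference.reference (Cs i) (cyls i)

  -- The linking of the pieces, computed on the reference chains.  The division by 4 is exact if
  -- every piece has a tiling.
  constant : ℤ
  constant = quarter (square (union ref) - ∑ (tabulate ref) square)

  Tw-union : ∀ (t : Fin m → List Domino) → (∀ i → IsTiling (InCyl (Cs i)) (t i)) →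
    Tw (union t) ≡ constant ℚ./ 1 ℚ.+ sumℚ (tabulate (λ i → Tw (t i)))
  Tw-union t T = begin
    Tw (union t)                                            ≡⟨ Tw-pair (union t) ⟩
    square (union t) ℚ./ 4                                  ≡⟨ cong (ℚ._/ 4) total ⟩
    (+ 4 * constant + ∑ (tabulate t) square) ℚ./ 4          ≡⟨ quarters-+ (+ 4 * constant) (∑ (tabulate t) square) ⟩
    (+ 4 * constant) ℚ./ 4 ℚ.+ ∑ (tabulate t) square ℚ./ 4  ≡⟨ cong₂ ℚ._+_ (quarter-of-4* constant) (sym (sum-Tw t)) ⟩
    constant ℚ./ 1 ℚ.+ sumℚ (tabulate (λ i → Tw (t i))) ∎
    where
    open ≡-Reasoning
    link = square (union ref) - ∑ (tabulate ref) square
    same : square (union t) - ∑ (tabulate t) square ≡ link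
    same = exchange C Cs cyls [] [] (λ _ → refl) (λ ()) (cells-partition C Cs cover apart) t ref
      (λ i → cylinder-fills (Cs i) (T i)) (λ i → Reference.reference-fills (Cs i) (cyls i) (tiling-balanced (Cs i) (T i)))
      (λ i d∈ k → ∈-cellsOf⁺ (Cs i) (tiling-inside (T i) d∈ k)) (λ i d∈ k → ∈-cellsOf⁺ (Cs i) (Reference.reference-inside (Cs i) (cyls i) d∈ k))
    whole = integral C cyl-C (union t) (union-tiling C Cs cover apart t T)
    parts = squares-quarter Cs cyls t T
    r : ∀ a b → + 4 * a - + 4 * b ≡ + 4 * (a - b)
    r = solve-∀
    r′ : ∀ a b → a ≡ a - b + b
    r′ = solve-∀
    -- The linking of the given tilings is divisible by 4 by integrality for the whole and for the
    -- pieces, and it equals the linking of the reference chains.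
    exact-quarter : link ≡ + 4 * constant
    exact-quarter = trans link-4 (cong (+ 4 *_) (sym (trans (cong quarter link-4) (quarter-4* (proj₁ whole - proj₁ parts)))))
      where
      link-4 : link ≡ + 4 * (proj₁ whole - proj₁ parts)
      link-4 = trans (sym same) (trans (cong₂ _-_ (proj₂ whole) (proj₂ parts)) (r (proj₁ whole) (proj₁ parts)))
    total : square (union t) ≡ + 4 * constant + ∑ (tabulate t) square
    total = trans (r′ (square (union t)) (∑ (tabulate t) square)) (cong (_+ ∑ (tabulate t) square) (trans same exact-quarter))

theorem1p3 : (∀ (C : Cylinder) → IsCylinder C → ∀ (t : List Domino) → IsTiling (InCyl C) t →
    ∃ λ (k : ℤ) → Tw t ≡ k ℚ./ 1)
    × (∀ (C : Cylinder) → IsCylinder C → ∀ (t₀ t₁ : List Domino) →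
    IsTiling (InCyl C) t₀ → IsTiling (InCyl C) t₁ → Flip t₀ t₁ → Tw t₁ ≡ Tw t₀)
    × (∀ (C : Cylinder) → IsCylinder C → ∀ (t₀ t₁ : List Domino) →
    IsTiling (InCyl C) t₀ → IsTiling (InCyl C) t₁ → PositiveTrit t₀ t₁ →
    Tw t₁ ℚ.- Tw t₀ ≡ 1ℚ)
    × (∀ (D : List Sq) → IsCylBase D → ∀ (t : List Domino) → IsTiling (InCyl (duplex D)) t →
    Tw t ≡ Pderiv1 t ℚ./ 1)
    × (∀ (C : Cylinder) → IsCylinder C → ∀ (m : ℕ) (Cs : Fin m → Cylinder) →
    (∀ i → IsCylinder (Cs i)) →
    (∀ c → InCyl C c ⇔ ∃ λ i → InCyl (Cs i) c) →
    (∀ i j c → i ≢ j → InCyl (Cs i) c → ¬ InCyl (Cs j) c) →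
    ∃ λ (K : ℤ) → ∀ (ts : Fin m → List Domino) →
    (∀ i → IsTiling (InCyl (Cs i)) (ts i)) →
    Tw (concat (tabulate ts)) ≡ K ℚ./ 1 ℚ.+ sumℚ (tabulate (λ i → Tw (ts i))))
theorem1p3 = integer , flips , trits , duplexes , λ C cyl-C m Cs cyls cover apart →
    Decomposition.constant C cyl-C Cs cyls cover apart , Decomposition.Tw-union C cyl-C Cs cyls cover apart
  where
  integer : ∀ (C : Cylinder) → IsCylinder C → ∀ (t : List Domino) → IsTiling (InCyl C) t → ∃ λ (k : ℤ) → Tw t ≡ k ℚ./ 1
  integer C cyl-C t T = proj₁ k , trans (Tw-pair t) (trans (cong (ℚ._/ 4) (proj₂ k)) (quarter-of-4* (proj₁ k)))
    where k = integral C cyl-C t T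
  flips : ∀ (C : Cylinder) → IsCylinder C → ∀ (t₀ t₁ : List Domino) →
    IsTiling (InCyl C) t₀ → IsTiling (InCyl C) t₁ → Flip t₀ t₁ → Tw t₁ ≡ Tw t₀
  flips C _ t₀ t₁ T₀ T₁ f = trans (Tw-pair t₁) (trans (cong (ℚ._/ 4) (flip-invariant C t₀ t₁ T₀ T₁ f)) (sym (Tw-pair t₀)))
  trits : ∀ (C : Cylinder) → IsCylinder C → ∀ (t₀ t₁ : List Domino) →
    IsTiling (InCyl C) t₀ → IsTiling (InCyl C) t₁ → PositiveTrit t₀ t₁ → Tw t₁ ℚ.- Tw t₀ ≡ 1ℚ
  trits C _ t₀ t₁ T₀ T₁ f = begin
    Tw t₁ ℚ.- Tw t₀                                          ≡⟨ cong₂ ℚ._-_ (Tw-pair t₁) (Tw-pair t₀) ⟩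
    square t₁ ℚ./ 4 ℚ.- square t₀ ℚ./ 4                      ≡⟨ cong (λ w → w ℚ./ 4 ℚ.- square t₀ ℚ./ 4) four-more ⟩
    (+ 4 + square t₀) ℚ./ 4 ℚ.- square t₀ ℚ./ 4              ≡⟨ cong (ℚ._- square t₀ ℚ./ 4) (quarters-+ (+ 4) (square t₀)) ⟩
    1ℚ ℚ.+ square t₀ ℚ./ 4 ℚ.- square t₀ ℚ./ 4               ≡⟨ ℚP.+-assoc 1ℚ (square t₀ ℚ./ 4) (ℚ.- (square t₀ ℚ./ 4)) ⟩
    1ℚ ℚ.+ (square t₀ ℚ./ 4 ℚ.- square t₀ ℚ./ 4)             ≡⟨ cong (1ℚ ℚ.+_) (ℚP.+-inverseʳ (square t₀ ℚ./ 4)) ⟩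
    1ℚ ∎
    where
    open ≡-Reasoning
    l : ∀ a b → a ≡ a - b + b
    l = solve-∀
    four-more : square t₁ ≡ + 4 + square t₀
    four-more = trans (l (square t₁) (square t₀)) (cong (_+ square t₀) (trit-increases C t₀ t₁ T₀ T₁ f))
  duplexes : ∀ (D : List Sq) → IsCylBase D → ∀ (t : List Domino) → IsTiling (InCyl (duplex D)) t → Tw t ≡ Pderiv1 t ℚ./ 1
  duplexes D cb t T = trans (Tw-pair t) (trans (cong (ℚ._/ 4) (Duplex.pair-duplex D cb T)) (quarter-of-4* (Pderiv1 t)))
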